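{- Let $\epsilon \in [\frac{1}{11},\frac{1}{2})$ be a real number. Let $p$ be a prime satisfying $$ \log\log p > \frac{\log 6.83}{\frac{1}{2}-\epsilon} \qquad \text{and} \qquad \frac{\phi(p-1)}{p-1}\leq \frac{1}{2}-\epsilon . $$ Then there is a QNRNP $g$ modulo $p$ and an integer $x \in [1,p-1]$ such that $x$ is a QNRNP modulo $p$ and $g^x \equiv x \pmod{p}$.
   Context: For an odd prime $p$, a primitive root modulo $p$ is an integer whose class generates the cyclic group $(\mathbb{Z}/p\mathbb{Z})^*$. An integer is called a QNRNP modulo $p$ if it is a quadratic non-residue modulo $p$ (in particular coprime to $p$) which is not a primitive root modulo $p$. Here $\phi$ is Euler's totient function and $\log$ is the natural logarithm. -}

module Defs where

open import Data.Empty using (⊥; ⊥-elim)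
import Data.Integer as ℤ
import Data.Integer.Coprimality as ℤ
import Data.Integer.Divisibility as ℤ
import Data.Integer.Properties as ℤₚ
open import Data.Integer.Base using (ℤ; +_; -[1+_])
open import Data.List.Base using (length; filter; map; upTo)
open import Data.Nat.Base as ℕ using (ℕ; zero; suc; _∸_)
import Data.Nat.Coprimality as ℕ
import Data.Nat.Properties as ℕₚ
open import Data.Nat.Primality using (Prime; prime⇒nonTrivial)
open import Data.Product.Base using (Σ; ∃; ∃-syntax; _×_; _,_; proj₁; proj₂)
open import Data.Rational.Base
open import Data.Rational.Properties
open import Data.Rational.Solver using (module +-*-Solver)
import Data.Rational.Unnormalised.Base as ℚᵘ
import Data.Rational.Unnormalised.Properties as ℚᵘₚ
open import Data.Sum.Base using (_⊎_; inj₁; inj₂; [_,_]′)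
open import Algebra.Bundles using (CommutativeRing)
open import Relation.Binary.Definitions using (tri<; tri≈; tri>)
open import Relation.Binary.PropositionalEquality
open import Relation.Nullary using (¬_; yes; no)

open import Algebra.Properties.CommutativeSemiring.Exp
  (CommutativeRing.commutativeSemiring +-*-commutativeRing)
  using (_^_; ^-distrib-*; ^-assocʳ)

module ℚ-Lemmas where

  open +-*-Solver using (solve; _:=_; _:+_; _:*_; _:-_; :-_; con)

  lt-by : ∀ {a b d} → 0ℚ < d → b ≡ a + d → a < b
  lt-by {a} {b} {d} 0<d refl =
    subst (_< a + d) (+-identityʳ a) (+-monoʳ-< a 0<d)

  le-by : ∀ {a b d} → 0ℚ ≤ d → b ≡ a + d → a ≤ b
  le-by {a} {b} {d} 0≤d refl =
    subst (_≤ a + d) (+-identityʳ a) (+-monoʳ-≤ a 0≤d)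

  sub-pos : ∀ {a b} → a < b → 0ℚ < b - a
  sub-pos {a} {b} a<b = subst (_< b - a) (+-inverseʳ a) (+-monoˡ-< (- a) a<b)

  sub-nonneg : ∀ {a b} → a ≤ b → 0ℚ ≤ b - a
  sub-nonneg {a} {b} a≤b = subst (_≤ b - a) (+-inverseʳ a) (+-monoˡ-≤ (- a) a≤b)

  0<1 : 0ℚ < 1ℚ
  0<1 = positive⁻¹ 1ℚ

  0≤1 : 0ℚ ≤ 1ℚ
  0≤1 = <⇒≤ 0<1

  +-pos : ∀ {a b} → 0ℚ < a → 0ℚ < b → 0ℚ < a + b
  +-pos = +-mono-<

  +-pos-nonneg : ∀ {a b} → 0ℚ < a → 0ℚ ≤ b → 0ℚ < a + b
  +-pos-nonneg = +-mono-<-≤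

  +-nonneg : ∀ {a b} → 0ℚ ≤ a → 0ℚ ≤ b → 0ℚ ≤ a + b
  +-nonneg = +-mono-≤

  *-pos : ∀ {a b} → 0ℚ < a → 0ℚ < b → 0ℚ < a * b
  *-pos {a} {b} 0<a 0<b = positive⁻¹ (a * b)
    {{pos*pos⇒pos a {{positive 0<a}} b {{positive 0<b}}}}

  *-nonneg : ∀ {a b} → 0ℚ ≤ a → 0ℚ ≤ b → 0ℚ ≤ a * b
  *-nonneg {a} {b} 0≤a 0≤b = nonNegative⁻¹ (a * b)
    {{nonNeg*nonNeg⇒nonNeg a {{nonNegative 0≤a}} b {{nonNegative 0≤b}}}}

  *-monoʳ-<′ : ∀ {c a b} → 0ℚ < c → a < b → c * a < c * b
  *-monoʳ-<′ {c} {a} {b} 0<c a<b = lt-by (*-pos 0<c (sub-pos a<b))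
    (solve 3 (λ c a b → c :* b := c :* a :+ c :* (b :- a)) refl c a b)

  *-monoˡ-<′ : ∀ {c a b} → 0ℚ < c → a < b → a * c < b * c
  *-monoˡ-<′ {c} {a} {b} 0<c a<b = lt-by (*-pos 0<c (sub-pos a<b))
    (solve 3 (λ c a b → b :* c := a :* c :+ c :* (b :- a)) refl c a b)

  *-monoʳ-≤′ : ∀ {c a b} → 0ℚ ≤ c → a ≤ b → c * a ≤ c * b
  *-monoʳ-≤′ {c} {a} {b} 0≤c a≤b = le-by (*-nonneg 0≤c (sub-nonneg a≤b))
    (solve 3 (λ c a b → c :* b := c :* a :+ c :* (b :- a)) refl c a b)

  *-monoˡ-≤′ : ∀ {c a b} → 0ℚ ≤ c → a ≤ b → a * c ≤ b * c
  *-monoˡ-≤′ {c} {a} {b} 0≤c a≤b = le-by (*-nonneg 0≤c (sub-nonneg a≤b))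
    (solve 3 (λ c a b → b :* c := a :* c :+ c :* (b :- a)) refl c a b)

  *-cancelʳ-<′ : ∀ {c a b} → 0ℚ < c → a * c < b * c → a < b
  *-cancelʳ-<′ {c} 0<c = *-cancelʳ-<-nonNeg c {{nonNegative (<⇒≤ 0<c)}}

  *-mono-≤′ : ∀ {a b c d} → 0ℚ ≤ a → 0ℚ ≤ d → a ≤ b → c ≤ d → a * c ≤ b * d
  *-mono-≤′ 0≤a 0≤d a≤b c≤d = ≤-trans (*-monoʳ-≤′ 0≤a c≤d) (*-monoˡ-≤′ 0≤d a≤b)

  square-nonneg : ∀ x → 0ℚ ≤ x * x
  square-nonneg x with ≤-total 0ℚ x
  ... | inj₁ 0≤x = *-nonneg 0≤x 0≤x
  ... | inj₂ x≤0 = subst (0ℚ ≤_)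
    (solve 1 (λ x → (:- x) :* (:- x) := x :* x) refl x) (*-nonneg 0≤-x 0≤-x)
    where
    0≤-x : 0ℚ ≤ - x
    0≤-x = neg-antimono-≤ x≤0

  recip : ∀ c → 0ℚ < c → ∃[ i ] (0ℚ < i × c * i ≡ 1ℚ)
  recip c 0<c = (1/ c) {{nz}} , positive⁻¹ _ {{1/pos⇒pos c {{pc}}}} , *-inverseʳ c {{nz}}
    where
    pc : Positive c
    pc = positive 0<c
    nz : NonZero c
    nz = pos⇒nonZero c {{pc}}

  abs-bound : ∀ q → ∃[ b ] (0ℚ ≤ b × q ≤ b × - q ≤ b)
  abs-bound q with ≤-total 0ℚ q
  ... | inj₁ 0≤q = q , 0≤q , ≤-refl , ≤-trans (neg-antimono-≤ 0≤q) 0≤q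
  ... | inj₂ q≤0 = - q , neg-antimono-≤ q≤0 , ≤-trans q≤0 (neg-antimono-≤ q≤0) , ≤-refl

  ι : ℕ → ℚ
  ι zero    = 0ℚ
  ι (suc n) = 1ℚ + ι n

  -- Opaque, because otherwise arithmetic on it unfolds to gcd computations.
  opaque
    inv : ℕ → ℚ
    inv k = + 1 / suc k

    inv-def : ∀ k → inv k ≡ + 1 / suc k
    inv-def k = refl

  ι-nonneg : ∀ n → 0ℚ ≤ ι n
  ι-nonneg zero    = ≤-refl
  ι-nonneg (suc n) = +-nonneg 0≤1 (ι-nonneg n)

  ι-pos : ∀ n → 0ℚ < ι (suc n)
  ι-pos n = +-pos-nonneg 0<1 (ι-nonneg n)

  toℚᵘ-ι : ∀ n → toℚᵘ (ι n) ℚᵘ.≃ ℚᵘ.mkℚᵘ (+ n) 0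
  toℚᵘ-ι zero    = ℚᵘₚ.≃-refl
  toℚᵘ-ι (suc n) = ℚᵘₚ.≃-trans (toℚᵘ-homo-+ 1ℚ (ι n))
    (ℚᵘₚ.≃-trans (ℚᵘₚ.+-congʳ ℚᵘ.1ℚᵘ (toℚᵘ-ι n)) (ℚᵘ.*≡* (begin
      (+ 1 ℤ.* + 1 ℤ.+ + n ℤ.* + 1) ℤ.* + 1 ≡⟨ ℤₚ.*-identityʳ _ ⟩
      + 1 ℤ.* + 1 ℤ.+ + n ℤ.* + 1           ≡⟨ cong (λ z → + 1 ℤ.+ z) (ℤₚ.*-identityʳ (+ n)) ⟩
      + suc n                               ≡⟨ ℤₚ.*-identityʳ (+ suc n) ⟨
      + suc n ℤ.* + 1                       ∎)))
    where open ≡-Reasoning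

  inv-ι : ∀ k → inv k * ι (suc k) ≡ 1ℚ
  inv-ι k = toℚᵘ-injective (ℚᵘₚ.≃-trans (toℚᵘ-homo-* (inv k) (ι (suc k)))
    (ℚᵘₚ.≃-trans (ℚᵘₚ.*-cong (ℚᵘₚ.≃-trans (toℚᵘ-cong (inv-def k)) (toℚᵘ-fromℚᵘ (ℚᵘ.mkℚᵘ (+ 1) k))) (toℚᵘ-ι (suc k)))
      (ℚᵘ.*≡* (begin
        + 1 ℤ.* + suc k ℤ.* + 1 ≡⟨ ℤₚ.*-identityʳ _ ⟩
        + 1 ℤ.* + suc k         ≡⟨ cong (λ m → + 1 ℤ.* + m) (ℕₚ.*-identityʳ (suc k)) ⟨
        + 1 ℤ.* + (suc k ℕ.* 1) ∎))))
    where open ≡-Reasoning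

  inv-pos : ∀ k → 0ℚ < inv k
  inv-pos k = *-cancelʳ-<′ (ι-pos k)
    (subst₂ _<_ (sym (*-zeroˡ (ι (suc k)))) (sym (inv-ι k)) 0<1)

  inv-zero : inv 0 ≡ 1ℚ
  inv-zero = inv-def 0

  1≡inv+ : ∀ k → 1ℚ ≡ inv k + inv k * ι k
  1≡inv+ k = trans (sym (inv-ι k))
    (solve 2 (λ h n → h :* (con 1ℚ :+ n) := h :+ h :* n) refl (inv k) (ι k))

  inv≤1 : ∀ k → inv k ≤ 1ℚ
  inv≤1 k = le-by (*-nonneg (<⇒≤ (inv-pos k)) (ι-nonneg k)) (1≡inv+ k)

  inv<1 : ∀ k → inv (suc k) < 1ℚ
  inv<1 k = lt-by (*-pos (inv-pos (suc k)) (ι-pos k)) (1≡inv+ (suc k))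

  ι-+ : ∀ m n → ι (m ℕ.+ n) ≡ ι m + ι n
  ι-+ zero    n = sym (+-identityˡ (ι n))
  ι-+ (suc m) n = trans (cong (λ z → 1ℚ + z) (ι-+ m n)) (sym (+-assoc 1ℚ (ι m) (ι n)))

  ι-* : ∀ m n → ι (m ℕ.* n) ≡ ι m * ι n
  ι-* zero    n = sym (*-zeroˡ (ι n))
  ι-* (suc m) n = begin
    ι (n ℕ.+ m ℕ.* n)  ≡⟨ ι-+ n (m ℕ.* n) ⟩
    ι n + ι (m ℕ.* n)  ≡⟨ cong (λ z → ι n + z) (ι-* m n) ⟩
    ι n + ι m * ι n    ≡⟨ solve 2 (λ m n → n :+ m :* n := (con 1ℚ :+ m) :* n) refl (ι m) (ι n) ⟩
    (1ℚ + ι m) * ι n   ∎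
    where open ≡-Reasoning

  -- suc (j ⊗ k) = suc k * suc j
  infixl 7 _⊗_
  _⊗_ : ℕ → ℕ → ℕ
  j ⊗ k = j ℕ.+ k ℕ.* suc j

  ⊗-comm : ∀ j k → j ⊗ k ≡ k ⊗ j
  ⊗-comm j k = ℕₚ.suc-injective (ℕₚ.*-comm (suc k) (suc j))

  inv-⊗ : ∀ j k → inv (j ⊗ k) ≡ inv j * inv k
  inv-⊗ j k = begin
    H                                   ≡⟨ *-identityʳ H ⟨
    H * 1ℚ                              ≡⟨ cong (H *_) (inv-ι j) ⟨
    H * (inv j * N)                     ≡⟨ cong (λ z → H * z) (*-identityʳ (inv j * N)) ⟨
    H * (inv j * N * 1ℚ)                ≡⟨ cong (λ z → H * (inv j * N * z)) (inv-ι k) ⟨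
    H * (inv j * N * (inv k * M))       ≡⟨ solve 5 (λ h a n b m → h :* (a :* n :* (b :* m)) := a :* b :* (h :* (m :* n)))
                                             refl H (inv j) N (inv k) M ⟩
    inv j * inv k * (H * (M * N))       ≡⟨ cong (λ z → inv j * inv k * (H * z)) (ι-* (suc k) (suc j)) ⟨
    inv j * inv k * (H * ι (suc (j ⊗ k))) ≡⟨ cong (inv j * inv k *_) (inv-ι (j ⊗ k)) ⟩
    inv j * inv k * 1ℚ                  ≡⟨ *-identityʳ _ ⟩
    inv j * inv k                       ∎
    where
    open ≡-Reasoning
    H N M : ℚ
    H = inv (j ⊗ k)
    N = ι (suc j)
    M = ι (suc k)

  archimedean : ∀ q → ∃[ k ] q < ι (suc k)
  archimedean q@(mkℚ n d _) = ℤ.∣ n ∣ , toℚᵘ-cancel-<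
    (ℚᵘₚ.<-respʳ-≃ (ℚᵘₚ.≃-sym (toℚᵘ-ι (suc ℤ.∣ n ∣))) (ℚᵘ.*<* (lemma n)))
    where
    lemma : ∀ n → n ℤ.* + 1 ℤ.< + suc ℤ.∣ n ∣ ℤ.* + suc d
    lemma (+ m) = subst (ℤ._< + suc m ℤ.* + suc d) (sym (ℤₚ.*-identityʳ (+ m)))
      (ℤ.+<+ (ℕₚ.<-≤-trans (ℕₚ.n<1+n m) (ℕₚ.m≤m*n (suc m) (suc d))))
    lemma -[1+ m ] = subst (ℤ._< + suc (suc m) ℤ.* + suc d)
      (sym (ℤₚ.*-identityʳ -[1+ m ])) ℤ.-<+

  arch : ∀ a {b} → 0ℚ < b → ∃[ k ] a * inv k < b
  arch a {b} 0<b with recip b 0<b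
  ... | i , 0<i , bi≡1 with archimedean (a * i)
  ... | k , ai<n = k , subst₂ _<_ eq₁ eq₂ (*-monoˡ-<′ (*-pos 0<b (inv-pos k)) ai<n)
    where
    open ≡-Reasoning
    eq₁ : a * i * (b * inv k) ≡ a * inv k
    eq₁ = begin
      a * i * (b * inv k)  ≡⟨ solve 4 (λ a i b h → a :* i :* (b :* h) := a :* h :* (b :* i)) refl a i b (inv k) ⟩
      a * inv k * (b * i)  ≡⟨ cong (a * inv k *_) bi≡1 ⟩
      a * inv k * 1ℚ       ≡⟨ *-identityʳ _ ⟩
      a * inv k            ∎
    eq₂ : ι (suc k) * (b * inv k) ≡ b
    eq₂ = begin
      ι (suc k) * (b * inv k)  ≡⟨ solve 3 (λ n b h → n :* (b :* h) := b :* (h :* n)) refl (ι (suc k)) b (inv k) ⟩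
      b * (inv k * ι (suc k))  ≡⟨ cong (b *_) (inv-ι k) ⟩
      b * 1ℚ                   ≡⟨ *-identityʳ b ⟩
      b                        ∎

  ^-nonneg : ∀ {x} n → 0ℚ ≤ x → 0ℚ ≤ x ^ n
  ^-nonneg zero    0≤x = 0≤1
  ^-nonneg (suc n) 0≤x = *-nonneg 0≤x (^-nonneg n 0≤x)

  ^-pos : ∀ {x} n → 0ℚ < x → 0ℚ < x ^ n
  ^-pos zero    0<x = 0<1
  ^-pos (suc n) 0<x = *-pos 0<x (^-pos n 0<x)

  ^-mono : ∀ {x y} n → 0ℚ ≤ x → x ≤ y → x ^ n ≤ y ^ n
  ^-mono zero    0≤x x≤y = ≤-refl
  ^-mono (suc n) 0≤x x≤y =
    *-mono-≤′ 0≤x (^-nonneg n (≤-trans 0≤x x≤y)) x≤y (^-mono n 0≤x x≤y)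

  ^≤1 : ∀ {x} n → 0ℚ ≤ x → x ≤ 1ℚ → x ^ n ≤ 1ℚ
  ^≤1 zero    0≤x x≤1 = ≤-refl
  ^≤1 (suc n) 0≤x x≤1 = *-mono-≤′ {b = 1ℚ} {d = 1ℚ} 0≤x 0≤1 x≤1 (^≤1 n 0≤x x≤1)

  bernoulli : ∀ x n → 0ℚ ≤ 1ℚ + x → 1ℚ + ι n * x ≤ (1ℚ + x) ^ n
  bernoulli x zero    0≤1+x = ≤-reflexive
    (solve 1 (λ x → con 1ℚ :+ con 0ℚ :* x := con 1ℚ) refl x)
  bernoulli x (suc n) 0≤1+x = ≤-trans
    (le-by (*-nonneg (ι-nonneg n) (square-nonneg x))
      (solve 2 (λ n x → (con 1ℚ :+ x) :* (con 1ℚ :+ n :* x)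
                     := con 1ℚ :+ (con 1ℚ :+ n) :* x :+ n :* (x :* x)) refl (ι n) x))
    (*-monoʳ-≤′ 0≤1+x (bernoulli x n 0≤1+x))

  shrink-bound : ∀ R n h i e → 0ℚ ≤ R → 0ℚ ≤ n → h ≤ i → R * n * i < R - e →
                 e < R * (1ℚ + n * - h)
  shrink-bound R n h i e 0≤R 0≤n h≤i small = lt-by
    (+-pos-nonneg (sub-pos small) (*-nonneg (*-nonneg 0≤R 0≤n) (sub-nonneg h≤i)))
    (solve 5 (λ R n h i e → R :* (con 1ℚ :+ n :* (:- h))
      := e :+ ((R :- e :- R :* n :* i) :+ R :* n :* (i :- h))) refl R n h i e)

  shrink-eq : ∀ y h → y ≡ y * (1ℚ + - h) + y * h
  shrink-eq = solve 2 (λ y h → y := y :* (con 1ℚ :+ :- h) :+ y :* h) refl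

  pow-scale : ∀ r y z n → r * (y * z) ^ n ≡ r * y ^ n * z ^ n
  pow-scale r y z n = trans (cong (r *_) (^-distrib-* y z n))
                            (sym (*-assoc r (y ^ n) (z ^ n)))

  inv*inv≤ : ∀ k → inv k * inv 1 ≤ inv k
  inv*inv≤ k = ≤-trans (*-monoʳ-≤′ (<⇒≤ (inv-pos k)) (inv≤1 1))
                       (≤-reflexive (*-identityʳ (inv k)))

  inv*inv<1 : ∀ k → inv k * inv 1 < 1ℚ
  inv*inv<1 k = ≤-<-trans (*-monoˡ-≤′ (<⇒≤ (inv-pos 1)) (inv≤1 k))
    (≤-<-trans (≤-reflexive (*-identityˡ (inv 1))) (inv<1 0))

  small-inv : ∀ a {b} → 0ℚ < b →
              ∃[ h ] ∃[ i ] (0ℚ < h × h < 1ℚ × h ≤ i × a * i < b)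
  small-inv a 0<b = let k , small = arch a 0<b in
    inv k * inv 1 , inv k , *-pos (inv-pos k) (inv-pos 1) ,
    inv*inv<1 k , inv*inv≤ k , small

  lower-base-aux : ∀ {e} r y n h i → 0ℚ < r → 0ℚ < y → h < 1ℚ → h ≤ i →
                   r * y ^ n * ι n * i < r * y ^ n - e → e < r * (y * (1ℚ + - h)) ^ n
  lower-base-aux {e} r y n h i 0<r 0<y h<1 h≤i small =
    <-≤-trans (shrink-bound (r * y ^ n) (ι n) h i e 0≤R (ι-nonneg n) h≤i small)
    (≤-trans (*-monoʳ-≤′ 0≤R (bernoulli (- h) n (<⇒≤ (sub-pos h<1))))
             (≤-reflexive (sym (pow-scale r y (1ℚ + - h) n))))
    where
    0≤R : 0ℚ ≤ r * y ^ n
    0≤R = <⇒≤ (*-pos 0<r (^-pos n 0<y))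

  lower-base : ∀ {e r y} n → 0ℚ < r → 0ℚ < y → e < r * y ^ n →
               ∃[ y′ ] (0ℚ < y′ × y′ < y × e < r * y′ ^ n)
  lower-base {e} {r} {y} n 0<r 0<y e<ryⁿ =
    let h , i , 0<h , h<1 , h≤i , small = small-inv (r * y ^ n * ι n) (sub-pos e<ryⁿ)
    in y * (1ℚ + - h) , *-pos 0<y (sub-pos h<1) , lt-by (*-pos 0<y 0<h) (shrink-eq y h) ,
       lower-base-aux r y n h i 0<r 0<y h<1 h≤i small

open ℚ-Lemmas
open +-*-Solver using (solve; _:=_; _:+_; _:*_; _:-_; :-_; con)

-- Dedekind reals, as located two-sided cuts: L q means q < x, U q means x < q.

record ℝ : Set₁ where
  field
    L U     : ℚ → Set
    L-inh   : ∃ L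
    U-inh   : ∃ U
    L-down  : ∀ {q r} → q < r → L r → L q
    L-open  : ∀ {q} → L q → ∃[ r ] (q < r × L r)
    U-up    : ∀ {q r} → q < r → U q → U r
    U-open  : ∀ {r} → U r → ∃[ q ] (q < r × U q)
    disjoint : ∀ {q} → L q → U q → ⊥
    located : ∀ {q r} → q < r → L q ⊎ U r

open ℝ public

infix 4 _<ℝ_ _≤ℝ_

_<ℝ_ : ℝ → ℝ → Set
x <ℝ y = ∃[ q ] (U x q × L y q)

_≤ℝ_ : ℝ → ℝ → Set
x ≤ℝ y = ∀ q → L x q → L y q

L<U : ∀ x {q r} → L x q → U x r → q < r
L<U x {q} {r} Lq Ur with <-cmp q r
... | tri< q<r _ _ = q<r
... | tri≈ _ refl _ = ⊥-elim (disjoint x Lq Ur)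
... | tri> _ _ r<q = ⊥-elim (disjoint x Lq (U-up x r<q Ur))

<ℝ-trans : ∀ {x y z} → x <ℝ y → y <ℝ z → x <ℝ z
<ℝ-trans {y = y} {z = z} (q , Uxq , Lyq) (r , Uyr , Lzr) =
  q , Uxq , L-down z (L<U y Lyq Uyr) Lzr

fromℚ : ℚ → ℝ
fromℚ p = record
  { L        = _< p
  ; U        = p <_
  ; L-inh    = p - 1ℚ , lt-by 0<1 (solve 1 (λ p → p := (p :- con 1ℚ) :+ con 1ℚ) refl p)
  ; U-inh    = p + 1ℚ , lt-by 0<1 refl
  ; L-down   = <-trans
  ; L-open   = <-dense
  ; U-up     = λ q<r p<q → <-trans p<q q<r
  ; U-open   = λ p<r → let q , p<q , q<r = <-dense p<r in q , q<r , p<q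
  ; disjoint = <-asym
  ; located  = loc
  }
  where
  loc : ∀ {q r} → q < r → q < p ⊎ p < r
  loc {q} q<r with q <? p
  ... | yes q<p = inj₁ q<p
  ... | no  q≮p = inj₂ (≤-<-trans (≮⇒≥ q≮p) q<r)

fromℕ : ℕ → ℝ
fromℕ n = fromℚ (+ n / 1)

0ℝ : ℝ
0ℝ = fromℚ 0ℚ

approx : ∀ y {η} → 0ℚ < η → ∃[ s ] ∃[ t ] (L y s × U y t × t < s + η)
approx y {η} 0<η =
  let s , Ls = L-inh y
      t , Ut = U-inh y
      k , small = arch (t - s) 0<h
  in go (suc k) s Ls (U-up y (bound s t k small) Ut)
  where
  -- Three steps of length h fit into η.
  h : ℚ
  h = η * inv 2
  0<h : 0ℚ < h
  0<h = *-pos 0<η (inv-pos 2)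
  3h : h + h + h ≡ η
  3h = trans
    (solve 2 (λ n i → n :* i :+ n :* i :+ n :* i := n :* (i :* (con 1ℚ :+ (con 1ℚ :+ (con 1ℚ :+ con 0ℚ))))) refl η (inv 2))
    (trans (cong (η *_) (inv-ι 2)) (*-identityʳ η))
  bound : ∀ s t k → (t - s) * inv k < h → t < s + ι (suc k) * h
  bound s t k small = lt-by
    (*-pos (ι-pos k) (sub-pos small))
    (trans (solve 4 (λ s t n h → s :+ n :* h := t :+ (n :* h :- (t :- s) :* con 1ℚ)) refl s t (ι (suc k)) h)
    (trans (cong (λ z → t + (ι (suc k) * h - (t - s) * z)) (sym (inv-ι k)))
      (solve 5 (λ s t n h i → t :+ (n :* h :- (t :- s) :* (i :* n)) := t :+ n :* (h :- (t :- s) :* i))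
        refl s t (ι (suc k)) h (inv k))))
  step : ∀ s n → s + (1ℚ + n) * h ≡ (s + h) + n * h
  step s n = solve 3 (λ s n h → s :+ (con 1ℚ :+ n) :* h := (s :+ h) :+ n :* h) refl s n h
  2h<η : ∀ s → s + h + h < s + η
  2h<η s = lt-by 0<h
    (trans (cong (λ z → s + z) (sym 3h))
      (solve 2 (λ s h → s :+ (h :+ h :+ h) := s :+ h :+ h :+ h) refl s h))
  go : ∀ n s → L y s → U y (s + ι n * h) → ∃[ s ] ∃[ t ] (L y s × U y t × t < s + η)
  go zero s Ls Us = ⊥-elim (disjoint y Ls
    (subst (U y) (solve 2 (λ s h → s :+ con 0ℚ :* h := s) refl s h) Us))
  go (suc n) s Ls Us = [ (λ Lsh → go n (s + h) Lsh (subst (U y) (step s (ι n)) Us))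
                       , (λ Us2h → s , s + h + h , Ls , Us2h , 2h<η s) ]′
    (located y {s + h} {s + h + h} (lt-by 0<h refl))

cancel : ∀ a t → a - t + t ≡ a
cancel = solve 2 (λ a t → a :- t :+ t := a) refl
shiftʳ : ∀ q t a → q + t < a → q < a - t
shiftʳ q t a p = lt-by (sub-pos p)
  (solve 3 (λ q t a → a :- t := q :+ (a :- (q :+ t))) refl q t a)
shiftˡ : ∀ q t a → a < q + t → a - t < q
shiftˡ q t a p = lt-by (sub-pos p)
  (solve 3 (λ q t a → q := (a :- t) :+ ((q :+ t) :- a)) refl q t a)
swap : ∀ q r s t → t < s + (r - q) → q + t < r + s
swap q r s t p = lt-by (sub-pos p)
  (solve 4 (λ q r s t → r :+ s := (q :+ t) :+ (s :+ (r :- q) :- t)) refl q r s t)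

swap′ : ∀ a q m → m < a - q → m + q < a
swap′ a q m p = lt-by (sub-pos p)
  (solve 3 (λ a q m → a := (m :+ q) :+ (a :- q :- m)) refl a q m)

infixl 6 _-ℝ_

_-ℝ_ : ℝ → ℝ → ℝ
x -ℝ y = record
  { L        = L′
  ; U        = U′
  ; L-inh    = let a , La = L-inh x
                   t , Ut = U-inh y
               in a - t , L-intro Ut La
  ; U-inh    = let a , Ua = U-inh x
                   s , Ls = L-inh y
               in a - s , U-intro Ls Ua
  ; L-down   = L-down′
  ; L-open   = L-open′
  ; U-up     = U-up′
  ; U-open   = U-open′
  ; disjoint = λ {q} → disjoint′ {q}
  ; located  = located′
  }
  where
  L′ U′ : ℚ → Set
  L′ q = ∃[ t ] (U y t × L x (q + t))
  U′ q = ∃[ s ] (L y s × U x (q + s))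
  L-intro : ∀ {a t} → U y t → L x a → L′ (a - t)
  L-intro {a} {t} Ut La = t , Ut , subst (L x) (sym (cancel a t)) La
  U-intro : ∀ {a s} → L y s → U x a → U′ (a - s)
  U-intro {a} {s} Ls Ua = s , Ls , subst (U x) (sym (cancel a s)) Ua
  L-down′ : ∀ {q r} → q < r → L′ r → L′ q
  L-down′ q<r (t , Ut , Lrt) = t , Ut , L-down x (+-monoˡ-< t q<r) Lrt
  U-up′ : ∀ {q r} → q < r → U′ q → U′ r
  U-up′ q<r (s , Ls , Uqs) = s , Ls , U-up x (+-monoˡ-< s q<r) Uqs
  L-open′ : ∀ {q} → L′ q → ∃[ r ] (q < r × L′ r)
  L-open′ {q} (t , Ut , Lqt) =
    let a , q+t<a , La = L-open x Lqt in a - t , shiftʳ q t a q+t<a , L-intro Ut La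
  U-open′ : ∀ {r} → U′ r → ∃[ q ] (q < r × U′ q)
  U-open′ {r} (s , Ls , Urs) =
    let a , a<r+s , Ua = U-open x Urs in a - s , shiftˡ r s a a<r+s , U-intro Ls Ua
  disjoint′ : ∀ {q} → L′ q → U′ q → ⊥
  disjoint′ {q} (t , Ut , Lqt) (s , Ls , Uqs) =
    <-asym {q + t} {q + s} (L<U x Lqt Uqs) (+-monoʳ-< q (L<U y Ls Ut))
  located′ : ∀ {q r} → q < r → L′ q ⊎ U′ r
  located′ {q} {r} q<r = split (approx y (sub-pos q<r))
    where
    split : ∃[ s ] ∃[ t ] (L y s × U y t × t < s + (r - q)) → L′ q ⊎ U′ r
    split (s , t , Ls , Ut , t<s+η) =
      [ (λ Lqt → inj₁ (t , Ut , Lqt)) , (λ Urs → inj₂ (s , Ls , Urs)) ]′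
        (located x (swap q r s t t<s+η))

<⇒0<- : ∀ {x y} → x <ℝ y → 0ℝ <ℝ y -ℝ x
<⇒0<- {x} {y} (q , Uxq , Lyq) =
  let a , q<a , La = L-open y Lyq
      m , 0<m , m<a-q = <-dense (sub-pos q<a)
  in m , 0<m , q , Uxq , L-down y (swap′ a q m m<a-q) La

module Division-Lemmas where

  open ≡-Reasoning

  scale-openʳ : ∀ {q s a} → 0ℚ < s → q * s < a → ∃[ r ] (q < r × r * s < a)
  scale-openʳ {q} {s} {a} 0<s qs<a = go (recip s 0<s) (<-dense qs<a)
    where
    go : ∃[ i ] (0ℚ < i × s * i ≡ 1ℚ) → ∃[ m ] (q * s < m × m < a) →
         ∃[ r ] (q < r × r * s < a)
    go (i , 0<i , si≡1) (m , qs<m , m<a) =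
      m * i ,
      *-cancelʳ-<′ 0<s (subst (q * s <_) (sym (mis m i si≡1)) qs<m) ,
      subst (_< a) (sym (mis m i si≡1)) m<a
      where
      mis : ∀ m i → s * i ≡ 1ℚ → m * i * s ≡ m
      mis m i si≡1 = trans (solve 3 (λ m i s → m :* i :* s := m :* (s :* i)) refl m i s)
        (trans (cong (m *_) si≡1) (*-identityʳ m))

  scale-openˡ : ∀ {q s a} → 0ℚ < s → a < q * s → ∃[ r ] (r < q × a < r * s)
  scale-openˡ {q} {s} {a} 0<s a<qs = go (recip s 0<s) (<-dense a<qs)
    where
    go : ∃[ i ] (0ℚ < i × s * i ≡ 1ℚ) → ∃[ m ] (a < m × m < q * s) →
         ∃[ r ] (r < q × a < r * s)
    go (i , 0<i , si≡1) (m , a<m , m<qs) =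
      m * i ,
      *-cancelʳ-<′ 0<s (subst (_< q * s) (sym (mis m i si≡1)) m<qs) ,
      subst (a <_) (sym (mis m i si≡1)) a<m
      where
      mis : ∀ m i → s * i ≡ 1ℚ → m * i * s ≡ m
      mis m i si≡1 = trans (solve 3 (λ m i s → m :* i :* s := m :* (s :* i)) refl m i s)
        (trans (cong (m *_) si≡1) (*-identityʳ m))

  scale₂-openʳ : ∀ {q s t a} → 0ℚ < s → 0ℚ < t → q * s < a → q * t < a →
                 ∃[ r ] (q < r × r * s < a × r * t < a)
  scale₂-openʳ {q} {s} {t} {a} 0<s 0<t qs<a qt<a =
    go (scale-openʳ 0<s qs<a) (scale-openʳ 0<t qt<a)
    where
    go : ∃[ r ] (q < r × r * s < a) → ∃[ r ] (q < r × r * t < a) →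
         ∃[ r ] (q < r × r * s < a × r * t < a)
    go (r₁ , q<r₁ , r₁s<a) (r₂ , q<r₂ , r₂t<a) =
      [ (λ r₁≤r₂ → r₁ , q<r₁ , r₁s<a , ≤-<-trans (*-monoˡ-≤′ {t} {r₁} {r₂} (<⇒≤ 0<t) r₁≤r₂) r₂t<a)
      , (λ r₂≤r₁ → r₂ , q<r₂ , ≤-<-trans (*-monoˡ-≤′ {s} {r₂} {r₁} (<⇒≤ 0<s) r₂≤r₁) r₁s<a , r₂t<a)
      ]′ (≤-total r₁ r₂)

  scale₂-openˡ : ∀ {q s t a} → 0ℚ < s → 0ℚ < t → a < q * s → a < q * t →
                 ∃[ r ] (r < q × a < r * s × a < r * t)
  scale₂-openˡ {q} {s} {t} {a} 0<s 0<t a<qs a<qt =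
    go (scale-openˡ 0<s a<qs) (scale-openˡ 0<t a<qt)
    where
    go : ∃[ r ] (r < q × a < r * s) → ∃[ r ] (r < q × a < r * t) →
         ∃[ r ] (r < q × a < r * s × a < r * t)
    go (r₁ , r₁<q , a<r₁s) (r₂ , r₂<q , a<r₂t) =
      [ (λ r₁≤r₂ → r₂ , r₂<q , <-≤-trans a<r₁s (*-monoˡ-≤′ {s} {r₁} {r₂} (<⇒≤ 0<s) r₁≤r₂) , a<r₂t)
      , (λ r₂≤r₁ → r₁ , r₁<q , a<r₁s , <-≤-trans a<r₂t (*-monoˡ-≤′ {t} {r₂} {r₁} (<⇒≤ 0<t) r₂≤r₁))
      ]′ (≤-total r₁ r₂)

  *-antimono : ∀ {q a b} → q ≤ 0ℚ → a ≤ b → q * b ≤ q * a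
  *-antimono {q} {a} {b} q≤0 a≤b =
    le-by (*-nonneg (neg-antimono-≤ {q} {0ℚ} q≤0) (sub-nonneg a≤b))
      (solve 3 (λ q a b → q :* a := q :* b :+ (:- q) :* (b :- a)) refl q a b)

  -- If q s, q t < a < a′ < q s′, q t′, then [s,t] and [s′,t′] do not overlap.
  no-overlap : ∀ {q s t s′ t′ a a′} → s < t′ → s′ < t → a < a′ →
               q * s < a → q * t < a → a′ < q * s′ → a′ < q * t′ → ⊥
  no-overlap {q} {s} {t} {s′} {t′} s<t′ s′<t a<a′ qs<a qt<a a′<qs′ a′<qt′ =
    [ (λ 0≤q → <-irrefl refl (<-≤-trans (<-trans qt<a (<-trans a<a′ a′<qs′))
                 (*-monoʳ-≤′ {q} {s′} {t} 0≤q (<⇒≤ s′<t))))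
    , (λ q≤0 → <-irrefl refl (<-≤-trans (<-trans qs<a (<-trans a<a′ a′<qt′))
                 (*-antimono {q} {s} {t′} q≤0 (<⇒≤ s<t′))))
    ]′ (≤-total 0ℚ q)

  below-quotient : ∀ a {s t} → 0ℚ < s → s < t → ∃[ q ] (q * s < a × q * t < a)
  below-quotient a {s} {t} 0<s s<t = go (abs-bound a) (recip s 0<s)
    where
    go : ∃[ b ] (0ℚ ≤ b × a ≤ b × - a ≤ b) → ∃[ i ] (0ℚ < i × s * i ≡ 1ℚ) →
         ∃[ q ] (q * s < a × q * t < a)
    go (b , 0≤b , _ , -a≤b) (i , 0<i , si≡1) =
      q , qs<a , ≤-<-trans (*-antimono {q} {s} {t} q≤0 (<⇒≤ s<t)) qs<a
      where
      q : ℚ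
      q = - ((b + 1ℚ) * i)
      q≤0 : q ≤ 0ℚ
      q≤0 = neg-antimono-≤ {0ℚ} {(b + 1ℚ) * i} (*-nonneg (+-nonneg 0≤b 0≤1) (<⇒≤ 0<i))
      qs : q * s ≡ - (b + 1ℚ)
      qs = trans (solve 3 (λ c i s → (:- (c :* i)) :* s := (:- c) :* (s :* i)) refl (b + 1ℚ) i s)
        (trans (cong (- (b + 1ℚ) *_) si≡1) (*-identityʳ _))
      qs<a : q * s < a
      qs<a = subst (_< a) (sym qs) (lt-by (+-pos-nonneg 0<1 (sub-nonneg -a≤b))
        (solve 2 (λ a b → a := :- (b :+ con 1ℚ) :+ (con 1ℚ :+ (b :- (:- a)))) refl a b))

  above-quotient : ∀ a {s t} → 0ℚ < s → s < t → ∃[ q ] (a < q * s × a < q * t)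
  above-quotient a {s} {t} 0<s s<t = go (abs-bound a) (recip s 0<s)
    where
    go : ∃[ b ] (0ℚ ≤ b × a ≤ b × - a ≤ b) → ∃[ i ] (0ℚ < i × s * i ≡ 1ℚ) →
         ∃[ q ] (a < q * s × a < q * t)
    go (b , 0≤b , a≤b , _) (i , 0<i , si≡1) =
      q , a<qs , <-≤-trans a<qs (*-monoʳ-≤′ {q} {s} {t} 0≤q (<⇒≤ s<t))
      where
      q : ℚ
      q = (b + 1ℚ) * i
      0≤q : 0ℚ ≤ q
      0≤q = *-nonneg (+-nonneg 0≤b 0≤1) (<⇒≤ 0<i)
      qs : q * s ≡ b + 1ℚ
      qs = trans (solve 3 (λ c i s → (c :* i) :* s := c :* (s :* i)) refl (b + 1ℚ) i s)
        (trans (cong ((b + 1ℚ) *_) si≡1) (*-identityʳ _))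
      a<qs : a < q * s
      a<qs = subst (a <_) (sym qs) (lt-by (+-pos-nonneg 0<1 (sub-nonneg a≤b))
        (solve 2 (λ a b → b :+ con 1ℚ := a :+ (con 1ℚ :+ (b :- a))) refl a b))

  separate : ∀ {q r s t δ η b c} → q < r → δ ≤ s → s < t → t < s + η →
             0ℚ ≤ b → q ≤ b → 0ℚ ≤ c → - r ≤ c → (b + c) * η < (r - q) * δ →
             ∃[ a ] ∃[ a′ ] (a < a′ × q * s < a × q * t < a × a′ < r * s × a′ < r * t)
  separate {q} {r} {s} {t} {δ} {η} {b} {c} q<r δ≤s s<t t<s+η 0≤b q≤b 0≤c -r≤c small =
    go (<-dense m₁<m₂)
    where
    m₁ m₂ d : ℚ
    d  = t - s
    m₁ = q * s + b * d
    m₂ = r * s - c * d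
    0≤d : 0ℚ ≤ d
    0≤d = <⇒≤ (sub-pos s<t)
    d≤η : d ≤ η
    d≤η = <⇒≤ (lt-by (sub-pos t<s+η)
      (solve 3 (λ s t η → η := (t :- s) :+ (s :+ η :- t)) refl s t η))
    Bd<qrs : (b + c) * d < (r - q) * s
    Bd<qrs = ≤-<-trans (*-monoʳ-≤′ {b + c} {d} {η} (+-nonneg 0≤b 0≤c) d≤η)
      (<-≤-trans small (*-monoʳ-≤′ {r - q} {δ} {s} (<⇒≤ (sub-pos q<r)) δ≤s))
    m₁<m₂ : m₁ < m₂
    m₁<m₂ = lt-by (sub-pos Bd<qrs)
      (eq q r s d b c)
      where
      eq : ∀ q r s d b c → r * s - c * d ≡ (q * s + b * d) + ((r - q) * s - (b + c) * d)
      eq = solve 6 (λ q r s d b c → r :* s :- c :* d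
        := (q :* s :+ b :* d) :+ ((r :- q) :* s :- (b :+ c) :* d)) refl
    qs≤m₁ : q * s ≤ m₁
    qs≤m₁ = le-by (*-nonneg 0≤b 0≤d) refl
    qt≤m₁ : q * t ≤ m₁
    qt≤m₁ = le-by (*-nonneg (sub-nonneg q≤b) 0≤d) (eq q s t b)
      where
      eq : ∀ q s t b → q * s + b * (t - s) ≡ q * t + (b - q) * (t - s)
      eq = solve 4 (λ q s t b → q :* s :+ b :* (t :- s) := q :* t :+ (b :- q) :* (t :- s)) refl
    m₂≤rs : m₂ ≤ r * s
    m₂≤rs = le-by (*-nonneg 0≤c 0≤d) (eq (r * s) (c * d))
      where
      eq : ∀ x y → x ≡ x - y + y
      eq = solve 2 (λ x y → x := x :- y :+ y) refl
    m₂≤rt : m₂ ≤ r * t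
    m₂≤rt = le-by (*-nonneg (sub-nonneg -r≤c) 0≤d) (eq r s t c)
      where
      eq : ∀ r s t c → r * t ≡ (r * s - c * (t - s)) + (c - (- r)) * (t - s)
      eq = solve 4 (λ r s t c → r :* t := (r :* s :- c :* (t :- s)) :+ (c :- (:- r)) :* (t :- s)) refl
    go : ∃[ a ] (m₁ < a × a < m₂) →
         ∃[ a ] ∃[ a′ ] (a < a′ × q * s < a × q * t < a × a′ < r * s × a′ < r * t)
    go (a , m₁<a , a<m₂) = go′ (<-dense a<m₂)
      where
      go′ : ∃[ a′ ] (a < a′ × a′ < m₂) →
            ∃[ a ] ∃[ a′ ] (a < a′ × q * s < a × q * t < a × a′ < r * s × a′ < r * t)
      go′ (a′ , a<a′ , a′<m₂) =
        a , a′ , a<a′ , ≤-<-trans qs≤m₁ m₁<a , ≤-<-trans qt≤m₁ m₁<a ,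
        <-≤-trans a′<m₂ m₂≤rs , <-≤-trans a′<m₂ m₂≤rt

open Division-Lemmas

infixl 7 _/ℝ_[_]

-- For s < y < t with 0 < s, the conditions q * s < a and q * t < a say that
-- q * y′ < a for every y′ in [s, t], so L says q * y < x and U says x < q * y.
_/ℝ_[_] : (x y : ℝ) → 0ℝ <ℝ y → ℝ
x /ℝ y [ (δ₀ , 0<δ₀ , Lδ₀) ] = record
  { L        = L′
  ; U        = U′
  ; L-inh    = L-inh′ (L-inh x) (U-inh y)
  ; U-inh    = U-inh′ (U-inh x) (U-inh y)
  ; L-down   = L-down′
  ; L-open   = L-open′
  ; U-up     = U-up′
  ; U-open   = U-open′
  ; disjoint = λ {q} → disjoint′ {q}
  ; located  = located′
  }
  where
  L′ U′ : ℚ → Set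
  L′ q = ∃[ a ] ∃[ s ] ∃[ t ]
    (L x a × L y s × U y t × 0ℚ < s × q * s < a × q * t < a)
  U′ q = ∃[ a ] ∃[ s ] ∃[ t ]
    (U x a × L y s × U y t × 0ℚ < s × a < q * s × a < q * t)
  L-inh′ : ∃ (L x) → ∃ (U y) → ∃ L′
  L-inh′ (a , La) (t , Ut) =
    let q , qs<a , qt<a = below-quotient a 0<δ₀ (L<U y Lδ₀ Ut)
    in q , a , δ₀ , t , La , Lδ₀ , Ut , 0<δ₀ , qs<a , qt<a
  U-inh′ : ∃ (U x) → ∃ (U y) → ∃ U′
  U-inh′ (a , Ua) (t , Ut) =
    let q , a<qs , a<qt = above-quotient a 0<δ₀ (L<U y Lδ₀ Ut)
    in q , a , δ₀ , t , Ua , Lδ₀ , Ut , 0<δ₀ , a<qs , a<qt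
  L-down′ : ∀ {q r} → q < r → L′ r → L′ q
  L-down′ {q} {r} q<r (a , s , t , La , Ls , Ut , 0<s , rs<a , rt<a) =
    a , s , t , La , Ls , Ut , 0<s ,
    <-trans (*-monoˡ-<′ {s} {q} {r} 0<s q<r) rs<a ,
    <-trans (*-monoˡ-<′ {t} {q} {r} (<-trans 0<s (L<U y Ls Ut)) q<r) rt<a
  U-up′ : ∀ {q r} → q < r → U′ q → U′ r
  U-up′ {q} {r} q<r (a , s , t , Ua , Ls , Ut , 0<s , a<qs , a<qt) =
    a , s , t , Ua , Ls , Ut , 0<s ,
    <-trans a<qs (*-monoˡ-<′ {s} {q} {r} 0<s q<r) ,
    <-trans a<qt (*-monoˡ-<′ {t} {q} {r} (<-trans 0<s (L<U y Ls Ut)) q<r)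
  L-open′ : ∀ {q} → L′ q → ∃[ r ] (q < r × L′ r)
  L-open′ {q} (a , s , t , La , Ls , Ut , 0<s , qs<a , qt<a) =
    let r , q<r , rs<a , rt<a = scale₂-openʳ {q} {s} {t} 0<s (<-trans 0<s (L<U y Ls Ut)) qs<a qt<a
    in r , q<r , a , s , t , La , Ls , Ut , 0<s , rs<a , rt<a
  U-open′ : ∀ {r} → U′ r → ∃[ q ] (q < r × U′ q)
  U-open′ {r} (a , s , t , Ua , Ls , Ut , 0<s , a<rs , a<rt) =
    let q , q<r , a<qs , a<qt = scale₂-openˡ {r} {s} {t} 0<s (<-trans 0<s (L<U y Ls Ut)) a<rs a<rt
    in q , q<r , a , s , t , Ua , Ls , Ut , 0<s , a<qs , a<qt
  disjoint′ : ∀ {q} → L′ q → U′ q → ⊥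
  disjoint′ {q} (a , s , t , La , Ls , Ut , _ , qs<a , qt<a)
                (a′ , s′ , t′ , Ua′ , Ls′ , Ut′ , _ , a′<qs′ , a′<qt′) =
    no-overlap {q} {s} {t} {s′} {t′} (L<U y Ls Ut′) (L<U y Ls′ Ut) (L<U x La Ua′)
      qs<a qt<a a′<qs′ a′<qt′
  located′ : ∀ {q r} → q < r → L′ q ⊎ U′ r
  located′ {q} {r} q<r = bounds (abs-bound q) (abs-bound r)
    where
    Interval : ℚ → Set
    Interval η = ∃[ s ] ∃[ t ] (L y s × U y t × δ₀ ≤ s × t < s + η)
    interval : ∀ {η} → ∃[ s ] ∃[ t ] (L y s × U y t × t < s + η) → Interval η
    interval {η} (s , t , Ls , Ut , t<s+η) =
      [ (λ δ₀≤s → s , t , Ls , Ut , δ₀≤s , t<s+η)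
      , (λ s≤δ₀ → δ₀ , t , Lδ₀ , Ut , ≤-refl , <-≤-trans t<s+η (+-monoˡ-≤ η s≤δ₀))
      ]′ (≤-total δ₀ s)
    compare : ∀ {s t} → L y s → U y t → 0ℚ < s →
      ∃[ a ] ∃[ a′ ] (a < a′ × q * s < a × q * t < a × a′ < r * s × a′ < r * t) →
      L′ q ⊎ U′ r
    compare {s} {t} Ls Ut 0<s (a , a′ , a<a′ , qs<a , qt<a , a′<rs , a′<rt) =
      [ (λ La  → inj₁ (a , s , t , La , Ls , Ut , 0<s , qs<a , qt<a))
      , (λ Ua′ → inj₂ (a′ , s , t , Ua′ , Ls , Ut , 0<s , a′<rs , a′<rt))
      ]′ (located x a<a′)
    bounds : ∃[ b ] (0ℚ ≤ b × q ≤ b × - q ≤ b) → ∃[ c ] (0ℚ ≤ c × r ≤ c × - r ≤ c) →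
             L′ q ⊎ U′ r
    bounds (b , 0≤b , q≤b , _) (c , 0≤c , _ , -r≤c) =
      step (arch (b + c) {(r - q) * δ₀} (*-pos (sub-pos q<r) 0<δ₀))
      where
      step : ∃[ k ] (b + c) * inv k < (r - q) * δ₀ → L′ q ⊎ U′ r
      step (k , small) = finish (interval (approx y (inv-pos k)))
        where
        finish : Interval (inv k) → L′ q ⊎ U′ r
        finish (s , t , Ls , Ut , δ₀≤s , t<s+η) =
          compare Ls Ut (<-≤-trans 0<δ₀ δ₀≤s)
            (separate {q} {r} {s} {t} {δ₀} {inv k} {b} {c}
              q<r δ₀≤s (L<U y Ls Ut) t<s+η 0≤b q≤b 0≤c -r≤c small)

module Exp-Lemmas where

  open ≡-Reasoning

  refine : ∀ x j k → 0ℚ < 1ℚ + x →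
           0ℚ < 1ℚ + x * inv k × (1ℚ + x) ^ suc j ≤ (1ℚ + x * inv k) ^ suc (j ⊗ k)
  refine x j k 0<1+x = 0<1+y , subst ((1ℚ + x) ^ suc j ≤_) (^-assocʳ (1ℚ + y) (suc k) (suc j))
    (^-mono {1ℚ + x} {(1ℚ + y) ^ suc k} (suc j) (<⇒≤ 0<1+x) 1+x≤)
    where
    y : ℚ
    y = x * inv k
    eq₁ : ∀ x i → 1ℚ + x * i ≡ i * (1ℚ + x) + (1ℚ - i)
    eq₁ = solve 2 (λ x i → con 1ℚ :+ x :* i := i :* (con 1ℚ :+ x) :+ (con 1ℚ :- i)) refl
    0<1+y : 0ℚ < 1ℚ + y
    0<1+y = subst (0ℚ <_) (sym (eq₁ x (inv k)))
      (+-pos-nonneg (*-pos (inv-pos k) 0<1+x) (sub-nonneg (inv≤1 k)))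
    eq₂ : ι (suc k) * (x * inv k) ≡ x
    eq₂ = trans (solve 3 (λ n x i → n :* (x :* i) := x :* (i :* n)) refl (ι (suc k)) x (inv k))
      (trans (cong (x *_) (inv-ι k)) (*-identityʳ x))
    1+x≤ : 1ℚ + x ≤ (1ℚ + y) ^ suc k
    1+x≤ = subst (_≤ (1ℚ + y) ^ suc k) (cong (λ z → 1ℚ + z) eq₂)
      (bernoulli y (suc k) (<⇒≤ 0<1+y))

  refine⁺ : ∀ q j k → 0ℚ < 1ℚ + q * inv j → 0ℚ < 1ℚ + q * inv (j ⊗ k) ×
            (1ℚ + q * inv j) ^ suc j ≤ (1ℚ + q * inv (j ⊗ k)) ^ suc (j ⊗ k)
  refine⁺ q j k 0<b = subst
    (λ z → 0ℚ < 1ℚ + z × (1ℚ + q * inv j) ^ suc j ≤ (1ℚ + z) ^ suc (j ⊗ k))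
    (trans (*-assoc q (inv j) (inv k)) (cong (q *_) (sym (inv-⊗ j k))))
    (refine (q * inv j) j k 0<b)

  refine⁻ : ∀ q j k → 0ℚ < 1ℚ - q * inv j → 0ℚ < 1ℚ - q * inv (j ⊗ k) ×
            (1ℚ - q * inv j) ^ suc j ≤ (1ℚ - q * inv (j ⊗ k)) ^ suc (j ⊗ k)
  refine⁻ q j k 0<b = subst
    (λ z → 0ℚ < 1ℚ + z × (1ℚ - q * inv j) ^ suc j ≤ (1ℚ + z) ^ suc (j ⊗ k))
    (trans (solve 3 (λ q i h → (:- (q :* i)) :* h := :- (q :* (i :* h))) refl q (inv j) (inv k))
           (cong (λ z → - (q * z)) (sym (inv-⊗ j k))))
    (refine (- (q * inv j)) j k 0<b)

  base⁺ : ∀ q → ∃[ k ] 0ℚ < 1ℚ + q * inv k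
  base⁺ q = go (arch (- q) 0<1)
    where
    go : ∃[ k ] (- q * inv k < 1ℚ) → ∃[ k ] 0ℚ < 1ℚ + q * inv k
    go (k , p) = k , subst (0ℚ <_)
      (solve 2 (λ q i → con 1ℚ :- (:- q) :* i := con 1ℚ :+ q :* i) refl q (inv k)) (sub-pos p)

  base⁻ : ∀ q → ∃[ k ] 0ℚ < 1ℚ - q * inv k
  base⁻ q = go (arch q 0<1)
    where
    go : ∃[ k ] (q * inv k < 1ℚ) → ∃[ k ] 0ℚ < 1ℚ - q * inv k
    go (k , p) = k , sub-pos p

  base± : ∀ q r → ∃[ k ] (0ℚ < 1ℚ + q * inv k × 0ℚ < 1ℚ - r * inv k)
  base± q r = go (base⁺ q) (base⁻ r)
    where
    go : ∃[ k ] 0ℚ < 1ℚ + q * inv k → ∃[ k ] 0ℚ < 1ℚ - r * inv k →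
         ∃[ k ] (0ℚ < 1ℚ + q * inv k × 0ℚ < 1ℚ - r * inv k)
    go (j , 0<b) (k , 0<c) = j ⊗ k , proj₁ (refine⁺ q j k 0<b) ,
      subst (λ i → 0ℚ < 1ℚ - r * inv i) (⊗-comm k j) (proj₁ (refine⁻ r k j 0<c))

  1-x² : ∀ x → (1ℚ + x) * (1ℚ - x) ≡ 1ℚ + - (x * x)
  1-x² = solve 1 (λ x → (con 1ℚ :+ x) :* (con 1ℚ :- x) := con 1ℚ :+ (:- (x :* x))) refl

  0≤1-x² : ∀ {x} → 0ℚ < 1ℚ + x → 0ℚ < 1ℚ - x → 0ℚ ≤ 1ℚ + - (x * x)
  0≤1-x² {x} p m = subst (0ℚ ≤_) (1-x² x) (<⇒≤ (*-pos p m))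

  product≡ : ∀ x n → (1ℚ + x) ^ n * (1ℚ - x) ^ n ≡ (1ℚ + - (x * x)) ^ n
  product≡ x n = trans (sym (^-distrib-* (1ℚ + x) (1ℚ - x) n)) (cong (_^ n) (1-x² x))

  product≤1 : ∀ {x} n → 0ℚ < 1ℚ + x → 0ℚ < 1ℚ - x → (1ℚ + x) ^ n * (1ℚ - x) ^ n ≤ 1ℚ
  product≤1 {x} n p m = subst (_≤ 1ℚ) (sym (product≡ x n))
    (^≤1 n (0≤1-x² {x} p m) (le-by (square-nonneg x) (eq (x * x))))
    where
    eq : ∀ z → 1ℚ ≡ (1ℚ + - z) + z
    eq = solve 1 (λ z → con 1ℚ := (con 1ℚ :+ :- z) :+ z) refl

  product≥ : ∀ q k → 0ℚ < 1ℚ + q * inv k → 0ℚ < 1ℚ - q * inv k →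
             1ℚ - q * q * inv k ≤ (1ℚ + q * inv k) ^ suc k * (1ℚ - q * inv k) ^ suc k
  product≥ q k p m = subst₂ _≤_ (cong (λ z → 1ℚ + z) eq) (sym (product≡ (q * inv k) (suc k)))
    (bernoulli (- (q * inv k * (q * inv k))) (suc k) (0≤1-x² {q * inv k} p m))
    where
    eq : ι (suc k) * - (q * inv k * (q * inv k)) ≡ - (q * q * inv k)
    eq = trans (solve 3 (λ n q i → n :* (:- (q :* i :* (q :* i))) := :- (q :* q :* i :* (i :* n)))
                 refl (ι (suc k)) q (inv k))
      (cong -_ (trans (cong (q * q * inv k *_) (inv-ι k)) (*-identityʳ _)))

  over : ∀ {c} → 0ℚ < c → ∃[ r ] 1ℚ < r * c
  over {c} 0<c = go (recip c 0<c)
    where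
    go : ∃[ i ] (0ℚ < i × c * i ≡ 1ℚ) → ∃[ r ] 1ℚ < r * c
    go (i , 0<i , ci≡1) = i + i , subst (1ℚ <_) (sym eq) (lt-by 0<1 refl)
      where
      eq : (i + i) * c ≡ 1ℚ + 1ℚ
      eq = trans (solve 2 (λ i c → (i :+ i) :* c := c :* i :+ c :* i) refl i c)
                 (cong₂ _+_ ci≡1 ci≡1)

  between : ∀ {a c} → 0ℚ < c → 1ℚ < a * c → ∃[ r ] (r < a × 1ℚ < r * c)
  between = scale-openˡ

  below-above : ∀ {q r s} j k → 0ℚ < 1ℚ + q * inv j → r < (1ℚ + q * inv j) ^ suc j →
                0ℚ < 1ℚ - q * inv k → 1ℚ < s * (1ℚ - q * inv k) ^ suc k → r < s
  below-above {q} {r} {s} j k 0<b r<A 0<c 1<sC = *-cancelʳ-<′ 0<C (<-≤-trans rC<1 (<⇒≤ 1<sC))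
    where
    C : ℚ
    C = (1ℚ - q * inv k) ^ suc k
    0<C : 0ℚ < C
    0<C = ^-pos (suc k) 0<c
    n : ℕ
    n = j ⊗ k
    ref⁺ = refine⁺ q j k 0<b
    ref⁻ : 0ℚ < 1ℚ - q * inv n × C ≤ (1ℚ - q * inv n) ^ suc n
    ref⁻ = subst (λ n → 0ℚ < 1ℚ - q * inv n × C ≤ (1ℚ - q * inv n) ^ suc n)
             (⊗-comm k j) (refine⁻ q k j 0<c)
    rC<1 : r * C < 1ℚ
    rC<1 = <-≤-trans (*-monoˡ-<′ {C} {r} 0<C (<-≤-trans r<A (proj₂ ref⁺)))
      (≤-trans (*-monoʳ-≤′ {(1ℚ + q * inv n) ^ suc n} {C}
                 (^-nonneg (suc n) (<⇒≤ (proj₁ ref⁺))) (proj₂ ref⁻))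
               (product≤1 {q * inv n} (suc n) (proj₁ ref⁺) (proj₁ ref⁻)))

  inv-⊗≤ : ∀ a j k → 0ℚ ≤ a → a * inv (j ⊗ k) ≤ a * inv k
  inv-⊗≤ a j k 0≤a = *-monoʳ-≤′ {a} 0≤a (subst₂ _≤_ (sym (inv-⊗ j k)) (*-identityˡ (inv k))
    (*-monoˡ-≤′ {inv k} {inv j} {1ℚ} (<⇒≤ (inv-pos k)) (inv≤1 j)))

  -- For large k the bounds (1 + q/(k+1))^(k+1) and (1 - q/(k+1))^-(k+1)
  -- separate any two rationals r < s.
  squeeze : ∀ q {r s} → r < s →
    ∃[ k ] (0ℚ < 1ℚ + q * inv k × 0ℚ < 1ℚ - q * inv k ×
            (r < (1ℚ + q * inv k) ^ suc k ⊎ 1ℚ < s * (1ℚ - q * inv k) ^ suc k))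
  squeeze q {r} {s} r<s = go (base± q q)
    where
    Goal : Set
    Goal = ∃[ k ] (0ℚ < 1ℚ + q * inv k × 0ℚ < 1ℚ - q * inv k ×
            (r < (1ℚ + q * inv k) ^ suc k ⊎ 1ℚ < s * (1ℚ - q * inv k) ^ suc k))
    go : ∃[ j ] (0ℚ < 1ℚ + q * inv j × 0ℚ < 1ℚ - q * inv j) → Goal
    go (j , 0<b , 0<c) = go′ (arch (q * q) (*-pos (sub-pos r<s) (^-pos (suc j) 0<c)))
      where
      go′ : ∃[ m ] (q * q * inv m < (s - r) * (1ℚ - q * inv j) ^ suc j) → Goal
      go′ (m , small) = n , proj₁ ref⁺ , proj₁ ref⁻ ,
        [ (λ A≤r → inj₂ (1<sC A≤r)) , (λ A≰r → inj₁ A≰r) ]′ (split r A)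
        where
        n : ℕ
        n = j ⊗ m
        ref⁺ = refine⁺ q j m 0<b
        ref⁻ = refine⁻ q j m 0<c
        A C : ℚ
        A = (1ℚ + q * inv n) ^ suc n
        C = (1ℚ - q * inv n) ^ suc n
        split : ∀ r a → a ≤ r ⊎ r < a
        split r a with a ≤? r
        ... | yes a≤r = inj₁ a≤r
        ... | no  a≰r = inj₂ (≰⇒> a≰r)
        small′ : q * q * inv n < (s - r) * C
        small′ = ≤-<-trans (inv-⊗≤ (q * q) j m (square-nonneg q))
          (<-≤-trans small (*-monoʳ-≤′ {s - r} {(1ℚ - q * inv j) ^ suc j} {C}
            (<⇒≤ (sub-pos r<s)) (proj₂ ref⁻)))
        0≤C : 0ℚ ≤ C
        0≤C = ^-nonneg (suc n) (<⇒≤ (proj₁ ref⁻))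
        eq : ∀ s r C A z → s * C ≡ 1ℚ + ((s - r) * C - z + ((r - A) * C + (A * C - (1ℚ - z))))
        eq = solve 5 (λ s r C A z → s :* C := con 1ℚ :+ ((s :- r) :* C :- z :+
          ((r :- A) :* C :+ (A :* C :- (con 1ℚ :- z))))) refl
        1<sC : A ≤ r → 1ℚ < s * C
        1<sC A≤r = lt-by (+-pos-nonneg (sub-pos small′)
            (+-nonneg (*-nonneg (sub-nonneg A≤r) 0≤C)
                      (sub-nonneg (product≥ q n (proj₁ ref⁺) (proj₁ ref⁻)))))
          (eq s r C A (q * q * inv n))

  strict : ∀ {q r} → q < r →
    ∃[ k ] (0ℚ < 1ℚ + r * inv k × 0ℚ < 1ℚ - q * inv k ×
            1ℚ < (1ℚ + r * inv k) ^ suc k * (1ℚ - q * inv k) ^ suc k)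
  strict {q} {r} q<r = go (base± r q)
    where
    Goal : Set
    Goal = ∃[ k ] (0ℚ < 1ℚ + r * inv k × 0ℚ < 1ℚ - q * inv k ×
            1ℚ < (1ℚ + r * inv k) ^ suc k * (1ℚ - q * inv k) ^ suc k)
    go : ∃[ j ] (0ℚ < 1ℚ + r * inv j × 0ℚ < 1ℚ - q * inv j) → Goal
    go (j , 0<b , 0<c) = go′ (arch (r * q * inv j) (sub-pos q<r))
      where
      go′ : ∃[ m ] (r * q * inv j * inv m < r - q) → Goal
      go′ (m , small) = n , proj₁ ref⁺ , proj₁ ref⁻ ,
        subst (1ℚ <_) (trans (cong (_^ suc n) (sym eq₁)) (^-distrib-* (1ℚ + r * h) (1ℚ - q * h) (suc n)))
          (<-≤-trans (lt-by (sub-pos small′) refl)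
            (subst (_≤ (1ℚ + x) ^ suc n) (cong (λ z → 1ℚ + z) eq₂)
              (bernoulli x (suc n) (subst (0ℚ ≤_) eq₁ (<⇒≤ (*-pos (proj₁ ref⁺) (proj₁ ref⁻)))))))
        where
        n : ℕ
        n = j ⊗ m
        h : ℚ
        h = inv n
        ref⁺ = refine⁺ r j m 0<b
        ref⁻ = refine⁻ q j m 0<c
        x : ℚ
        x = h * (r - q - r * q * h)
        small′ : r * q * h < r - q
        small′ = subst (_< r - q)
          (trans (*-assoc (r * q) (inv j) (inv m)) (cong (r * q *_) (sym (inv-⊗ j m)))) small
        eq₁ : (1ℚ + r * h) * (1ℚ - q * h) ≡ 1ℚ + x
        eq₁ = solve 3 (λ r q h → (con 1ℚ :+ r :* h) :* (con 1ℚ :- q :* h)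
          := con 1ℚ :+ h :* (r :- q :- r :* q :* h)) refl r q h
        eq₂ : ι (suc n) * x ≡ r - q - r * q * h
        eq₂ = trans (ring₂ (ι (suc n)) h (r - q - r * q * h))
          (trans (cong (λ z → (r - q - r * q * h) * z) (inv-ι n)) (*-identityʳ _))
          where
          ring₂ : ∀ n h y → n * (h * y) ≡ y * (h * n)
          ring₂ = solve 3 (λ n h y → n :* (h :* y) := y :* (h :* n)) refl

open Exp-Lemmas

-- e^q is the supremum of (1 + q/n)^n over the n ≥ 1 with 1 + q/n > 0, and the
-- infimum of (1 - q/n)^(-n) over the n ≥ 1 with 1 - q/n > 0; here n = k + 1
-- and inv k = 1/n.
expℚ : ℚ → ℝ
expℚ q = record
  { L        = L′
  ; U        = U′
  ; L-inh    = L-inh′ (base⁺ q)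
  ; U-inh    = U-inh′ (base⁻ q)
  ; L-down   = λ { r<s (k , 0<b , s<A) → k , 0<b , <-trans r<s s<A }
  ; L-open   = L-open′
  ; U-up     = U-up′
  ; U-open   = U-open′
  ; disjoint = disjoint′
  ; located  = located′
  }
  where
  L′ U′ : ℚ → Set
  L′ r = ∃[ k ] (0ℚ < 1ℚ + q * inv k × r < (1ℚ + q * inv k) ^ suc k)
  U′ r = ∃[ k ] (0ℚ < 1ℚ - q * inv k × 1ℚ < r * (1ℚ - q * inv k) ^ suc k)
  L-inh′ : ∃[ k ] 0ℚ < 1ℚ + q * inv k → ∃ L′
  L-inh′ (k , 0<b) = 0ℚ , k , 0<b , ^-pos (suc k) 0<b
  U-inh′ : ∃[ k ] 0ℚ < 1ℚ - q * inv k → ∃ U′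
  U-inh′ (k , 0<c) = let r , 1<rC = over (^-pos (suc k) 0<c) in r , k , 0<c , 1<rC
  L-open′ : ∀ {r} → L′ r → ∃[ s ] (r < s × L′ s)
  L-open′ (k , 0<b , r<A) = let s , r<s , s<A = <-dense r<A in s , r<s , k , 0<b , s<A
  U-up′ : ∀ {r s} → r < s → U′ r → U′ s
  U-up′ {r} {s} r<s (k , 0<c , 1<rC) = k , 0<c ,
    <-trans 1<rC (*-monoˡ-<′ {(1ℚ - q * inv k) ^ suc k} {r} {s} (^-pos (suc k) 0<c) r<s)
  U-open′ : ∀ {s} → U′ s → ∃[ r ] (r < s × U′ r)
  U-open′ {s} (k , 0<c , 1<sC) =
    let r , r<s , 1<rC = between {s} (^-pos (suc k) 0<c) 1<sC in r , r<s , k , 0<c , 1<rC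
  disjoint′ : ∀ {r} → L′ r → U′ r → ⊥
  disjoint′ {r} (j , 0<b , r<A) (k , 0<c , 1<rC) =
    <-irrefl refl (below-above {q} {r} {r} j k 0<b r<A 0<c 1<rC)
  located′ : ∀ {r s} → r < s → L′ r ⊎ U′ s
  located′ {r} {s} r<s = go (squeeze q r<s)
    where
    go : ∃[ k ] (0ℚ < 1ℚ + q * inv k × 0ℚ < 1ℚ - q * inv k ×
            (r < (1ℚ + q * inv k) ^ suc k ⊎ 1ℚ < s * (1ℚ - q * inv k) ^ suc k)) → L′ r ⊎ U′ s
    go (k , 0<b , 0<c , inj₁ r<A)  = inj₁ (k , 0<b , r<A)
    go (k , 0<b , 0<c , inj₂ 1<sC) = inj₂ (k , 0<c , 1<sC)

expℚ-mono : ∀ {q r} → q < r → expℚ q <ℝ expℚ r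
expℚ-mono {q} {r} q<r = go (strict q<r)
  where
  go : ∃[ k ] (0ℚ < 1ℚ + r * inv k × 0ℚ < 1ℚ - q * inv k ×
            1ℚ < (1ℚ + r * inv k) ^ suc k * (1ℚ - q * inv k) ^ suc k) → expℚ q <ℝ expℚ r
  go (k , 0<b , 0<c , 1<AC) =
    let s , s<A , 1<sC = between {(1ℚ + r * inv k) ^ suc k} (^-pos (suc k) 0<c) 1<AC
    in s , (k , 0<c , 1<sC) , (k , 0<b , s<A)

module Log-Lemmas where

  exp-below : ∀ s → 0ℚ < s → ∃[ q ] U (expℚ q) s
  exp-below s 0<s = go (recip s 0<s)
    where
    go : ∃[ i ] (0ℚ < i × s * i ≡ 1ℚ) → ∃[ q ] U (expℚ q) s
    go (i , 0<i , si≡1) = - i , 0 ,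
      subst (λ z → 0ℚ < 1ℚ - - i * z) (sym inv-zero)
        (subst (0ℚ <_) (eq₀ i) (+-pos 0<1 0<i)) ,
      subst (λ z → 1ℚ < s * (1ℚ - - i * z) ^ 1) (sym inv-zero)
        (subst (1ℚ <_) (sym eq₁) (lt-by 0<s refl))
      where
      eq₀ : ∀ i → 1ℚ + i ≡ 1ℚ - - i * 1ℚ
      eq₀ = solve 1 (λ i → con 1ℚ :+ i := con 1ℚ :- (:- i) :* con 1ℚ) refl
      eq₁ : s * (1ℚ - - i * 1ℚ) ^ 1 ≡ 1ℚ + s
      eq₁ = trans (solve 2 (λ s i → s :* ((con 1ℚ :- (:- i) :* con 1ℚ) :* con 1ℚ) := s :* i :+ s) refl s i)
                  (cong (_+ s) si≡1)

  exp-above : ∀ t → 0ℚ < t → L (expℚ t) t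
  exp-above t 0<t = 0 ,
    subst (λ z → 0ℚ < 1ℚ + t * z) (sym inv-zero) (subst (0ℚ <_) (eq₀ t) (+-pos 0<1 0<t)) ,
    subst (λ z → t < (1ℚ + t * z) ^ 1) (sym inv-zero) (lt-by 0<1 (eq₁ t))
    where
    eq₀ : ∀ t → 1ℚ + t ≡ 1ℚ + t * 1ℚ
    eq₀ = solve 1 (λ t → con 1ℚ :+ t := con 1ℚ :+ t :* con 1ℚ) refl
    eq₁ : ∀ t → (1ℚ + t * 1ℚ) ^ 1 ≡ t + 1ℚ
    eq₁ = solve 1 (λ t → (con 1ℚ :+ t :* con 1ℚ) :* con 1ℚ := t :+ con 1ℚ) refl

  raise : ∀ q {s} → U (expℚ q) s → ∃[ r ] (q < r × U (expℚ r) s)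
  raise q {s} (k , 0<c , 1<sC) = go (lower-base {1ℚ} {s} {1ℚ - q * inv k} (suc k) 0<s 0<c 1<sC)
    where
    0<s : 0ℚ < s
    0<s = *-cancelʳ-<′ (^-pos (suc k) 0<c)
      (subst (_< s * (1ℚ - q * inv k) ^ suc k) (sym (*-zeroˡ ((1ℚ - q * inv k) ^ suc k)))
        (<-trans 0<1 1<sC))
    go : ∃[ y ] (0ℚ < y × y < 1ℚ - q * inv k × 1ℚ < s * y ^ suc k) →
         ∃[ r ] (q < r × U (expℚ r) s)
    go (y , 0<y , y<c , 1<sy) = r ,
      *-cancelʳ-<′ (inv-pos k) (subst (q * inv k <_) (sym ri) (lt-by (sub-pos y<c) (eq₁ (q * inv k) y))) ,
      k , subst (0ℚ <_) (sym b≡y) 0<y , subst (λ z → 1ℚ < s * z ^ suc k) (sym b≡y) 1<sy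
      where
      r : ℚ
      r = (1ℚ - y) * ι (suc k)
      ri : r * inv k ≡ 1ℚ - y
      ri = trans (solve 3 (λ z n i → z :* n :* i := z :* (i :* n)) refl (1ℚ - y) (ι (suc k)) (inv k))
        (trans (cong ((1ℚ - y) *_) (inv-ι k)) (*-identityʳ _))
      eq₁ : ∀ z y → 1ℚ - y ≡ z + (1ℚ - z - y)
      eq₁ = solve 2 (λ z y → con 1ℚ :- y := z :+ (con 1ℚ :- z :- y)) refl
      b≡y : 1ℚ - r * inv k ≡ y
      b≡y = trans (cong (λ z → 1ℚ - z) ri) (solve 1 (λ y → con 1ℚ :- (con 1ℚ :- y) := y) refl y)

  lower : ∀ q {t} → L (expℚ q) t → ∃[ p ] (p < q × L (expℚ p) t)
  lower q {t} (k , 0<b , t<A) = go (lower-base {t} {1ℚ} {1ℚ + q * inv k} (suc k) 0<1 0<b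
      (subst (t <_) (sym (*-identityˡ ((1ℚ + q * inv k) ^ suc k))) t<A))
    where
    go : ∃[ y ] (0ℚ < y × y < 1ℚ + q * inv k × t < 1ℚ * y ^ suc k) →
         ∃[ p ] (p < q × L (expℚ p) t)
    go (y , 0<y , y<b , t<y) = p ,
      *-cancelʳ-<′ (inv-pos k) (subst (_< q * inv k) (sym pi) (lt-by (sub-pos y<b) (eq₁ (q * inv k) y))) ,
      k , subst (0ℚ <_) (sym b≡y) 0<y ,
      subst (λ z → t < z ^ suc k) (sym b≡y) (subst (t <_) (*-identityˡ (y ^ suc k)) t<y)
      where
      p : ℚ
      p = (y - 1ℚ) * ι (suc k)
      pi : p * inv k ≡ y - 1ℚ
      pi = trans (solve 3 (λ z n i → z :* n :* i := z :* (i :* n)) refl (y - 1ℚ) (ι (suc k)) (inv k))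
        (trans (cong ((y - 1ℚ) *_) (inv-ι k)) (*-identityʳ _))
      eq₁ : ∀ z y → z ≡ y - 1ℚ + (1ℚ + z - y)
      eq₁ = solve 2 (λ z y → z := y :- con 1ℚ :+ (con 1ℚ :+ z :- y)) refl
      b≡y : 1ℚ + p * inv k ≡ y
      b≡y = trans (cong (λ z → 1ℚ + z) pi) (solve 1 (λ y → con 1ℚ :+ (y :- con 1ℚ) := y) refl y)

open Log-Lemmas

-- The logarithm is the inverse of the exponential function: q < log x iff
-- e^q < x, and log x < q iff x < e^q.
log : (x : ℝ) → 0ℝ <ℝ x → ℝ
log x (s₀ , 0<s₀ , Ls₀) = record
  { L        = L′
  ; U        = U′
  ; L-inh    = L-inh′ (exp-below s₀ 0<s₀)
  ; U-inh    = U-inh′ (U-inh x)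
  ; L-down   = λ {q} {r} q<r Lr → <ℝ-trans {expℚ q} {expℚ r} {x} (expℚ-mono q<r) Lr
  ; L-open   = λ {q} → L-open′ {q}
  ; U-up     = λ {q} {r} q<r Uq → <ℝ-trans {x} {expℚ q} {expℚ r} Uq (expℚ-mono q<r)
  ; U-open   = λ {r} → U-open′ {r}
  ; disjoint = λ {q} → disjoint′ {q}
  ; located  = λ {q} {r} q<r → located′ {q} {r} (expℚ-mono q<r)
  }
  where
  L′ U′ : ℚ → Set
  L′ q = expℚ q <ℝ x
  U′ q = x <ℝ expℚ q
  L-inh′ : ∃[ q ] U (expℚ q) s₀ → ∃ L′
  L-inh′ (q , Us₀) = q , s₀ , Us₀ , Ls₀
  U-inh′ : ∃ (U x) → ∃ U′
  U-inh′ (t , Ut) = t , t , Ut , exp-above t (<-trans 0<s₀ (L<U x Ls₀ Ut))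
  L-open′ : ∀ {q} → L′ q → ∃[ r ] (q < r × L′ r)
  L-open′ {q} (s , Us , Ls) = let r , q<r , Us′ = raise q {s} Us in r , q<r , s , Us′ , Ls
  U-open′ : ∀ {r} → U′ r → ∃[ q ] (q < r × U′ q)
  U-open′ {r} (t , Ut , Lt) = let q , q<r , Lt′ = lower r {t} Lt in q , q<r , t , Ut , Lt′
  disjoint′ : ∀ {q} → L′ q → U′ q → ⊥
  disjoint′ {q} (s , Us , Ls) (t , Ut , Lt) =
    <-asym {s} {t} (L<U x Ls Ut) (L<U (expℚ q) Lt Us)
  located′ : ∀ {q r} → expℚ q <ℝ expℚ r → L′ q ⊎ U′ r
  located′ {q} {r} (s , Us , Ls) = go (L-open (expℚ r) Ls)
    where
    go : ∃[ t ] (s < t × L (expℚ r) t) → L′ q ⊎ U′ r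
    go (t , s<t , Lt) =
      [ (λ Lxs → inj₁ (s , Us , Lxs)) , (λ Uxt → inj₂ (t , Uxt , Lt)) ]′ (located x s<t)

0<log : ∀ x (0<x : 0ℝ <ℝ x) → fromℚ 1ℚ <ℝ x → 0ℝ <ℝ log x 0<x
0<log x 0<x (s , 1<s , Ls) = go (raise 0ℚ {s} U₀s)
  where
  U₀s : U (expℚ 0ℚ) s
  U₀s = 0 , subst (λ z → 0ℚ < 1ℚ - 0ℚ * z) (sym inv-zero) (positive⁻¹ _) ,
        subst (λ z → 1ℚ < s * (1ℚ - 0ℚ * z) ^ 1) (sym inv-zero) (subst (1ℚ <_) (sym (*-identityʳ s)) 1<s)
  go : ∃[ r ] (0ℚ < r × U (expℚ r) s) → 0ℝ <ℝ log x 0<x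
  go (r , 0<r , Us) =
    let m , 0<m , m<r = <-dense 0<r
    in m , 0<m , <ℝ-trans {expℚ m} {expℚ r} {x} (expℚ-mono m<r) (s , Us , Ls)

fromℕ-mono : ∀ {m n} → m ℕ.< n → fromℕ m <ℝ fromℕ n
fromℕ-mono {m} {n} m<n = <-dense (toℚᵘ-cancel-<
  (ℚᵘₚ.<-respʳ-≃ (ℚᵘₚ.≃-sym (toℚᵘ-fromℚᵘ (ℚᵘ.mkℚᵘ (+ n) 0)))
  (ℚᵘₚ.<-respˡ-≃ (ℚᵘₚ.≃-sym (toℚᵘ-fromℚᵘ (ℚᵘ.mkℚᵘ (+ m) 0)))
    (ℚᵘ.*<* (ℤₚ.*-monoʳ-<-pos (+ 1) (ℤ.+<+ m<n))))))

module _ {p : ℕ} (p-prime : Prime p) where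

  1<prime : 1 ℕ.< p
  1<prime = ℕ.nonTrivial⇒n>1 p {{prime⇒nonTrivial p-prime}}

  0<p : 0ℝ <ℝ fromℕ p
  0<p = fromℕ-mono (ℕₚ.<-trans ℕ.z<s 1<prime)

  0<p-1 : 0ℝ <ℝ fromℕ (p ∸ 1)
  0<p-1 = fromℕ-mono (ℕₚ.m<n⇒0<n∸m 1<prime)

  0<log-p : 0ℝ <ℝ log (fromℕ p) 0<p
  0<log-p = 0<log (fromℕ p) 0<p (fromℕ-mono 1<prime)

0<6·83 : 0ℝ <ℝ fromℚ (+ 683 / 100)
0<6·83 = <-dense (positive⁻¹ (+ 683 / 100))

φ : ℕ → ℕ
φ n = length (filter (λ k → ℕ.coprime? k n) (map suc (upTo n)))

infix 4 _≡_[mod_]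

_≡_[mod_] : ℤ → ℤ → ℕ → Set
a ≡ b [mod n ] = + n ℤ.∣ a ℤ.- b

-- The unit group is finite, so the subgroup generated by g consists of the
-- powers of g with exponents in ℕ.
PrimitiveRoot : ℕ → ℤ → Set
PrimitiveRoot p g = ℤ.Coprime g (+ p) ×
  (∀ b → ℤ.Coprime b (+ p) → ∃[ k ] g ℤ.^ k ≡ b [mod p ])

QuadraticNonResidue : ℕ → ℤ → Set
QuadraticNonResidue p a = ℤ.Coprime a (+ p) × ¬ (∃[ y ] y ℤ.^ 2 ≡ a [mod p ])

QNRNP : ℕ → ℤ → Set
QNRNP p a = QuadraticNonResidue p a × ¬ PrimitiveRoot p a

module Submission where

-- Put n = p - 1.  As φ(n)/n ≤ 9/22 < 1/2, n has an odd prime factor, and the least one, q, is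
-- at most 11/2 times the number of odd prime factors.  Put H = n/(2q).  If z is coprime to n and
-- z^H ≡ -1 (mod p), then z^(n/2) ≡ -1 and z^(n/q) ≡ 1, so z is a QNRNP; with k z ≡ 1 (mod n) the
-- number g = z^k satisfies g^H ≡ -1 too, and g^z = z^(k z) ≡ z.
--
-- Such a z exists because there are sets X, Y ⊆ [0, n) all of whose sums are less than n and
-- coprime to n, with |X| |Y| at least about φ(n)²/4^(ω(n) + 1): the pairs with coprime sum are
-- thinned out by one partition of the residues for each prime factor of n, and each costs at
-- most a factor 4.  On the other hand, a second moment count shows that X + Y meets every coset
-- of the subgroup of order H as soon as |X| |Y| H² > 2 p³.

-- Numbers coprime to n are too irregular for a direct count of those with z^H ≡ -1. Sums x + y have
-- a bilinear structure: for arbitrary sets X and Y a variance over shifts replaces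
-- equidistribution, and its only arithmetic input besides Fermat's theorem is that z^d ≡ 1 has at
-- most d solutions. As X and Y may be arbitrary, thinning them costs nothing beyond the lost pairs.
--
-- Write n = 2 M P with P the product of the l odd primes r dividing n, and D for the product of the
-- r - 1, so that φ(n) = M D. If no z exists, the two counts of pairs together give M D² ≤ 34848 ·
-- 4^l l² P. Here 34848 = 288 · 11², where 288 = 9 · 4 · 4 · 2: 9 from φ(n) ≤ 3 K for the integer
-- half K of φ(n), 4 for the prime 2 in the thinning, 4 from 2 p³ ≤ 4 n³, and 2 from n = 2 M P; 11²
-- comes from 2 q ≤ 11 l.
--
-- This fails because l distinct primes cannot all be small: D⁴ is at least l! P³ / (l + 1)³, so
-- after squaring, l! stands against 16^l (l + 1)^7, and n ≥ 2^82 covers the range of l where the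
-- factorial has not yet won. The hypothesis on log log p serves to make p this large.

-- Finite sums and indicator functions over the natural numbers.

module Sums where

  open import Data.Bool.Base using (Bool; true; false)
  open import Data.Nat.Base
  open import Data.Nat.Properties
  open import Data.Nat.Tactic.RingSolver using (solve-∀)
  open import Data.Sum.Base using (inj₁; inj₂)
  open import Relation.Binary.PropositionalEquality
  open import Relation.Nullary using (¬_; Dec; yes; no; contradiction)

  private
    variable
      P Q : Set

  𝟙 : Dec P → ℕ
  𝟙 (yes _) = 1
  𝟙 (no  _) = 0

  𝟙-yes : (d : Dec P) → P → 𝟙 d ≡ 1
  𝟙-yes (yes _) _ = refl
  𝟙-yes (no ¬p) p = contradiction p ¬p

  𝟙-no : (d : Dec P) → ¬ P → 𝟙 d ≡ 0
  𝟙-no (yes p) ¬p = contradiction p ¬p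
  𝟙-no (no _)  _  = refl

  𝟙≤1 : (d : Dec P) → 𝟙 d ≤ 1
  𝟙≤1 (yes _) = s≤s z≤n
  𝟙≤1 (no _)  = z≤n

  𝟙-mono : (d : Dec P) (e : Dec Q) → (P → Q) → 𝟙 d ≤ 𝟙 e
  𝟙-mono (yes p) e f = ≤-reflexive (sym (𝟙-yes e (f p)))
  𝟙-mono (no _)  e f = z≤n

  𝟙-cong : (d : Dec P) (e : Dec Q) → (P → Q) → (Q → P) → 𝟙 d ≡ 𝟙 e
  𝟙-cong d e f g = ≤-antisym (𝟙-mono d e f) (𝟙-mono e d g)

  -- A bound on a product of indicators may be proved under all of their conditions at once; nested
  -- uses peel them off one by one.
  𝟙*≤ : (d : Dec P) {a b : ℕ} → (P → a ≤ b) → 𝟙 d * a ≤ b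
  𝟙*≤ (yes p) {a} h = ≤-trans (≤-reflexive (*-identityˡ a)) (h p)
  𝟙*≤ (no _)  h = z≤n

  bit : Bool → ℕ
  bit true  = 1
  bit false = 0

  bit≤1 : ∀ b → bit b ≤ 1
  bit≤1 true  = ≤-refl
  bit≤1 false = z≤n

  bit-idem : ∀ b → bit b * bit b ≡ bit b
  bit-idem true  = refl
  bit-idem false = refl

  ∑ : ℕ → (ℕ → ℕ) → ℕ
  ∑ zero    f = 0
  ∑ (suc N) f = ∑ N f + f N

  infixr 10 ∑
  syntax ∑ N (λ x → e) = ∑[ x < N ] e

  ∑-mono : ∀ N {f g : ℕ → ℕ} → (∀ x → x < N → f x ≤ g x) → ∑ N f ≤ ∑ N g
  ∑-mono zero    h = z≤n
  ∑-mono (suc N) h = +-mono-≤ (∑-mono N (λ x x<N → h x (m<n⇒m<1+n x<N))) (h N (n<1+n N))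

  ∑-cong : ∀ N {f g : ℕ → ℕ} → (∀ x → x < N → f x ≡ g x) → ∑ N f ≡ ∑ N g
  ∑-cong N h = ≤-antisym (∑-mono N (λ x x<N → ≤-reflexive (h x x<N)))
                         (∑-mono N (λ x x<N → ≤-reflexive (sym (h x x<N))))

  ∑-distrib-+ : ∀ N (f g : ℕ → ℕ) → ∑[ x < N ] (f x + g x) ≡ ∑ N f + ∑ N g
  ∑-distrib-+ zero    f g = refl
  ∑-distrib-+ (suc N) f g = trans (cong (_+ (f N + g N)) (∑-distrib-+ N f g))
    (interchange (∑ N f) (∑ N g) (f N) (g N))
    where
    interchange : ∀ a b c d → a + b + (c + d) ≡ a + c + (b + d)
    interchange = solve-∀

  *-distribˡ-∑ : ∀ N c (f : ℕ → ℕ) → c * ∑ N f ≡ ∑[ x < N ] (c * f x)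
  *-distribˡ-∑ zero    c f = *-zeroʳ c
  *-distribˡ-∑ (suc N) c f =
    trans (*-distribˡ-+ c (∑ N f) (f N)) (cong (_+ c * f N) (*-distribˡ-∑ N c f))

  *-distribʳ-∑ : ∀ N c (f : ℕ → ℕ) → ∑ N f * c ≡ ∑[ x < N ] (f x * c)
  *-distribʳ-∑ N c f = trans (*-comm (∑ N f) c)
    (trans (*-distribˡ-∑ N c f) (∑-cong N (λ x _ → *-comm c (f x))))

  ∑-const : ∀ N c → ∑[ x < N ] c ≡ N * c
  ∑-const zero    c = refl
  ∑-const (suc N) c = trans (cong (_+ c) (∑-const N c)) (+-comm (N * c) c)

  ∑-zero : ∀ N {f : ℕ → ℕ} → (∀ x → x < N → f x ≡ 0) → ∑ N f ≡ 0
  ∑-zero N h = trans (∑-cong N h) (trans (∑-const N 0) (*-zeroʳ N))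

  ∑-swap : ∀ M N (f : ℕ → ℕ → ℕ) → ∑[ x < M ] ∑[ y < N ] f x y ≡ ∑[ y < N ] ∑[ x < M ] f x y
  ∑-swap zero    N f = sym (∑-zero N (λ _ _ → refl))
  ∑-swap (suc M) N f = trans (cong (_+ ∑ N (f M)) (∑-swap M N f))
    (sym (∑-distrib-+ N (λ y → ∑[ x < M ] f x y) (f M)))

  ∑*∑ : ∀ M N (f g : ℕ → ℕ) → ∑ M f * ∑ N g ≡ ∑[ x < M ] ∑[ y < N ] (f x * g y)
  ∑*∑ M N f g = trans (*-distribʳ-∑ M (∑ N g) f) (∑-cong M (λ x _ → *-distribˡ-∑ N (f x) g))

  term≤∑ : ∀ N (f : ℕ → ℕ) {i} → i < N → f i ≤ ∑ N f
  term≤∑ (suc N) f {i} (s≤s i≤N) with m≤n⇒m<n∨m≡n i≤N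
  ... | inj₁ i<N  = ≤-trans (term≤∑ N f i<N) (m≤m+n (∑ N f) (f N))
  ... | inj₂ refl = m≤n+m (f N) (∑ N f)

  ∑-split : ∀ a b (f : ℕ → ℕ) → ∑ (a + b) f ≡ ∑ a f + ∑[ x < b ] f (a + x)
  ∑-split a zero    f = trans (cong (λ N → ∑ N f) (+-identityʳ a)) (sym (+-identityʳ (∑ a f)))
  ∑-split a (suc b) f = trans (cong (λ N → ∑ N f) (+-suc a b))
    (trans (cong (_+ f (a + b)) (∑-split a b f)) (+-assoc (∑ a f) (∑[ x < b ] f (a + x)) (f (a + b))))

  ∑-head : ∀ N (f : ℕ → ℕ) → ∑ (suc N) f ≡ f 0 + ∑[ x < N ] f (suc x)
  ∑-head N f = ∑-split 1 N f

  ∑-monoˡ-≤ : ∀ {M N} (f : ℕ → ℕ) → M ≤ N → ∑ M f ≤ ∑ N f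
  ∑-monoˡ-≤ {M} {N} f M≤N = ≤-trans (m≤m+n (∑ M f) _)
    (≤-reflexive (trans (sym (∑-split M (N ∸ M) f)) (cong (λ K → ∑ K f) (m+[n∸m]≡n M≤N))))

  ∑𝟙≤1 : ∀ N {P : ℕ → Set} (P? : ∀ x → Dec (P x)) →
          (∀ i j → i < N → j < N → P i → P j → i ≡ j) → ∑[ x < N ] 𝟙 (P? x) ≤ 1
  ∑𝟙≤1 zero    P? unique = z≤n
  ∑𝟙≤1 (suc N) P? unique with P? N
  ... | no  _  = ≤-trans (≤-reflexive (+-identityʳ _))
    (∑𝟙≤1 N P? (λ i j i<N j<N → unique i j (m<n⇒m<1+n i<N) (m<n⇒m<1+n j<N)))
  ... | yes pN = ≤-reflexive (cong (_+ 1) (∑-zero N λ x x<N → 𝟙-no (P? x)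
    (λ px → <⇒≢ x<N (unique x N (m<n⇒m<1+n x<N) (n<1+n N) px pN))))

  ∑-point : ∀ N i (f : ℕ → ℕ) → i < N → ∑[ x < N ] (𝟙 (x ≟ i) * f x) ≡ f i
  ∑-point (suc N) i f (s≤s i≤N) with m≤n⇒m<n∨m≡n i≤N
  ... | inj₁ i<N  = trans (cong₂ _+_ (∑-point N i f i<N)
                      (cong (_* f N) (𝟙-no (N ≟ i) (λ N≡i → <⇒≢ i<N (sym N≡i)))))
                      (+-identityʳ (f i))
  ... | inj₂ refl = trans (cong₂ _+_
      (∑-zero N (λ x x<N → cong (_* f x) (𝟙-no (x ≟ N) (<⇒≢ x<N))))
      (cong (_* f N) (𝟙-yes (N ≟ N) refl)))
    (*-identityˡ (f N))

-- Arithmetic modulo a prime: roots of polynomials, roots of unity, Fermat's theorem.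

module Modular where

  open import Defs using (_≡_[mod_])
  open import Data.Integer.Base hiding (suc)
  open import Data.Integer.Properties
  open import Data.Integer.Tactic.RingSolver using (solve-∀)
  import Data.Integer.Divisibility.Signed as Signed
  open import Data.Nat.Base as ℕ using (ℕ; zero; suc)
  import Data.Nat.Divisibility as ℕ
  import Data.Nat.DivMod as ℕ
  import Data.Nat.Properties as ℕ
  open import Data.Nat.Base using (_!)
  open import Data.Nat.Properties using (_!≢0; _!*_!≢0)
  open import Data.Nat.Tactic.RingSolver using () renaming (solve-∀ to ℕ-solve-∀)
  open import Data.Nat.Combinatorics using (_C_; nCn≡1; nCk≡n!/k![n-k]!; k![n∸k]!∣n!; nCk+nC[k+1]≡[n+1]C[k+1])
  open import Data.Nat.Combinatorics.Specification using (k>n⇒nCk≡0)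
  open import Data.Nat.Primality using (Prime; euclidsLemma; prime⇒nonZero; prime⇒nonTrivial)
  open import Data.Product.Base using (∃-syntax; _,_; proj₁; proj₂)
  open import Data.Sum.Base as Sum using (_⊎_; inj₁; inj₂; [_,_]′)
  open import Data.Vec.Base using (Vec; []; _∷_; replicate)
  open import Relation.Binary.PropositionalEquality
  open import Relation.Binary.Bundles using (Setoid)
  import Relation.Binary.Reasoning.Setoid as ≈-Reasoning
  open import Relation.Nullary using (¬_; Dec; yes; no; contradiction)
  open import Relation.Nullary.Decidable using (map′)
  open Sums

  -- Coefficients, lowest degree first, of a monic polynomial of degree d; the
  -- leading 1 is not listed.
  monic : ∀ {d} → Vec ℤ d → ℤ → ℤ
  monic []       x = 1ℤ
  monic (c ∷ cs) x = c + x * monic cs x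

  -- Synthetic division: the coefficients of the quotient are the Horner values at `a` of the tails
  -- of the coefficient list.
  factor-theorem : ∀ {d} (cs : Vec ℤ (suc d)) a →
    ∃[ ds ] (∀ x → monic cs x ≡ (x - a) * monic {d} ds x + monic cs a)
  factor-theorem (c ∷ []) a = [] , λ x → linear c x a
    where
    linear : ∀ c x a → c + x * 1ℤ ≡ (x - a) * 1ℤ + (c + a * 1ℤ)
    linear = solve-∀
  factor-theorem (c ∷ cs@(_ ∷ _)) a with factor-theorem cs a
  ... | ds , f≡ = monic cs a ∷ ds , λ x →
    trans (cong (λ z → c + x * z) (f≡ x)) (horner c x a (monic ds x) (monic cs a))
    where
    horner : ∀ c x a g b → c + x * ((x - a) * g + b) ≡ (x - a) * (b + x * g) + (c + a * b)
    horner = solve-∀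

  monic-zeros : ∀ d x → monic (replicate d 0ℤ) x ≡ x ^ d
  monic-zeros zero    x = refl
  monic-zeros (suc d) x = trans (+-identityˡ _) (cong (x *_) (monic-zeros d x))

  pos-^ : ∀ a k → + (a ℕ.^ k) ≡ (+ a) ^ k
  pos-^ a zero    = refl
  pos-^ a (suc k) = trans (pos-* a (a ℕ.^ k)) (cong (+ a *_) (pos-^ a k))

  binomial : ∀ n a → suc a ℕ.^ n ≡ ∑[ k < suc n ] ((n C k) ℕ.* a ℕ.^ k)
  binomial zero    a = refl
  binomial (suc n) a = begin
    suc a ℕ.* suc a ℕ.^ n                            ≡⟨ cong (suc a ℕ.*_) (binomial n a) ⟩
    suc a ℕ.* B                                      ≡⟨ cong (ℕ._+ a ℕ.* B) shifted ⟩
    1 ℕ.+ ∑[ k < suc n ] t (suc k) ℕ.+ a ℕ.* B        ≡⟨ cong (1 ℕ.+ ∑[ k < suc n ] t (suc k) ℕ.+_) scaled ⟩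
    1 ℕ.+ ∑[ k < suc n ] t (suc k) ℕ.+ ∑[ k < suc n ] (a ℕ.* t k)
                                                     ≡⟨ ℕ.+-assoc 1 (∑[ k < suc n ] t (suc k)) _ ⟩
    1 ℕ.+ (∑[ k < suc n ] t (suc k) ℕ.+ ∑[ k < suc n ] (a ℕ.* t k))
                                                     ≡⟨ cong (1 ℕ.+_) (∑-distrib-+ (suc n) (λ k → t (suc k)) (λ k → a ℕ.* t k)) ⟨
    1 ℕ.+ ∑[ k < suc n ] (t (suc k) ℕ.+ a ℕ.* t k)   ≡⟨ cong (1 ℕ.+_) (∑-cong (suc n) (λ k _ → pascal k)) ⟩
    1 ℕ.+ ∑[ k < suc n ] ((suc n C suc k) ℕ.* a ℕ.^ suc k)  ≡⟨ ∑-head (suc n) (λ k → (suc n C k) ℕ.* a ℕ.^ k) ⟨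
    ∑[ k < suc (suc n) ] ((suc n C k) ℕ.* a ℕ.^ k)   ∎
    where
    open ≡-Reasoning
    t = λ k → (n C k) ℕ.* a ℕ.^ k
    B = ∑ (suc n) t
    scaled : a ℕ.* B ≡ ∑[ k < suc n ] (a ℕ.* t k)
    scaled = *-distribˡ-∑ (suc n) a t
    -- The vanishing term `n C suc n` is added so that the shifted and the scaled sum run over the
    -- same range and Pascal's rule applies term by term.
    shifted : B ≡ 1 ℕ.+ ∑[ k < suc n ] t (suc k)
    shifted = trans (sym (trans (cong (λ c → B ℕ.+ c ℕ.* a ℕ.^ suc n) (k>n⇒nCk≡0 (ℕ.n<1+n n))) (ℕ.+-identityʳ B)))
      (∑-head (suc n) t)
    pascal : ∀ k → t (suc k) ℕ.+ a ℕ.* t k ≡ (suc n C suc k) ℕ.* a ℕ.^ suc k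
    pascal k = trans (ring (n C suc k) (n C k) a (a ℕ.^ k)) (cong (ℕ._* a ℕ.^ suc k) (nCk+nC[k+1]≡[n+1]C[k+1] n k))
      where
      ring : ∀ c d a b → c ℕ.* (a ℕ.* b) ℕ.+ a ℕ.* (d ℕ.* b) ≡ (d ℕ.+ c) ℕ.* (a ℕ.* b)
      ring = ℕ-solve-∀

  module ModPrime {p : ℕ} (p-prime : Prime p) where

    private instance
      p≢0 : ℕ.NonZero p
      p≢0 = prime⇒nonZero p-prime

    1<p : 1 ℕ.< p
    1<p = ℕ.nonTrivial⇒n>1 p {{prime⇒nonTrivial p-prime}}

    infix 4 _≈_ _≈?_

    -- A record, so that both sides can be inferred from a proof.
    record _≈_ (a b : ℤ) : Set where
      constructor mod
      field
        unmod : a ≡ b [mod p ]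

    open _≈_ public

    _≈?_ : ∀ a b → Dec (a ≈ b)
    a ≈? b = map′ mod unmod (p ℕ.∣? ∣ a - b ∣)

    private
      by : ∀ {a b z} → (+ p) Signed.∣ z → z ≡ a - b → a ≈ b
      by p∣z refl = mod (Signed.∣⇒∣ᵤ p∣z)

      signed : ∀ {a b} → a ≈ b → (+ p) Signed.∣ (a - b)
      signed a≈b = Signed.∣ᵤ⇒∣ (unmod a≈b)

    ≈-reflexive : ∀ {a b} → a ≡ b → a ≈ b
    ≈-reflexive {a} refl = mod (subst (λ z → p ℕ.∣ ∣ z ∣) (sym (+-inverseʳ a)) (ℕ.divides 0 refl))

    ≈-refl : ∀ {a} → a ≈ a
    ≈-refl = ≈-reflexive refl

    ≈-sym : ∀ {a b} → a ≈ b → b ≈ a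
    ≈-sym {a} {b} a≈b = by (Signed.∣m⇒∣-m (signed a≈b)) (ring a b)
      where
      ring : ∀ a b → - (a - b) ≡ b - a
      ring = solve-∀

    ≈-trans : ∀ {a b c} → a ≈ b → b ≈ c → a ≈ c
    ≈-trans {a} {b} {c} a≈b b≈c = by (Signed.∣m∣n⇒∣m+n (signed a≈b) (signed b≈c)) (ring a b c)
      where
      ring : ∀ a b c → (a - b) + (b - c) ≡ a - c
      ring = solve-∀

    ≈-setoid : Setoid _ _
    ≈-setoid = record
      { Carrier = ℤ ; _≈_ = _≈_
      ; isEquivalence = record { refl = ≈-refl ; sym = ≈-sym ; trans = ≈-trans } }

    +-cong : ∀ {a b c d} → a ≈ b → c ≈ d → a + c ≈ b + d
    +-cong {a} {b} {c} {d} a≈b c≈d =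
      by (Signed.∣m∣n⇒∣m+n (signed a≈b) (signed c≈d)) (ring a b c d)
      where
      ring : ∀ a b c d → (a - b) + (c - d) ≡ a + c - (b + d)
      ring = solve-∀

    *-cong : ∀ {a b c d} → a ≈ b → c ≈ d → a * c ≈ b * d
    *-cong {a} {b} {c} {d} a≈b c≈d =
      by (Signed.∣m∣n⇒∣m+n (Signed.∣m⇒∣m*n c (signed a≈b)) (Signed.∣n⇒∣m*n b (signed c≈d)))
         (ring a b c d)
      where
      ring : ∀ a b c d → (a - b) * c + b * (c - d) ≡ a * c - b * d
      ring = solve-∀

    ^-cong : ∀ k {a b} → a ≈ b → a ^ k ≈ b ^ k
    ^-cong zero    a≈b = ≈-refl
    ^-cong (suc k) a≈b = *-cong a≈b (^-cong k a≈b)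

    ∣⇒≈0 : ∀ {a} → p ℕ.∣ ∣ a ∣ → a ≈ 0ℤ
    ∣⇒≈0 {a} p∣a = mod (subst (λ z → p ℕ.∣ ∣ z ∣) (sym (+-identityʳ a)) p∣a)

    ≈0⇒∣ : ∀ {a} → a ≈ 0ℤ → p ℕ.∣ ∣ a ∣
    ≈0⇒∣ {a} a≈0 = subst (λ z → p ℕ.∣ ∣ z ∣) (+-identityʳ a) (unmod a≈0)

    ≈⇒-≈0 : ∀ {a b} → a ≈ b → a - b ≈ 0ℤ
    ≈⇒-≈0 a≈b = ∣⇒≈0 (unmod a≈b)

    -≈0⇒≈ : ∀ {a b} → a - b ≈ 0ℤ → a ≈ b
    -≈0⇒≈ a-b≈0 = mod (≈0⇒∣ a-b≈0)

    zero-product : ∀ a b → a * b ≈ 0ℤ → a ≈ 0ℤ ⊎ b ≈ 0ℤ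
    zero-product a b ab≈0 = Sum.map ∣⇒≈0 ∣⇒≈0
      (euclidsLemma ∣ a ∣ ∣ b ∣ p-prime (subst (p ℕ.∣_) (abs-* a b) (≈0⇒∣ ab≈0)))

    *-cancelˡ : ∀ {c a b} → ¬ c ≈ 0ℤ → c * a ≈ c * b → a ≈ b
    *-cancelˡ {c} {a} {b} c≉0 ca≈cb =
      [ (λ c≈0 → contradiction c≈0 c≉0) , -≈0⇒≈ ]′
        (zero-product c (a - b) (≈-trans (≈-reflexive (ring c a b)) (≈⇒-≈0 ca≈cb)))
      where
      ring : ∀ c a b → c * (a - b) ≡ c * a - c * b
      ring = solve-∀

    1≉0 : ¬ 1ℤ ≈ 0ℤ
    1≉0 1≈0 = ℕ.<⇒≱ 1<p (ℕ.∣⇒≤ (≈0⇒∣ 1≈0))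

    ^≈0⇒≈0 : ∀ k {a} → a ^ k ≈ 0ℤ → a ≈ 0ℤ
    ^≈0⇒≈0 zero        1≈0  = contradiction 1≈0 1≉0
    ^≈0⇒≈0 (suc k) {a} aᵏ≈0 = [ (λ a≈0 → a≈0) , ^≈0⇒≈0 k ]′ (zero-product a (a ^ k) aᵏ≈0)

    %-≈ : ∀ a → + (a ℕ.% p) ≈ + a
    %-≈ a = ≈-sym (≈-trans
      (≈-reflexive (trans (cong +_ (ℕ.m≡m%n+[m/n]*n a p)) (pos-+ (a ℕ.% p) (a ℕ./ p ℕ.* p))))
      (≈-trans (+-cong (≈-refl {+ (a ℕ.% p)}) (∣⇒≈0 {+ (a ℕ./ p ℕ.* p)} (ℕ.n∣m*n (a ℕ./ p))))
               (≈-reflexive (+-identityʳ (+ (a ℕ.% p))))))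

    private
      pos-∸ : ∀ {i j} → i ℕ.≤ j → + (j ℕ.∸ i) ≡ + j - + i
      pos-∸ {i} {j} i≤j = trans (sym (⊖-≥ i≤j)) (sym (m-n≡m⊖n j i))

      ordered : ∀ {i j} → i ℕ.≤ j → j ℕ.< p → + j ≈ + i → i ≡ j
      ordered {i} {j} i≤j j<p j≈i with j ℕ.∸ i ℕ.≟ 0
      ... | yes j∸i≡0 = ℕ.≤-antisym i≤j (ℕ.m∸n≡0⇒m≤n j∸i≡0)
      ... | no  j∸i≢0 = contradiction
        (ℕ.∣⇒≤ {{ℕ.≢-nonZero j∸i≢0}} (subst (λ z → p ℕ.∣ ∣ z ∣) (sym (pos-∸ i≤j)) (unmod j≈i)))
        (ℕ.<⇒≱ (ℕ.≤-<-trans (ℕ.m∸n≤m j i) j<p))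

    ≈⇒≡ : ∀ {i j} → i ℕ.< p → j ℕ.< p → + i ≈ + j → i ≡ j
    ≈⇒≡ {i} {j} i<p j<p i≈j = [ (λ i≤j → ordered i≤j j<p (≈-sym i≈j))
                               , (λ j≤i → sym (ordered j≤i i<p i≈j)) ]′ (ℕ.≤-total i j)

    -- A root `a` splits off a factor, and modulo a prime a product vanishes only if a factor does;
    -- so every other root is a root of the quotient.
    roots≤degree : ∀ {d} (cs : Vec ℤ d) → ∑[ h < p ] 𝟙 (monic cs (+ h) ≈? 0ℤ) ℕ.≤ d
    roots≤degree []           = ℕ.≤-reflexive (∑-zero p (λ h _ → 𝟙-no (1ℤ ≈? 0ℤ) 1≉0))
    roots≤degree {suc d} cs with ℕ.anyUpTo? (λ h → monic cs (+ h) ≈? 0ℤ) p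
    ... | no  none = ℕ.≤-trans (ℕ.≤-reflexive (∑-zero p (λ h h<p →
                       𝟙-no (monic cs (+ h) ≈? 0ℤ) (λ root → none (h , h<p , root))))) ℕ.z≤n
    ... | yes (a , a<p , fa≈0) = ℕ.≤-trans (∑-mono p pointwise)
      (ℕ.≤-trans (ℕ.≤-reflexive (∑-distrib-+ p (λ h → 𝟙 (h ℕ.≟ a)) (λ h → 𝟙 (monic ds (+ h) ≈? 0ℤ))))
        (ℕ.+-mono-≤ (∑𝟙≤1 p (ℕ._≟ a) (λ i j _ _ i≡a j≡a → trans i≡a (sym j≡a)))
                    (roots≤degree ds)))
      where
      open ≈-Reasoning ≈-setoid
      ds = proj₁ (factor-theorem cs (+ a))
      factorise : ∀ h → monic cs (+ h) ≈ 0ℤ → (+ h - + a) * monic ds (+ h) ≈ 0ℤ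
      factorise h fh≈0 = begin
        (+ h - + a) * monic ds (+ h)                   ≡⟨ +-identityʳ _ ⟨
        (+ h - + a) * monic ds (+ h) + 0ℤ              ≈⟨ +-cong (≈-refl {(+ h - + a) * monic ds (+ h)}) fa≈0 ⟨
        (+ h - + a) * monic ds (+ h) + monic cs (+ a)  ≡⟨ proj₂ (factor-theorem cs (+ a)) (+ h) ⟨
        monic cs (+ h)                                 ≈⟨ fh≈0 ⟩
        0ℤ                                             ∎
      pointwise : ∀ h → h ℕ.< p →
        𝟙 (monic cs (+ h) ≈? 0ℤ) ℕ.≤ 𝟙 (h ℕ.≟ a) ℕ.+ 𝟙 (monic ds (+ h) ≈? 0ℤ)
      pointwise h h<p with monic cs (+ h) ≈? 0ℤ
      ... | no  _    = ℕ.z≤n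
      ... | yes fh≈0 with zero-product (+ h - + a) (monic ds (+ h)) (factorise h fh≈0)
      ... | inj₁ h-a≈0 = ℕ.≤-trans
              (ℕ.≤-reflexive (sym (𝟙-yes (h ℕ.≟ a) (≈⇒≡ h<p a<p (-≈0⇒≈ h-a≈0))))) (ℕ.m≤m+n _ _)
      ... | inj₂ gh≈0 = ℕ.≤-trans
              (ℕ.≤-reflexive (sym (𝟙-yes (monic ds (+ h) ≈? 0ℤ) gh≈0))) (ℕ.m≤n+m _ _)

    -- In place of the cyclic structure of the unit group: the kernel of z ↦ z^d has at most d
    -- elements.
    roots-of-unity : ∀ d → .{{ℕ.NonZero d}} → ∑[ h < p ] 𝟙 ((+ h) ^ d ≈? 1ℤ) ℕ.≤ d
    roots-of-unity (suc d) = ℕ.≤-trans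
      (∑-mono p (λ h _ → 𝟙-mono ((+ h) ^ suc d ≈? 1ℤ) (monic cs (+ h) ≈? 0ℤ) (root h)))
      (roots≤degree cs)
      where
      cs = - 1ℤ ∷ replicate d 0ℤ
      root : ∀ h → (+ h) ^ suc d ≈ 1ℤ → monic cs (+ h) ≈ 0ℤ
      root h hᵈ≈1 = subst (_≈ 0ℤ)
        (trans (+-comm ((+ h) ^ suc d) (- 1ℤ))
               (cong (λ z → - 1ℤ + + h * z) (sym (monic-zeros d (+ h)))))
        (≈⇒-≈0 hᵈ≈1)

    -- The prime divides p! = (p C k) · k! · (p - k)!, but neither of the two smaller factorials.
    p∣binomial : ∀ {k} → 0 ℕ.< k → k ℕ.< p → p ℕ.∣ (p C k)
    p∣binomial {k} 0<k k<p = [ (λ p∣C → p∣C) , (λ p∣d → contradiction p∣d p∤d) ]′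
      (euclidsLemma (p C k) d p-prime (subst (p ℕ.∣_) p!≡ p∣p!))
      where
      d = k ! ℕ.* (p ℕ.∸ k) !
      instance
        d≢0 : ℕ.NonZero d
        d≢0 = k !* (p ℕ.∸ k) !≢0
      p!≡ : p ! ≡ (p C k) ℕ.* d
      p!≡ = sym (trans (cong (ℕ._* d) (nCk≡n!/k![n-k]! (ℕ.<⇒≤ k<p))) (ℕ.m/n*n≡m (k![n∸k]!∣n! (ℕ.<⇒≤ k<p))))
      p∣p! : p ℕ.∣ p !
      p∣p! = subst (λ n → n ℕ.∣ n !) (ℕ.suc-pred p) (ℕ.m∣m*n (ℕ.pred p !))
      p∤! : ∀ j → j ℕ.< p → ¬ p ℕ.∣ j !
      p∤! zero    j<p p∣1  = ℕ.<⇒≱ 1<p (ℕ.∣⇒≤ p∣1)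
      p∤! (suc j) j<p p∣j! = [ (λ p∣j → ℕ.<⇒≱ j<p (ℕ.∣⇒≤ p∣j)) , p∤! j (ℕ.<-trans (ℕ.n<1+n j) j<p) ]′
        (euclidsLemma (suc j) (j !) p-prime p∣j!)
      p∤d : ¬ p ℕ.∣ d
      p∤d p∣d = [ p∤! k k<p , p∤! (p ℕ.∸ k) (ℕ.∸-monoʳ-< 0<k (ℕ.<⇒≤ k<p)) ]′
        (euclidsLemma (k !) ((p ℕ.∸ k) !) p-prime p∣d)

    ∑-multiples : ∀ N {f} → (∀ x → x ℕ.< N → p ℕ.∣ f x) → p ℕ.∣ ∑ N f
    ∑-multiples zero    h = ℕ.divides 0 refl
    ∑-multiples (suc N) h = ℕ.∣m∣n⇒∣m+n (∑-multiples N (λ x x<N → h x (ℕ.m<n⇒m<1+n x<N))) (h N (ℕ.n<1+n N))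

    -- The inductive step of `a^p≈a`: in the expansion of (1 + a)^p all inner binomial coefficients
    -- vanish modulo p.
    frobenius : ∀ a → + (suc a ℕ.^ p) ≈ + suc (a ℕ.^ p)
    frobenius a = ≈-trans (≈-reflexive (cong +_ expand)) (begin
      + (1 ℕ.+ (inner ℕ.+ a ℕ.^ p))  ≡⟨ cong +_ (ring inner (a ℕ.^ p)) ⟩
      + (inner ℕ.+ suc (a ℕ.^ p))    ≡⟨ pos-+ inner (suc (a ℕ.^ p)) ⟩
      + inner + + suc (a ℕ.^ p)      ≈⟨ +-cong (∣⇒≈0 {+ inner} p∣inner) (≈-refl {+ suc (a ℕ.^ p)}) ⟩
      0ℤ + + suc (a ℕ.^ p)           ≡⟨ +-identityˡ (+ suc (a ℕ.^ p)) ⟩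
      + suc (a ℕ.^ p)                ∎)
      where
      open ≈-Reasoning ≈-setoid
      ring : ∀ i b → 1 ℕ.+ (i ℕ.+ b) ≡ i ℕ.+ suc b
      ring i b = sym (ℕ.+-suc i b)
      term = λ k → (p C k) ℕ.* a ℕ.^ k
      inner = ∑[ k < ℕ.pred p ] term (suc k)
      p∣inner : p ℕ.∣ inner
      p∣inner = ∑-multiples (ℕ.pred p) (λ k k<p-1 → ℕ.∣m⇒∣m*n (a ℕ.^ suc k)
        (p∣binomial (ℕ.s≤s ℕ.z≤n) (subst (suc k ℕ.<_) (ℕ.suc-pred p) (ℕ.s<s k<p-1))))
      expand : suc a ℕ.^ p ≡ 1 ℕ.+ (inner ℕ.+ a ℕ.^ p)
      expand = trans (binomial p a) (trans (cong (λ q → ∑ (suc q) term) (sym (ℕ.suc-pred p)))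
        (trans (∑-head (suc (ℕ.pred p)) term) (cong (λ v → 1 ℕ.+ (inner ℕ.+ v))
          (trans (cong (λ q → (p C q) ℕ.* a ℕ.^ q) (ℕ.suc-pred p))
            (trans (cong (ℕ._* a ℕ.^ p) (nCn≡1 p)) (ℕ.*-identityˡ (a ℕ.^ p)))))))

    a^p≈a : ∀ a → (+ a) ^ p ≈ + a
    a^p≈a a = ≈-trans (≈-reflexive (sym (pos-^ a p))) (go a)
      where
      go : ∀ a → + (a ℕ.^ p) ≈ + a
      go zero    = ≈-reflexive (cong (λ q → + (0 ℕ.^ q)) (sym (ℕ.suc-pred p)))
      go (suc a) = ≈-trans (frobenius a) (+-cong (≈-refl {1ℤ}) (go a))

    fermat : ∀ a → ¬ + a ≈ 0ℤ → (+ a) ^ (p ℕ.∸ 1) ≈ 1ℤ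
    fermat a a≉0 = *-cancelˡ a≉0 (begin
      (+ a) ^ suc (p ℕ.∸ 1)  ≡⟨ cong ((+ a) ^_) (ℕ.m+[n∸m]≡n {1} (ℕ.<⇒≤ 1<p)) ⟩
      (+ a) ^ p              ≈⟨ a^p≈a a ⟩
      + a                    ≡⟨ *-identityʳ (+ a) ⟨
      + a * 1ℤ               ∎)
      where open ≈-Reasoning ≈-setoid

-- Second moment bound for sumsets that avoid a coset of the subgroup of order H.

module SecondMoment where

  open import Data.Bool.Base using (Bool; true; false)
  open import Data.Integer.Base using (+_; 0ℤ; 1ℤ) renaming (_^_ to _^ᶻ_; _*_ to _*ᶻ_; _+_ to _+ᶻ_; _-_ to _-ᶻ_)
  import Data.Integer.Properties as ℤ
  open import Data.Integer.Tactic.RingSolver using () renaming (solve-∀ to ℤ-solve-∀)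
  open import Data.Nat.Base
  open import Data.Nat.DivMod using (m%n<n)
  open import Data.Nat.Properties
  open import Data.Nat.Primality using (Prime; prime⇒nonZero)
  open import Data.Nat.Tactic.RingSolver using (solve-∀)
  open import Data.Product.Base using (∃-syntax; _×_; _,_)
  open import Data.Sum.Base as Sum using (_⊎_; [_,_]′)
  open import Relation.Binary.PropositionalEquality
  import Relation.Binary.Reasoning.Setoid as ≈-Reasoning
  open import Relation.Nullary using (¬_; yes; no; contradiction)
  open Sums
  open Modular

  -- The form of (a - b)² ≥ 0 that makes sense in ℕ; squared deviations are handled through it
  -- without any subtraction.
  2ab≤a²+b² : ∀ a b → 2 * (a * b) ≤ a * a + b * b
  2ab≤a²+b² a b = [ (λ a≤b → ordered a b a≤b)
                   , (λ b≤a → subst₂ _≤_ (cong (2 *_) (*-comm b a)) (+-comm (b * b) (a * a)) (ordered b a b≤a))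
                   ]′ (≤-total a b)
    where
    square : ∀ a d → 2 * (a * (a + d)) + d * d ≡ a * a + (a + d) * (a + d)
    square = solve-∀
    ordered : ∀ a b → a ≤ b → 2 * (a * b) ≤ a * a + b * b
    ordered a b a≤b with b ∸ a | m+[n∸m]≡n a≤b
    ... | d | refl = m+n≤o⇒m≤o _ (≤-reflexive (square a d))

  module _ {p : ℕ} (p-prime : Prime p) where

    open ModPrime p-prime

    private
      instance
        p≢0 : NonZero p
        p≢0 = prime⇒nonZero p-prime
      n = p ∸ 1

    suc-n : suc n ≡ p
    suc-n = m+[n∸m]≡n {1} (<⇒≤ 1<p)

    inverse : ∀ a → ¬ + a ≈ 0ℤ → ∃[ b ] + b *ᶻ + a ≈ 1ℤ
    inverse a a≉0 = a ^ (p ∸ 2) , (begin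
      + (a ^ (p ∸ 2)) *ᶻ + a     ≡⟨ cong (_*ᶻ + a) (pos-^ a (p ∸ 2)) ⟩
      (+ a) ^ᶻ (p ∸ 2) *ᶻ + a    ≡⟨ ℤ.*-comm ((+ a) ^ᶻ (p ∸ 2)) (+ a) ⟩
      (+ a) ^ᶻ suc (p ∸ 2)       ≡⟨ cong ((+ a) ^ᶻ_) (+-∸-assoc 1 1<p) ⟨
      (+ a) ^ᶻ (p ∸ 1)           ≈⟨ fermat a a≉0 ⟩
      1ℤ                         ∎)
      where open ≈-Reasoning ≈-setoid

    quotient : ∀ a b → ¬ + b ≈ 0ℤ → ∃[ h ] (h < p × + a ≈ + h *ᶻ + b)
    quotient a b b≉0 = found (inverse b b≉0)
      where
      open ≈-Reasoning ≈-setoid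
      found : ∃[ c ] + c *ᶻ + b ≈ 1ℤ → ∃[ h ] (h < p × + a ≈ + h *ᶻ + b)
      found (c , cb≈1) = (a * c) % p , m%n<n (a * c) p , ≈-sym (begin
        + ((a * c) % p) *ᶻ + b  ≈⟨ *-cong (%-≈ (a * c)) (≈-refl {+ b}) ⟩
        + (a * c) *ᶻ + b        ≡⟨ cong (_*ᶻ + b) (ℤ.pos-* a c) ⟩
        + a *ᶻ + c *ᶻ + b       ≡⟨ ℤ.*-assoc (+ a) (+ c) (+ b) ⟩
        + a *ᶻ (+ c *ᶻ + b)     ≈⟨ *-cong (≈-refl {+ a}) cb≈1 ⟩
        + a *ᶻ 1ℤ               ≡⟨ ℤ.*-identityʳ (+ a) ⟩
        + a                     ∎)

    ^-distrib-* : ∀ a b k → (a *ᶻ b) ^ᶻ k ≡ a ^ᶻ k *ᶻ b ^ᶻ k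
    ^-distrib-* a b zero    = refl
    ^-distrib-* a b (suc k) = trans (cong ((a *ᶻ b) *ᶻ_) (^-distrib-* a b k)) (ring a b (a ^ᶻ k) (b ^ᶻ k))
      where
      ring : ∀ a b c d → a *ᶻ b *ᶻ (c *ᶻ d) ≡ a *ᶻ c *ᶻ (b *ᶻ d)
      ring = ℤ-solve-∀

    -- Subtracting the two equations leaves (s - t)(1 - h) ≈ 0. If h ≈ 1, either equation reads x ≈
    -- x′.
    affine-injective : ∀ x x′ s t h →
      x +ᶻ s ≈ h *ᶻ (x′ +ᶻ s) → x +ᶻ t ≈ h *ᶻ (x′ +ᶻ t) → s ≈ t ⊎ x ≈ x′
    affine-injective x x′ s t h xs≈ xt≈ =
      Sum.map -≈0⇒≈ (λ 1-h≈0 → x≈x′ (-≈0⇒≈ 1-h≈0))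
        (zero-product (s -ᶻ t) (1ℤ -ᶻ h) (≈-trans (≈-reflexive (ring x x′ s t h))
          (≈⇒-≈0 (≈-trans (≈⇒-≈0 xs≈) (≈-sym (≈⇒-≈0 xt≈))))))
      where
      ring : ∀ x x′ s t h → (s -ᶻ t) *ᶻ (1ℤ -ᶻ h)
           ≡ (x +ᶻ s -ᶻ h *ᶻ (x′ +ᶻ s)) -ᶻ (x +ᶻ t -ᶻ h *ᶻ (x′ +ᶻ t))
      ring = ℤ-solve-∀
      cancel : ∀ x s x′ → x -ᶻ x′ ≡ x +ᶻ s -ᶻ 1ℤ *ᶻ (x′ +ᶻ s)
      cancel = ℤ-solve-∀
      x≈x′ : 1ℤ ≈ h → x ≈ x′
      x≈x′ 1≈h = -≈0⇒≈ (≈-trans (≈-reflexive (cancel x s x′))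
        (≈⇒-≈0 (≈-trans xs≈ (*-cong (≈-sym 1≈h) (≈-refl {x′ +ᶻ s})))))

    -- The map z ↦ z ^ H sends the units to the m-th roots of unity, where H m = p - 1.
    -- If it avoids one of these on X + Y, then X and Y are small: for a root of unity v
    -- and a shift t let S t v count the x ∈ X with (x + t) ^ H ≈ v.  The squares of
    -- p S t v - |X| H, summed over all t and v, are controlled by counting
    -- pairs x, x′, and each t ∈ Y contributes (|X| H)² to them.
    module Sumset (H m : ℕ) {{_ : NonZero H}} {{_ : NonZero m}} (Hm≡n : H * m ≡ n)
      (v₀ : ℕ) (v₀<p : v₀ < p) (v₀ᵐ≈1 : (+ v₀) ^ᶻ m ≈ 1ℤ) (X Y : ℕ → Bool)
      (avoids : ∀ x y → X x ≡ true → Y y ≡ true → ¬ (+ (x + y)) ^ᶻ H ≈ + v₀) where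

      k ∣Y∣ : ℕ
      k   = ∑[ x < p ] bit (X x)
      ∣Y∣ = ∑[ y < p ] bit (Y y)

      ζ : ℕ → ℕ → ℕ → ℕ
      ζ t x v = 𝟙 ((+ (x + t)) ^ᶻ H ≈? + v)

      ρ : ℕ → ℕ
      ρ v = 𝟙 ((+ v) ^ᶻ m ≈? 1ℤ)

      S : ℕ → ℕ → ℕ
      S t v = ∑[ x < p ] (bit (X x) * ζ t x v)

      shift-unique : ∀ x s t → s < p → t < p → + (x + s) ≈ 0ℤ → + (x + t) ≈ 0ℤ → s ≡ t
      shift-unique x s t s<p t<p xs≈0 xt≈0 = ≈⇒≡ s<p t<p (-≈0⇒≈ (begin
        + s -ᶻ + t                  ≡⟨ ring (+ x) (+ s) (+ t) ⟩
        (+ x +ᶻ + s) -ᶻ (+ x +ᶻ + t)  ≡⟨ cong₂ _-ᶻ_ (ℤ.pos-+ x s) (ℤ.pos-+ x t) ⟨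
        + (x + s) -ᶻ + (x + t)      ≈⟨ ≈⇒-≈0 (≈-trans xs≈0 (≈-sym xt≈0)) ⟩
        0ℤ                          ∎))
        where
        open ≈-Reasoning ≈-setoid
        ring : ∀ x s t → s -ᶻ t ≡ (x +ᶻ s) -ᶻ (x +ᶻ t)
        ring = ℤ-solve-∀

      -- By Fermat's theorem and H m = p - 1, the H-th power of a unit is an m-th root of unity, so
      -- some v is hit. The second summand pays for the shift that makes x + t vanish.
      unit-value : ∀ x t → 1 ≤ ∑[ v < p ] (ρ v * ζ t x v) + 𝟙 (+ (x + t) ≈? 0ℤ)
      unit-value x t with + (x + t) ≈? 0ℤ
      ... | yes _  = m≤n+m 1 _
      ... | no a≉0 = ≤-trans (≤-trans (≤-reflexive (sym (cong₂ _*_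
                        (𝟙-yes ((+ v) ^ᶻ m ≈? 1ℤ) vᵐ≈1)
                        (𝟙-yes ((+ a) ^ᶻ H ≈? + v) (≈-sym v≈aᴴ)))))
                        (term≤∑ p (λ v → ρ v * ζ t x v) (m%n<n (a ^ H) p)))
                      (m≤m+n _ 0)
        where
        open ≈-Reasoning ≈-setoid
        a = x + t
        v = (a ^ H) % p
        v≈aᴴ : + v ≈ (+ a) ^ᶻ H
        v≈aᴴ = ≈-trans (%-≈ (a ^ H)) (≈-reflexive (pos-^ a H))
        vᵐ≈1 : (+ v) ^ᶻ m ≈ 1ℤ
        vᵐ≈1 = begin
          (+ v) ^ᶻ m          ≈⟨ ^-cong m v≈aᴴ ⟩
          ((+ a) ^ᶻ H) ^ᶻ m   ≡⟨ ℤ.^-*-assoc (+ a) H m ⟩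
          (+ a) ^ᶻ (H * m)    ≡⟨ cong ((+ a) ^ᶻ_) Hm≡n ⟩
          (+ a) ^ᶻ n          ≈⟨ fermat a a≉0 ⟩
          1ℤ                  ∎

      units : ∀ x → n ≤ ∑[ t < p ] ∑[ v < p ] (ρ v * ζ t x v)
      units x = +-cancelʳ-≤ 1 n _ (begin
        n + 1                                    ≡⟨ trans (+-comm n 1) suc-n ⟩
        p                                        ≡⟨ trans (∑-const p 1) (*-identityʳ p) ⟨
        ∑[ t < p ] 1                             ≤⟨ ∑-mono p (λ t _ → unit-value x t) ⟩
        ∑[ t < p ] (value t + 𝟙 (+ (x + t) ≈? 0ℤ))  ≡⟨ ∑-distrib-+ p value (λ t → 𝟙 (+ (x + t) ≈? 0ℤ)) ⟩
        ∑ p value + ∑[ t < p ] 𝟙 (+ (x + t) ≈? 0ℤ)  ≤⟨ +-monoʳ-≤ (∑ p value)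
                                                        (∑𝟙≤1 p (λ t → + (x + t) ≈? 0ℤ) (shift-unique x)) ⟩
        ∑ p value + 1                            ∎)
        where
        open ≤-Reasoning
        value : ℕ → ℕ
        value t = ∑[ v < p ] (ρ v * ζ t x v)

      -- A lower bound is the right direction: the first moment enters the expanded squares through
      -- the cross term, which stands on the smaller side of `total-deviation`.
      first-moment : k * n ≤ ∑[ t < p ] ∑[ v < p ] (ρ v * S t v)
      first-moment = begin
        k * n                                                      ≡⟨ *-distribʳ-∑ p n (λ x → bit (X x)) ⟩
        ∑[ x < p ] (bit (X x) * n)                                 ≤⟨ ∑-mono p (λ x _ → *-monoʳ-≤ (bit (X x)) (units x)) ⟩
        ∑[ x < p ] (bit (X x) * ∑[ t < p ] ∑[ v < p ] (ρ v * ζ t x v))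
          ≡⟨ ∑-cong p (λ x _ → trans (*-distribˡ-∑ p (bit (X x)) (λ t → ∑[ v < p ] (ρ v * ζ t x v)))
               (∑-cong p (λ t _ → *-distribˡ-∑ p (bit (X x)) (λ v → ρ v * ζ t x v)))) ⟩
        ∑[ x < p ] ∑[ t < p ] ∑[ v < p ] (bit (X x) * (ρ v * ζ t x v))
          ≡⟨ ∑-swap p p (λ x t → ∑[ v < p ] (bit (X x) * (ρ v * ζ t x v))) ⟩
        ∑[ t < p ] ∑[ x < p ] ∑[ v < p ] (bit (X x) * (ρ v * ζ t x v))
          ≡⟨ ∑-cong p (λ t _ → ∑-swap p p (λ x v → bit (X x) * (ρ v * ζ t x v))) ⟩
        ∑[ t < p ] ∑[ v < p ] ∑[ x < p ] (bit (X x) * (ρ v * ζ t x v))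
          ≡⟨ ∑-cong p (λ t _ → ∑-cong p (λ v _ → trans
               (∑-cong p (λ x _ → ring (bit (X x)) (ρ v) (ζ t x v)))
               (sym (*-distribˡ-∑ p (ρ v) (λ x → bit (X x) * ζ t x v))))) ⟩
        ∑[ t < p ] ∑[ v < p ] (ρ v * S t v)                        ∎
        where
        open ≤-Reasoning
        ring : ∀ a b c → a * (b * c) ≡ b * (a * c)
        ring = solve-∀

      root-unit : ∀ x t v → (+ (x + t)) ^ᶻ H ≈ + v → (+ v) ^ᶻ m ≈ 1ℤ → ¬ + (x + t) ≈ 0ℤ
      root-unit x t v aᴴ≈v vᵐ≈1 a≈0 = 1≉0 (begin
        1ℤ                    ≈⟨ vᵐ≈1 ⟨
        (+ v) ^ᶻ m            ≈⟨ ^-cong m aᴴ≈v ⟨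
        ((+ a) ^ᶻ H) ^ᶻ m     ≡⟨ ℤ.^-*-assoc (+ a) H m ⟩
        (+ a) ^ᶻ (H * m)      ≈⟨ ^-cong (H * m) a≈0 ⟩
        0ℤ ^ᶻ (H * m)         ≡⟨ cong (0ℤ ^ᶻ_) (suc-pred (H * m) {{m*n≢0 H m}}) ⟨
        0ℤ ^ᶻ suc (pred (H * m)) ≡⟨⟩
        0ℤ                    ∎)
        where
        open ≈-Reasoning ≈-setoid
        a = x + t

      collision : ℕ → ℕ → ℕ → ℕ
      collision x x′ t = ∑[ v < p ] (ρ v * (ζ t x v * ζ t x′ v))

      ∑ζ≤1 : ∀ t x → ∑[ v < p ] ζ t x v ≤ 1
      ∑ζ≤1 t x = ∑𝟙≤1 p (λ v → (+ (x + t)) ^ᶻ H ≈? + v)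
        (λ v w v<p w<p a≈v a≈w → ≈⇒≡ v<p w<p (≈-trans (≈-sym a≈v) a≈w))

      collision≤1 : ∀ x x′ t → collision x x′ t ≤ 1
      collision≤1 x x′ t = ≤-trans (∑-mono p (λ v _ → bound v)) (∑ζ≤1 t x)
        where
        bound : ∀ v → ρ v * (ζ t x v * ζ t x′ v) ≤ ζ t x v
        bound v = ≤-trans (*-mono-≤ (𝟙≤1 ((+ v) ^ᶻ m ≈? 1ℤ))
                            (*-monoʳ-≤ (ζ t x v) (𝟙≤1 ((+ (x′ + t)) ^ᶻ H ≈? + v))))
          (≤-reflexive (trans (*-identityˡ _) (*-identityʳ _)))

      ratio : ℕ → ℕ → ℕ → ℕ → ℕ
      ratio x x′ t h = 𝟙 ((+ h) ^ᶻ H ≈? 1ℤ) * 𝟙 (+ (x + t) ≈? + h *ᶻ + (x′ + t))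

      -- If x + t and x′ + t have the same H-th power, and it is a root of unity, then x′ + t is
      -- invertible and the quotient h satisfies h^H ≈ 1. Parametrising collisions by h makes them
      -- countable.
      collision≤ratio : ∀ x x′ t → collision x x′ t ≤ ∑[ h < p ] ratio x x′ t h
      collision≤ratio x x′ t = begin
        collision x x′ t                                    ≤⟨ ∑-mono p (λ v _ → bound v) ⟩
        ∑[ v < p ] (ζ t x v * ∑[ h < p ] ratio x x′ t h)    ≡⟨ *-distribʳ-∑ p (∑[ h < p ] ratio x x′ t h) (ζ t x) ⟨
        ∑ p (ζ t x) * ∑[ h < p ] ratio x x′ t h             ≤⟨ *-monoˡ-≤ (∑[ h < p ] ratio x x′ t h) (∑ζ≤1 t x) ⟩
        1 * ∑[ h < p ] ratio x x′ t h                       ≡⟨ *-identityˡ _ ⟩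
        ∑[ h < p ] ratio x x′ t h                           ∎
        where
        open ≤-Reasoning
        a b : ℕ
        a = x + t
        b = x′ + t
        exists : ∀ v → (+ v) ^ᶻ m ≈ 1ℤ → (+ a) ^ᶻ H ≈ + v → (+ b) ^ᶻ H ≈ + v → 1 ≤ ∑[ h < p ] ratio x x′ t h
        exists v vᵐ≈1 aᴴ≈v bᴴ≈v = found (quotient a b (root-unit x′ t v bᴴ≈v vᵐ≈1))
          where
          module R = ≈-Reasoning ≈-setoid
          bᴴ≉0 : ¬ (+ b) ^ᶻ H ≈ 0ℤ
          bᴴ≉0 bᴴ≈0 = root-unit x′ t v bᴴ≈v vᵐ≈1 (^≈0⇒≈0 H bᴴ≈0)
          power≈1 : ∀ h → + a ≈ + h *ᶻ + b → (+ h) ^ᶻ H ≈ 1ℤ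
          power≈1 h a≈hb = *-cancelˡ {(+ b) ^ᶻ H} {(+ h) ^ᶻ H} {1ℤ} bᴴ≉0 (R.begin
            (+ b) ^ᶻ H *ᶻ (+ h) ^ᶻ H  R.≡⟨ ℤ.*-comm ((+ b) ^ᶻ H) ((+ h) ^ᶻ H) ⟩
            (+ h) ^ᶻ H *ᶻ (+ b) ^ᶻ H  R.≡⟨ ^-distrib-* (+ h) (+ b) H ⟨
            (+ h *ᶻ + b) ^ᶻ H         R.≈⟨ ^-cong H a≈hb ⟨
            (+ a) ^ᶻ H                R.≈⟨ ≈-trans aᴴ≈v (≈-sym bᴴ≈v) ⟩
            (+ b) ^ᶻ H                R.≡⟨ ℤ.*-identityʳ ((+ b) ^ᶻ H) ⟨
            (+ b) ^ᶻ H *ᶻ 1ℤ          R.∎)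
          found : ∃[ h ] (h < p × + a ≈ + h *ᶻ + b) → 1 ≤ ∑[ h < p ] ratio x x′ t h
          found (h , h<p , a≈hb) = ≤-trans (≤-reflexive (sym (cong₂ _*_
              (𝟙-yes ((+ h) ^ᶻ H ≈? 1ℤ) (power≈1 h a≈hb)) (𝟙-yes (+ a ≈? + h *ᶻ + b) a≈hb))))
            (term≤∑ p (ratio x x′ t) h<p)
        bound : ∀ v → ρ v * (ζ t x v * ζ t x′ v) ≤ ζ t x v * ∑[ h < p ] ratio x x′ t h
        bound v = 𝟙*≤ ((+ v) ^ᶻ m ≈? 1ℤ) (λ vᵐ≈1 → 𝟙*≤ ((+ a) ^ᶻ H ≈? + v) (λ aᴴ≈v →
          subst (λ z → ζ t x′ v ≤ z * ∑[ h < p ] ratio x x′ t h) (sym (𝟙-yes ((+ a) ^ᶻ H ≈? + v) aᴴ≈v))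
            (≤-trans (≤-reflexive (sym (*-identityʳ (ζ t x′ v))))
              (𝟙*≤ ((+ b) ^ᶻ H ≈? + v) (λ bᴴ≈v →
                ≤-trans (exists v vᵐ≈1 aᴴ≈v bᴴ≈v) (≤-reflexive (sym (*-identityˡ _))))))))

      ratio-unique : ∀ {x x′} h s t → x < p → x′ < p → x ≢ x′ → s < p → t < p →
        + (x + s) ≈ + h *ᶻ + (x′ + s) → + (x + t) ≈ + h *ᶻ + (x′ + t) → s ≡ t
      ratio-unique {x} {x′} h s t x<p x′<p x≢x′ s<p t<p xs≈ xt≈ =
        [ ≈⇒≡ s<p t<p , (λ x≈x′ → contradiction (≈⇒≡ x<p x′<p x≈x′) x≢x′) ]′
          (affine-injective (+ x) (+ x′) (+ s) (+ t) (+ h)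
            (subst₂ (λ a b → a ≈ + h *ᶻ b) (ℤ.pos-+ x s) (ℤ.pos-+ x′ s) xs≈)
            (subst₂ (λ a b → a ≈ + h *ᶻ b) (ℤ.pos-+ x t) (ℤ.pos-+ x′ t) xt≈))

      -- On the diagonal every shift may collide. Off it there are at most H ratios h, and by
      -- `ratio-unique` each of them fixes the shift. This H equals n / m, the number expected of
      -- independent values.
      collisions : ∀ x x′ → x < p → x′ < p → ∑[ t < p ] collision x x′ t ≤ 𝟙 (x′ ≟ x) * p + H
      collisions x x′ x<p x′<p with x′ ≟ x
      ... | yes _ = ≤-trans (∑-mono p (λ t _ → collision≤1 x x′ t))
                     (≤-trans (≤-reflexive (trans (∑-const p 1) (*-comm p 1))) (m≤m+n (1 * p) H))
      ... | no x′≢x = begin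
        ∑[ t < p ] collision x x′ t                       ≤⟨ ∑-mono p (λ t _ → collision≤ratio x x′ t) ⟩
        ∑[ t < p ] ∑[ h < p ] ratio x x′ t h              ≡⟨ ∑-swap p p (ratio x x′) ⟩
        ∑[ h < p ] ∑[ t < p ] ratio x x′ t h              ≡⟨ ∑-cong p (λ h _ → *-distribˡ-∑ p (𝟙 ((+ h) ^ᶻ H ≈? 1ℤ))
                                                               (λ t → 𝟙 (+ (x + t) ≈? + h *ᶻ + (x′ + t)))) ⟨
        ∑[ h < p ] (𝟙 ((+ h) ^ᶻ H ≈? 1ℤ) * ∑[ t < p ] 𝟙 (+ (x + t) ≈? + h *ᶻ + (x′ + t)))
          ≤⟨ ∑-mono p (λ h _ → *-monoʳ-≤ (𝟙 ((+ h) ^ᶻ H ≈? 1ℤ))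
               (∑𝟙≤1 p (λ t → + (x + t) ≈? + h *ᶻ + (x′ + t))
                 (λ s t → ratio-unique h s t x<p x′<p (λ x≡x′ → x′≢x (sym x≡x′))))) ⟩
        ∑[ h < p ] (𝟙 ((+ h) ^ᶻ H ≈? 1ℤ) * 1)             ≡⟨ ∑-cong p (λ h _ → *-identityʳ _) ⟩
        ∑[ h < p ] 𝟙 ((+ h) ^ᶻ H ≈? 1ℤ)                   ≤⟨ roots-of-unity H ⟩
        H                                                 ∎
        where open ≤-Reasoning

      square-sum : ∀ t v → ρ v * (S t v * S t v)
        ≡ ∑[ x < p ] ∑[ x′ < p ] (bit (X x) * bit (X x′) * (ρ v * (ζ t x v * ζ t x′ v)))
      square-sum t v = begin
        ρ v * (S t v * S t v)
          ≡⟨ cong (ρ v *_) (∑*∑ p p f f) ⟩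
        ρ v * ∑[ x < p ] ∑[ x′ < p ] (f x * f x′)
          ≡⟨ trans (*-distribˡ-∑ p (ρ v) (λ x → ∑[ x′ < p ] (f x * f x′)))
               (∑-cong p (λ x _ → *-distribˡ-∑ p (ρ v) (λ x′ → f x * f x′))) ⟩
        ∑[ x < p ] ∑[ x′ < p ] (ρ v * (f x * f x′))
          ≡⟨ ∑-cong p (λ x _ → ∑-cong p (λ x′ _ → ring (ρ v) (bit (X x)) (ζ t x v) (bit (X x′)) (ζ t x′ v))) ⟩
        ∑[ x < p ] ∑[ x′ < p ] (bit (X x) * bit (X x′) * (ρ v * (ζ t x v * ζ t x′ v))) ∎
        where
        open ≡-Reasoning
        f : ℕ → ℕ
        f x = bit (X x) * ζ t x v
        ring : ∀ r a b c d → r * (a * b * (c * d)) ≡ a * c * (r * (b * d))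
        ring = solve-∀

      -- Expanding the squares gives a sum over pairs x, x′ of X, and the order of summation is
      -- changed until the shifts stand innermost. The diagonal then yields k p and the bound H for
      -- all pairs yields k² H.
      second-moment : ∑[ t < p ] ∑[ v < p ] (ρ v * (S t v * S t v)) ≤ k * p + k * k * H
      second-moment = begin
        ∑[ t < p ] ∑[ v < p ] (ρ v * (S t v * S t v))
          ≡⟨ ∑-cong p (λ t _ → ∑-cong p (λ v _ → square-sum t v)) ⟩
        ∑[ t < p ] ∑[ v < p ] ∑[ x < p ] ∑[ x′ < p ] w x x′ t v
          ≡⟨ ∑-cong p (λ t _ → ∑-swap p p (λ v x → ∑[ x′ < p ] w x x′ t v)) ⟩
        ∑[ t < p ] ∑[ x < p ] ∑[ v < p ] ∑[ x′ < p ] w x x′ t v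
          ≡⟨ ∑-swap p p (λ t x → ∑[ v < p ] ∑[ x′ < p ] w x x′ t v) ⟩
        ∑[ x < p ] ∑[ t < p ] ∑[ v < p ] ∑[ x′ < p ] w x x′ t v
          ≡⟨ ∑-cong p (λ x _ → ∑-cong p (λ t _ → ∑-swap p p (λ v x′ → w x x′ t v))) ⟩
        ∑[ x < p ] ∑[ t < p ] ∑[ x′ < p ] ∑[ v < p ] w x x′ t v
          ≡⟨ ∑-cong p (λ x _ → ∑-swap p p (λ t x′ → ∑[ v < p ] w x x′ t v)) ⟩
        ∑[ x < p ] ∑[ x′ < p ] ∑[ t < p ] ∑[ v < p ] w x x′ t v
          ≡⟨ ∑-cong p (λ x _ → ∑-cong p (λ x′ _ → sym (trans
               (*-distribˡ-∑ p (b x x′) (collision x x′))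
               (∑-cong p (λ t _ → *-distribˡ-∑ p (b x x′) (λ v → ρ v * (ζ t x v * ζ t x′ v))))))) ⟩
        ∑[ x < p ] ∑[ x′ < p ] (b x x′ * ∑[ t < p ] collision x x′ t)
          ≤⟨ ∑-mono p (λ x x<p → ∑-mono p (λ x′ x′<p → *-monoʳ-≤ (b x x′) (collisions x x′ x<p x′<p))) ⟩
        ∑[ x < p ] ∑[ x′ < p ] (b x x′ * (𝟙 (x′ ≟ x) * p + H))
          ≡⟨ ∑-cong p (λ x _ → trans
               (∑-cong p (λ x′ _ → ring (bit (X x)) (bit (X x′)) (𝟙 (x′ ≟ x)) p H))
               (∑-distrib-+ p (λ x′ → 𝟙 (x′ ≟ x) * (b x x′ * p)) (λ x′ → b x x′ * H))) ⟩
        ∑[ x < p ] (∑[ x′ < p ] (𝟙 (x′ ≟ x) * (b x x′ * p)) + ∑[ x′ < p ] (b x x′ * H))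
          ≡⟨ ∑-cong p (λ x x<p → cong₂ _+_
               (trans (∑-point p x (λ x′ → b x x′ * p) x<p) (cong (_* p) (bit-idem (X x))))
               (sym (*-distribʳ-∑ p H (b x)))) ⟩
        ∑[ x < p ] (bit (X x) * p + ∑ p (b x) * H)
          ≡⟨ ∑-distrib-+ p (λ x → bit (X x) * p) (λ x → ∑ p (b x) * H) ⟩
        ∑[ x < p ] (bit (X x) * p) + ∑[ x < p ] (∑ p (b x) * H)
          ≡⟨ cong₂ _+_ (*-distribʳ-∑ p p (λ x → bit (X x))) (*-distribʳ-∑ p H (λ x → ∑ p (b x))) ⟨
        k * p + ∑[ x < p ] ∑ p (b x) * H
          ≡⟨ cong (λ z → k * p + z * H) (∑*∑ p p (λ x → bit (X x)) (λ x → bit (X x))) ⟨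
        k * p + k * k * H ∎
        where
        open ≤-Reasoning
        b : ℕ → ℕ → ℕ
        b x x′ = bit (X x) * bit (X x′)
        w : ℕ → ℕ → ℕ → ℕ → ℕ
        w x x′ t v = b x x′ * (ρ v * (ζ t x v * ζ t x′ v))
        ring : ∀ a c e p H → a * c * (e * p + H) ≡ e * (a * c * p) + a * c * H
        ring = solve-∀

      S≡0 : ∀ t → Y t ≡ true → S t v₀ ≡ 0
      S≡0 t Yt = ∑-zero p (λ x _ → vanish x)
        where
        vanish : ∀ x → bit (X x) * ζ t x v₀ ≡ 0
        vanish x with X x in Xx
        ... | false = refl
        ... | true  = trans (*-identityˡ _) (𝟙-no ((+ (x + t)) ^ᶻ H ≈? + v₀) (avoids x t Xx Yt))

      -- Each inequality is (p S - k H)² ≥ 0 with the square expanded; the mean k / m of S is k H /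
      -- n, so p S is compared with k H. At v₀ and t ∈ Y the sum S is 0 by avoidance, and the square
      -- is the full (k H)², which is recorded as a gain.
      deviation : ∀ t v → ρ v * (2 * (p * S t v * (k * H))) + 𝟙 (v ≟ v₀) * (bit (Y t) * (k * H * (k * H)))
        ≤ ρ v * (p * S t v * (p * S t v) + k * H * (k * H))
      deviation t v with v ≟ v₀ | Y t in Yt
      ... | no  _    | _     = ≤-trans (≤-reflexive (+-identityʳ _))
                                (*-monoʳ-≤ (ρ v) (2ab≤a²+b² (p * S t v) (k * H)))
      ... | yes _    | false = ≤-trans (≤-reflexive (+-identityʳ _))
                                (*-monoʳ-≤ (ρ v) (2ab≤a²+b² (p * S t v) (k * H)))
      ... | yes refl | true  = ≤-reflexive (begin
        ρ v * (2 * (p * S t v * c)) + 1 * (1 * (c * c))  ≡⟨ cong₂ (λ r s → r * (2 * (p * s * c)) + 1 * (1 * (c * c))) ρ≡1 (S≡0 t Yt) ⟩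
        1 * (2 * (p * 0 * c)) + 1 * (1 * (c * c))        ≡⟨ ring p c ⟩
        1 * (p * 0 * (p * 0) + c * c)                    ≡⟨ cong₂ (λ r s → r * (p * s * (p * s) + c * c)) ρ≡1 (S≡0 t Yt) ⟨
        ρ v * (p * S t v * (p * S t v) + c * c)          ∎)
        where
        open ≡-Reasoning
        c = k * H
        ρ≡1 : ρ v ≡ 1
        ρ≡1 = 𝟙-yes ((+ v) ^ᶻ m ≈? 1ℤ) v₀ᵐ≈1
        ring : ∀ p c → 1 * (2 * (p * 0 * c)) + 1 * (1 * (c * c)) ≡ 1 * (p * 0 * (p * 0) + c * c)
        ring = solve-∀

      k≤p : k ≤ p
      k≤p = ≤-trans (∑-mono p (λ x _ → bit≤1 (X x))) (≤-reflexive (trans (∑-const p 1) (*-identityʳ p)))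

      -- `deviation` summed over all t and v. The constant term occurs for at most m roots of unity
      -- v at each of the p shifts.
      total-deviation : 2 * (p * (k * H)) * (k * n) + ∣Y∣ * (k * H * (k * H))
        ≤ p * p * (k * p + k * k * H) + p * (m * (k * H * (k * H)))
      total-deviation = begin
        2 * (p * c) * (k * n) + ∣Y∣ * (c * c)
          ≤⟨ +-mono-≤ (*-monoʳ-≤ (2 * (p * c)) first-moment) (≤-reflexive marked) ⟩
        2 * (p * c) * ∑[ t < p ] ∑[ v < p ] (ρ v * S t v)
          + ∑[ t < p ] ∑[ v < p ] (𝟙 (v ≟ v₀) * (bit (Y t) * (c * c)))
          ≡⟨ cong (λ z → z + ∑[ t < p ] ∑[ v < p ] (𝟙 (v ≟ v₀) * (bit (Y t) * (c * c)))) cross ⟩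
        ∑[ t < p ] ∑[ v < p ] (ρ v * (2 * (p * S t v * c)))
          + ∑[ t < p ] ∑[ v < p ] (𝟙 (v ≟ v₀) * (bit (Y t) * (c * c)))
          ≡⟨ trans (∑-cong p (λ t _ → ∑-distrib-+ p (λ v → ρ v * (2 * (p * S t v * c)))
                       (λ v → 𝟙 (v ≟ v₀) * (bit (Y t) * (c * c)))))
               (∑-distrib-+ p (λ t → ∑[ v < p ] (ρ v * (2 * (p * S t v * c))))
                 (λ t → ∑[ v < p ] (𝟙 (v ≟ v₀) * (bit (Y t) * (c * c))))) ⟨
        ∑[ t < p ] ∑[ v < p ] (ρ v * (2 * (p * S t v * c)) + 𝟙 (v ≟ v₀) * (bit (Y t) * (c * c)))
          ≤⟨ ∑-mono p (λ t _ → ∑-mono p (λ v _ → deviation t v)) ⟩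
        ∑[ t < p ] ∑[ v < p ] (ρ v * (p * S t v * (p * S t v) + c * c))
          ≡⟨ trans (∑-cong p (λ t _ → trans (∑-cong p (λ v _ → expand (ρ v) p (S t v) c))
                     (∑-distrib-+ p (λ v → p * p * (ρ v * (S t v * S t v))) (λ v → ρ v * (c * c)))))
               (∑-distrib-+ p (λ t → ∑[ v < p ] (p * p * (ρ v * (S t v * S t v)))) (λ t → ∑[ v < p ] (ρ v * (c * c)))) ⟩
        ∑[ t < p ] ∑[ v < p ] (p * p * (ρ v * (S t v * S t v))) + ∑[ t < p ] ∑[ v < p ] (ρ v * (c * c))
          ≡⟨ cong₂ _+_ squares constants ⟩
        p * p * ∑[ t < p ] ∑[ v < p ] (ρ v * (S t v * S t v)) + p * (∑ p ρ * (c * c))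
          ≤⟨ +-mono-≤ (*-monoʳ-≤ (p * p) second-moment)
               (*-monoʳ-≤ p (*-monoˡ-≤ (c * c) (roots-of-unity m))) ⟩
        p * p * (k * p + k * k * H) + p * (m * (c * c)) ∎
        where
        open ≤-Reasoning
        c : ℕ
        c = k * H
        expand : ∀ r p s c → r * (p * s * (p * s) + c * c) ≡ p * p * (r * (s * s)) + r * (c * c)
        expand = solve-∀
        ring : ∀ p c r s → 2 * (p * c) * (r * s) ≡ r * (2 * (p * s * c))
        ring = solve-∀
        marked : ∣Y∣ * (c * c) ≡ ∑[ t < p ] ∑[ v < p ] (𝟙 (v ≟ v₀) * (bit (Y t) * (c * c)))
        marked = trans (*-distribʳ-∑ p (c * c) (λ t → bit (Y t)))
          (∑-cong p (λ t _ → sym (∑-point p v₀ (λ _ → bit (Y t) * (c * c)) v₀<p)))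
        cross : 2 * (p * c) * ∑[ t < p ] ∑[ v < p ] (ρ v * S t v) ≡ ∑[ t < p ] ∑[ v < p ] (ρ v * (2 * (p * S t v * c)))
        cross = trans (*-distribˡ-∑ p (2 * (p * c)) (λ t → ∑[ v < p ] (ρ v * S t v)))
          (∑-cong p (λ t _ → trans (*-distribˡ-∑ p (2 * (p * c)) (λ v → ρ v * S t v))
            (∑-cong p (λ v _ → ring p c (ρ v) (S t v)))))
        squares : ∑[ t < p ] ∑[ v < p ] (p * p * (ρ v * (S t v * S t v))) ≡ p * p * ∑[ t < p ] ∑[ v < p ] (ρ v * (S t v * S t v))
        squares = sym (trans (*-distribˡ-∑ p (p * p) (λ t → ∑[ v < p ] (ρ v * (S t v * S t v))))
          (∑-cong p (λ t _ → *-distribˡ-∑ p (p * p) (λ v → ρ v * (S t v * S t v)))))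
        constants : ∑[ t < p ] ∑[ v < p ] (ρ v * (c * c)) ≡ p * (∑ p ρ * (c * c))
        constants = trans (∑-cong p (λ t _ → sym (*-distribʳ-∑ p (c * c) ρ))) (∑-const p (∑ p ρ * (c * c)))

      -- The main terms cancel: H m = n, and p² k² H = p n k² H + p k² H, so both sides contain 2 p
      -- n k² H. What survives on the right is the diagonal p³ k and the small excess p H k², and
      -- each is at most p³ k.
      scaled-bound : k * (k * ∣Y∣ * (H * H)) ≤ k * (2 * (p * p * p))
      scaled-bound = begin
        k * (k * ∣Y∣ * (H * H))       ≤⟨ +-cancelʳ-≤ common _ _ balanced ⟩
        p * p * p * k + p * H * k * k ≤⟨ +-monoʳ-≤ (p * p * p * k) (*-monoˡ-≤ k (*-mono-≤ (*-monoʳ-≤ p H≤p) k≤p)) ⟩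
        p * p * p * k + p * p * p * k ≡⟨ double (p * p * p) k ⟩
        k * (2 * (p * p * p))         ∎
        where
        open ≤-Reasoning
        common : ℕ
        common = 2 * (p * (k * H)) * (k * n)
        H≤p : H ≤ p
        H≤p = ≤-trans (m≤m*n H m) (≤-trans (≤-reflexive Hm≡n) (m∸n≤m p 1))
        double : ∀ q k → q * k + q * k ≡ k * (2 * q)
        double = solve-∀
        ring₁ : ∀ k Y H c → k * (k * Y * (H * H)) + c ≡ c + Y * (k * H * (k * H))
        ring₁ = solve-∀
        ring₂ : ∀ n k H m → let p = suc n in
          p * p * (k * p + k * k * H) + p * (m * (k * H * (k * H)))
          ≡ p * p * p * k + p * H * k * k + (p * n * H * k * k + p * k * k * H * (H * m))
        ring₂ = solve-∀
        ring₃ : ∀ n k H → let p = suc n in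
          p * n * H * k * k + p * k * k * H * n ≡ 2 * (p * (k * H)) * (k * n)
        ring₃ = solve-∀
        regroup : p * p * (k * p + k * k * H) + p * (m * (k * H * (k * H)))
          ≡ p * p * p * k + p * H * k * k + common
        regroup = subst (λ p → p * p * (k * p + k * k * H) + p * (m * (k * H * (k * H)))
            ≡ p * p * p * k + p * H * k * k + 2 * (p * (k * H)) * (k * n)) suc-n
          (trans (ring₂ n k H m) (cong (λ z → suc n * suc n * suc n * k + suc n * H * k * k + z)
            (trans (cong (λ z → suc n * n * H * k * k + suc n * k * k * H * z) Hm≡n) (ring₃ n k H))))
        balanced : k * (k * ∣Y∣ * (H * H)) + common ≤ p * p * p * k + p * H * k * k + common
        balanced = subst₂ _≤_ (sym (ring₁ k ∣Y∣ H common)) regroup total-deviation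

      sumset-bound : k * ∣Y∣ * (H * H) ≤ 2 * (p * p * p)
      sumset-bound with k ≟ 0
      ... | yes k≡0 = subst (_≤ 2 * (p * p * p)) (sym (cong (λ z → z * ∣Y∣ * (H * H)) k≡0)) z≤n
      ... | no  k≢0 = *-cancelˡ-≤ k {{≢-nonZero k≢0}} scaled-bound

-- Thinning two sets so that no sum is divisible by given primes.

module Separation where

  open import Data.Bool.Base using (Bool; true; false; not; _∧_)
  open import Data.List.Base using (List; []; _∷_; length)
  open import Data.List.Relation.Unary.All as All using (All; []; _∷_)
  open import Data.Nat.Base
  open import Data.Nat.Divisibility
  open import Data.Nat.DivMod
  open import Data.Nat.Properties
  open import Data.Nat.Tactic.RingSolver using (solve-∀)
  open import Data.Product.Base using (∃-syntax; _×_; _,_)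
  open import Data.Sum.Base using (_⊎_; inj₁; inj₂; [_,_]′)
  open import Relation.Binary.PropositionalEquality
  open import Relation.Nullary using (¬_; Dec; yes; no; contradiction)
  open Sums

  data State : Set where
    free left right : State

  -- Twice the conditional probability that a colour in this state ends up on the left, respectively
  -- on the right.
  α β : State → ℕ
  α free  = 1
  α left  = 2
  α right = 0
  β free  = 1
  β left  = 0
  β right = 2

  isLeft : State → Bool
  isLeft left  = true
  isLeft free  = false
  isLeft right = false

  -- Every colour is put on the left or on the right at random; a pair of distinct colours
  -- is then separated in this order with probability 1/4.  Instead of averaging, the
  -- colours are decided one at a time without decreasing the conditional
  -- expectation Φ.
  module Colouring (N : ℕ) (w : ℕ → ℕ → ℕ) (r : ℕ) (cˣ cʸ : ℕ → ℕ)
    (cˣ<r : ∀ x → cˣ x < r) (cʸ<r : ∀ y → cʸ y < r)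
    (equal⇒0 : ∀ x y → cˣ x ≡ cʸ y → w x y ≡ 0) where

    weight : (ℕ → State) → ℕ → ℕ → ℕ
    weight u x y = w x y * (α (u (cˣ x)) * β (u (cʸ y)))

    Φ : (ℕ → State) → ℕ
    Φ u = ∑[ x < N ] ∑[ y < N ] weight u x y

    update : (ℕ → State) → ℕ → State → ℕ → State
    update u c s a = pick (a ≟ c)
      where
      pick : Dec (a ≡ c) → State
      pick (yes _) = s
      pick (no  _) = u a

    -- The weight is linear in the state of a single colour unless both x and y carry that colour.
    -- There the identity would fail, as one colour cannot be on both sides, but `equal⇒0` makes
    -- such pairs weightless.
    average : ∀ u c → u c ≡ free → ∀ x y →
      weight (update u c left) x y + weight (update u c right) x y ≡ 2 * weight u x y
    average u c free-c x y with cˣ x ≟ c | cʸ y ≟ c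
    ... | yes refl | yes cʸ≡cˣ rewrite equal⇒0 x y (sym cʸ≡cˣ) = refl
    ... | yes refl | no  _ rewrite free-c = ring (w x y) (β (u (cʸ y)))
      where
      ring : ∀ w b → w * (2 * b) + w * (0 * b) ≡ 2 * (w * (1 * b))
      ring = solve-∀
    ... | no  _ | yes refl rewrite free-c = ring (w x y) (α (u (cˣ x)))
      where
      ring : ∀ w a → w * (a * 0) + w * (a * 2) ≡ 2 * (w * (a * 1))
      ring = solve-∀
    ... | no  _ | no  _ = ring (w x y * (α (u (cˣ x)) * β (u (cʸ y))))
      where
      ring : ∀ a → a + a ≡ 2 * a
      ring = solve-∀

    Φ-average : ∀ u c → u c ≡ free → Φ (update u c left) + Φ (update u c right) ≡ 2 * Φ u
    Φ-average u c free-c = begin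
      Φ (update u c left) + Φ (update u c right)
        ≡⟨ ∑-distrib-+ N _ _ ⟨
      ∑[ x < N ] (∑ N (weight (update u c left) x) + ∑ N (weight (update u c right) x))
        ≡⟨ ∑-cong N (λ x _ → trans (sym (∑-distrib-+ N _ _)) (∑-cong N (λ y _ → average u c free-c x y))) ⟩
      ∑[ x < N ] ∑[ y < N ] (2 * weight u x y)
        ≡⟨ ∑-cong N (λ x _ → *-distribˡ-∑ N 2 (weight u x)) ⟨
      ∑[ x < N ] (2 * ∑ N (weight u x))
        ≡⟨ *-distribˡ-∑ N 2 (λ x → ∑ N (weight u x)) ⟨
      2 * Φ u ∎
      where open ≡-Reasoning

    larger : ∀ {a b c} → a + b ≡ 2 * c → c ≤ a ⊎ c ≤ b
    larger {a} {b} {c} a+b≡2c with c ≤? a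
    ... | yes c≤a = inj₁ c≤a
    ... | no  c≰a = inj₂ (+-cancelˡ-≤ c c b (≤-trans (≤-reflexive (trans (ring c) (sym a+b≡2c)))
                           (+-monoˡ-≤ b (<⇒≤ (≰⇒> c≰a)))))
      where
      ring : ∀ c → c + c ≡ 2 * c
      ring = solve-∀

    decide : ∀ c → ∃[ u ] ((∀ a → a < c → u a ≢ free) × (∀ a → c ≤ a → u a ≡ free) ×
                           Φ (λ _ → free) ≤ Φ u)
    decide zero = (λ _ → free) , (λ _ ()) , (λ _ _ → refl) , ≤-refl
    decide (suc c) with decide c
    ... | u , decided , undecided , Φ≤ =
      [ choose left (λ ()) , choose right (λ ()) ]′ (larger (Φ-average u c (undecided c ≤-refl)))
      where
      choose : ∀ s → s ≢ free → Φ u ≤ Φ (update u c s) →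
        ∃[ u ] ((∀ a → a < suc c → u a ≢ free) × (∀ a → suc c ≤ a → u a ≡ free) ×
                Φ (λ _ → free) ≤ Φ u)
      choose s s≢free Φu≤ = update u c s , decided′ , undecided′ , ≤-trans Φ≤ Φu≤
        where
        decided′ : ∀ a → a < suc c → update u c s a ≢ free
        decided′ a (s≤s a≤c) with a ≟ c
        ... | yes _  = s≢free
        ... | no a≢c = decided a (≤∧≢⇒< a≤c a≢c)
        undecided′ : ∀ a → suc c ≤ a → update u c s a ≡ free
        undecided′ a c<a with a ≟ c
        ... | yes refl = contradiction c<a (<-irrefl refl)
        ... | no  _    = undecided a (<⇒≤ c<a)

    α-decided : ∀ s → s ≢ free → α s ≡ 2 * bit (isLeft s)
    α-decided free  s≢free = contradiction refl s≢free
    α-decided left  _ = refl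
    α-decided right _ = refl

    β-decided : ∀ s → s ≢ free → β s ≡ 2 * bit (not (isLeft s))
    β-decided free  s≢free = contradiction refl s≢free
    β-decided left  _ = refl
    β-decided right _ = refl

    -- With all colours free each pair has factor 1; with all decided a pair has factor 2 · 2 if it
    -- is separated and 0 otherwise. This is the origin of the 4.
    cut : ∃[ L ] (∑[ x < N ] ∑[ y < N ] w x y
      ≤ 4 * ∑[ x < N ] ∑[ y < N ] (w x y * (bit (L (cˣ x)) * bit (not (L (cʸ y))))))
    cut with decide r
    ... | u , decided , _ , Φ≤ = (λ a → isLeft (u a)) , (begin
      ∑[ x < N ] ∑[ y < N ] w x y
        ≡⟨ ∑-cong N (λ x _ → ∑-cong N (λ y _ → sym (*-identityʳ (w x y)))) ⟩
      Φ (λ _ → free)   ≤⟨ Φ≤ ⟩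
      Φ u
        ≡⟨ ∑-cong N (λ x _ → ∑-cong N (λ y _ → pointwise x y)) ⟩
      ∑[ x < N ] ∑[ y < N ] (4 * cut-weight x y)
        ≡⟨ ∑-cong N (λ x _ → *-distribˡ-∑ N 4 (cut-weight x)) ⟨
      ∑[ x < N ] (4 * ∑ N (cut-weight x))
        ≡⟨ *-distribˡ-∑ N 4 (λ x → ∑ N (cut-weight x)) ⟨
      4 * ∑[ x < N ] ∑ N (cut-weight x) ∎)
      where
      open ≤-Reasoning
      cut-weight : ℕ → ℕ → ℕ
      cut-weight x y = w x y * (bit (isLeft (u (cˣ x))) * bit (not (isLeft (u (cʸ y)))))
      ring : ∀ w a b → w * (2 * a * (2 * b)) ≡ 4 * (w * (a * b))
      ring = solve-∀
      pointwise : ∀ x y → weight u x y ≡ 4 * cut-weight x y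
      pointwise x y = trans
        (cong₂ (λ a b → w x y * (a * b)) (α-decided (u (cˣ x)) (decided (cˣ x) (cˣ<r x)))
                                          (β-decided (u (cʸ y)) (decided (cʸ y) (cʸ<r y))))
        (ring (w x y) (bit (isLeft (u (cˣ x)))) (bit (not (isLeft (u (cʸ y))))))

  module _ (k : ℕ) where

    private
      r = suc k

    residue : ℕ → ℕ
    residue x = x % r

    -- The residue of - y.
    negated : ℕ → ℕ
    negated y = (k * y) % r

    residue≡negated⇒∣ : ∀ x y → residue x ≡ negated y → r ∣ x + y
    residue≡negated⇒∣ x y x≡-y = m%n≡0⇒n∣m (x + y) r (begin
      (x + y) % r                    ≡⟨ %-distribˡ-+ x y r ⟩
      (x % r + y % r) % r            ≡⟨ cong (λ z → (z + y % r) % r) x≡-y ⟩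
      ((k * y) % r + y % r) % r      ≡⟨ %-distribˡ-+ (k * y) y r ⟨
      (k * y + y) % r                ≡⟨ cong (_% r) (+-comm (k * y) y) ⟩
      (r * y) % r                    ≡⟨ n∣m⇒m%n≡0 (r * y) r (m∣m*n y) ⟩
      0                              ∎)
      where open ≡-Reasoning

    ∣⇒residue≡negated : ∀ x y → r ∣ x + y → residue x ≡ negated y
    ∣⇒residue≡negated x y r∣x+y = begin
      x % r                  ≡⟨ %-remove-+ʳ x (m∣m*n y) ⟨
      (x + r * y) % r        ≡⟨ cong (_% r) (+-assoc x y (k * y)) ⟨
      (x + y + k * y) % r    ≡⟨ %-remove-+ˡ (k * y) r∣x+y ⟩
      (k * y) % r            ∎
      where open ≡-Reasoning

  module _ (N : ℕ) (κ : ℕ → ℕ) where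

    pairs : (X Y : ℕ → Bool) → ℕ
    pairs X Y = ∑[ x < N ] ∑[ y < N ] (bit (X x) * bit (Y y) * κ (x + y))

    -- `κ` will indicate coprimality to n, which vanishes on the multiples of every prime r dividing
    -- n. Pairs that violate the separation therefore count for nothing from the start.
    Killed : ℕ → Set
    Killed r = NonZero r × (∀ s → r ∣ s → κ s ≡ 0)

    _⊑_ : (X′ X : ℕ → Bool) → Set
    X′ ⊑ X = ∀ x → X′ x ≡ true → X x ≡ true

    Separated : (X Y : ℕ → Bool) → ℕ → Set
    Separated X Y r = ∀ x y → X x ≡ true → Y y ≡ true → ¬ r ∣ x + y

    private
      ∧-left : ∀ a b → a ∧ b ≡ true → a ≡ true
      ∧-left true b _ = refl
      ∧-right : ∀ a b → a ∧ b ≡ true → b ≡ true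
      ∧-right true b ab = ab
      bit-∧ : ∀ a b → bit (a ∧ b) ≡ bit a * bit b
      bit-∧ true  b = sym (*-identityˡ (bit b))
      bit-∧ false b = refl
      not-both : ∀ b → b ≡ true → not b ≡ true → ∀ {ℓ} {A : Set ℓ} → A
      not-both true _ ()

    -- Colour x by its residue and y by the residue of -y: the colours agree exactly when r divides
    -- x + y. Keeping the x on the left and the y on the right forbids equal colours for all
    -- remaining pairs at once.
    separate₁ : ∀ {r} → Killed r → ∀ X Y → ∃[ X′ ] ∃[ Y′ ]
      (X′ ⊑ X × Y′ ⊑ Y × Separated X′ Y′ r × pairs X Y ≤ 4 * pairs X′ Y′)
    separate₁ {suc k} (_ , killed) X Y = split (Colouring.cut N w (suc k) (residue k) (negated k)
      (λ x → m%n<n x (suc k)) (λ y → m%n<n (k * y) (suc k))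
      (λ x y same → trans (cong (bit (X x) * bit (Y y) *_) (killed (x + y) (residue≡negated⇒∣ k x y same)))
                          (*-zeroʳ (bit (X x) * bit (Y y)))))
      where
      w : ℕ → ℕ → ℕ
      w x y = bit (X x) * bit (Y y) * κ (x + y)
      ring : ∀ a b c d e → a * b * c * (d * e) ≡ a * d * (b * e) * c
      ring = solve-∀
      split : ∃[ S ] (∑[ x < N ] ∑[ y < N ] w x y
          ≤ 4 * ∑[ x < N ] ∑[ y < N ] (w x y * (bit (S (residue k x)) * bit (not (S (negated k y)))))) →
        ∃[ X′ ] ∃[ Y′ ] (X′ ⊑ X × Y′ ⊑ Y × Separated X′ Y′ (suc k) × pairs X Y ≤ 4 * pairs X′ Y′)
      split (S , bound) = X′ , Y′ , (λ x → ∧-left (X x) _) , (λ y → ∧-left (Y y) _) , separated ,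
        ≤-trans bound (≤-reflexive (cong (4 *_) (∑-cong N (λ x _ → ∑-cong N (λ y _ → trans
          (ring (bit (X x)) (bit (Y y)) (κ (x + y)) (bit (S (residue k x))) (bit (not (S (negated k y)))))
          (cong₂ (λ a b → a * b * κ (x + y)) (sym (bit-∧ (X x) (S (residue k x))))
                                               (sym (bit-∧ (Y y) (not (S (negated k y)))))))))))
        where
        X′ Y′ : ℕ → Bool
        X′ x = X x ∧ S (residue k x)
        Y′ y = Y y ∧ not (S (negated k y))
        separated : Separated X′ Y′ (suc k)
        separated x y x∈ y∈ r∣x+y = not-both (S (negated k y))
          (subst (λ c → S c ≡ true) (∣⇒residue≡negated k x y r∣x+y) (∧-right (X x) _ x∈))
          (∧-right (Y y) _ y∈)

    -- Separation is inherited by subsets, so the primes can be treated in turn and their factors 4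
    -- multiply.
    separate : ∀ rs → All Killed rs → ∀ X Y → ∃[ X′ ] ∃[ Y′ ]
      (X′ ⊑ X × Y′ ⊑ Y × All (Separated X′ Y′) rs × pairs X Y ≤ 4 ^ length rs * pairs X′ Y′)
    separate []       []               X Y =
      X , Y , (λ _ p → p) , (λ _ p → p) , [] , ≤-reflexive (sym (*-identityˡ (pairs X Y)))
    separate (r ∷ rs) (killed ∷ killeds) X Y with separate rs killeds X Y
    ... | X₁ , Y₁ , X₁⊑X , Y₁⊑Y , sep , bound with separate₁ killed X₁ Y₁
    ... | X₂ , Y₂ , X₂⊑X₁ , Y₂⊑Y₁ , sep₂ , bound₂ =
      X₂ , Y₂ , (λ x p → X₁⊑X x (X₂⊑X₁ x p)) , (λ y p → Y₁⊑Y y (Y₂⊑Y₁ y p)) ,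
      sep₂ ∷ All.map (λ s x y x∈ y∈ → s x y (X₂⊑X₁ x x∈) (Y₂⊑Y₁ y y∈)) sep ,
      ≤-trans bound (≤-trans (*-monoʳ-≤ (4 ^ length rs) bound₂)
        (≤-reflexive (ring (4 ^ length rs) (pairs X₂ Y₂))))
      where
      ring : ∀ a b → a * (4 * b) ≡ 4 * a * b
      ring = solve-∀

    pairs≤ : (∀ s → κ s ≤ 1) → ∀ X Y → pairs X Y ≤ (∑[ x < N ] bit (X x)) * (∑[ y < N ] bit (Y y))
    pairs≤ κ≤1 X Y = ≤-trans
      (∑-mono N (λ x _ → ∑-mono N (λ y _ → ≤-trans
        (*-monoʳ-≤ (bit (X x) * bit (Y y)) (κ≤1 (x + y))) (≤-reflexive (*-identityʳ (bit (X x) * bit (Y y)))))))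
      (≤-reflexive (sym (∑*∑ N N (λ x → bit (X x)) (λ y → bit (Y y)))))

-- The product formula for φ and estimates for products over primes.

module Sieve where

  open import Defs using (φ)
  open import Data.List.Base using (List; []; _∷_; length; map; filter; applyUpTo)
  open import Data.List.Properties using (map-upTo)
  open import Data.List.Membership.Propositional using (_∈_)
  open import Data.List.Relation.Unary.All as All using (All; []; _∷_; all?)
  open import Data.List.Relation.Unary.AllPairs using (AllPairs; []; _∷_)
  open import Data.List.Relation.Unary.Any using (here; there)
  open import Data.Nat.Base
  open import Data.Nat.Coprimality using (Coprime; coprime?)
  open import Data.Nat.Divisibility
  open import Data.Nat.ListAction using (product)
  open import Data.Nat.Primality
  open import Data.Nat.Primality.Factorisation using (factorise; factorisationHasAllPrimeFactors)
  open import Data.Nat.Properties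
  open import Data.Nat.Tactic.RingSolver using (solve-∀)
  open import Data.Product.Base using (∃-syntax; _×_; _,_; proj₁; proj₂)
  open import Data.Sum.Base using ([_,_]′)
  open import Relation.Binary.PropositionalEquality
  open import Relation.Nullary using (¬_; Dec; yes; no; contradiction; ¬?)
  open import Relation.Nullary.Decidable using (_×-dec_)
  open Sums

  ∑-multiples : ∀ N r (f : ℕ → ℕ) → .{{NonZero r}} →
    ∑[ x < N * r ] (𝟙 (r ∣? x) * f x) ≡ ∑[ y < N ] f (y * r)
  ∑-multiples zero    r f = refl
  ∑-multiples (suc N) r f = begin
    ∑[ x < r + N * r ] g x                                ≡⟨ cong (λ K → ∑ K g) (+-comm r (N * r)) ⟩
    ∑[ x < N * r + r ] g x                                ≡⟨ ∑-split (N * r) r g ⟩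
    ∑ (N * r) g + ∑[ x < r ] g (N * r + x)                ≡⟨ cong₂ _+_ (∑-multiples N r f) (∑-cong r block) ⟩
    ∑[ y < N ] f (y * r) + ∑[ x < r ] (𝟙 (x ≟ 0) * f (N * r + x))
      ≡⟨ cong (∑[ y < N ] f (y * r) +_) (∑-point r 0 (λ x → f (N * r + x)) (>-nonZero⁻¹ r)) ⟩
    ∑[ y < N ] f (y * r) + f (N * r + 0)                  ≡⟨ cong (λ z → ∑[ y < N ] f (y * r) + f z) (+-identityʳ (N * r)) ⟩
    ∑[ y < N ] f (y * r) + f (N * r)                      ∎
    where
    open ≡-Reasoning
    g : ℕ → ℕ
    g x = 𝟙 (r ∣? x) * f x
    block : ∀ x → x < r → g (N * r + x) ≡ 𝟙 (x ≟ 0) * f (N * r + x)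
    block x x<r = cong (_* f (N * r + x)) (𝟙-cong (r ∣? N * r + x) (x ≟ 0)
      (λ r∣ → zero-residue x x<r (∣m+n∣m⇒∣n r∣ (n∣m*n N)))
      (λ { refl → ∣m∣n⇒∣m+n (n∣m*n N) (divides 0 refl) }))
      where
      zero-residue : ∀ x → x < r → r ∣ x → x ≡ 0
      zero-residue zero    _   _   = refl
      zero-residue (suc x) x<r r∣x = contradiction (∣⇒≤ r∣x) (<⇒≱ x<r)

  Free : List ℕ → ℕ → Set
  Free rs x = All (λ r → ¬ r ∣ x) rs

  free? : ∀ rs x → Dec (Free rs x)
  free? rs x = all? (λ r → ¬? (r ∣? x)) rs

  prime∣prime⇒≡ : ∀ {r s} → Prime r → Prime s → r ∣ s → r ≡ s
  prime∣prime⇒≡ {r} {s} r-prime s-prime r∣s =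
    [ (λ r≡1 → contradiction (subst Prime r≡1 r-prime) ¬prime[1]) , (λ r≡s → r≡s) ]′
      (prime⇒irreducible s-prime r∣s)

  -- Among the numbers free of `rs`, the multiples y r of r are dropped; since r differs from the
  -- primes in `rs`, y r is free of them exactly when y is. The arbitrary multiplier `M` carries the
  -- induction, which is applied once to `M * r` and once to `M`.
  sieve : ∀ rs → All Prime rs → AllPairs _≢_ rs → ∀ M →
    ∑[ x < M * product rs ] 𝟙 (free? rs x) ≡ M * product (map pred rs)
  sieve []       []                   []              M = trans (∑-const (M * 1) 1) (*-identityʳ (M * 1))
  sieve (r ∷ rs) (r-prime ∷ rs-prime) (r∉ ∷ distinct) M = +-cancelʳ-≡ (M * D) _ _ (begin
    ∑[ x < M * (r * R) ] 𝟙 (free? (r ∷ rs) x) + M * D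
      ≡⟨ cong (∑[ x < M * (r * R) ] 𝟙 (free? (r ∷ rs) x) +_) (sym multiples) ⟩
    ∑[ x < M * (r * R) ] 𝟙 (free? (r ∷ rs) x) + ∑[ x < M * (r * R) ] (𝟙 (r ∣? x) * 𝟙 (free? rs x))
      ≡⟨ ∑-distrib-+ (M * (r * R)) (λ x → 𝟙 (free? (r ∷ rs) x)) (λ x → 𝟙 (r ∣? x) * 𝟙 (free? rs x)) ⟨
    ∑[ x < M * (r * R) ] (𝟙 (free? (r ∷ rs) x) + 𝟙 (r ∣? x) * 𝟙 (free? rs x))
      ≡⟨ ∑-cong (M * (r * R)) (λ x _ → partition x) ⟩
    ∑[ x < M * (r * R) ] 𝟙 (free? rs x)
      ≡⟨ cong (λ N → ∑[ x < N ] 𝟙 (free? rs x)) (*-assoc M r R) ⟨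
    ∑[ x < M * r * R ] 𝟙 (free? rs x)
      ≡⟨ sieve rs rs-prime distinct (M * r) ⟩
    M * r * D
      ≡⟨ trans (cong (λ s → M * s * D) (sym (suc-pred r))) (ring M (pred r) D) ⟩
    M * (pred r * D) + M * D ∎)
    where
    open ≡-Reasoning
    instance
      r≢0 : NonZero r
      r≢0 = prime⇒nonZero r-prime
    R D : ℕ
    R = product rs
    D = product (map pred rs)
    ring : ∀ M s D → M * suc s * D ≡ M * (s * D) + M * D
    ring = solve-∀
    ring′ : ∀ M r R → M * (r * R) ≡ M * R * r
    ring′ = solve-∀
    partition : ∀ x → 𝟙 (free? (r ∷ rs) x) + 𝟙 (r ∣? x) * 𝟙 (free? rs x) ≡ 𝟙 (free? rs x)
    partition x = cases (r ∣? x)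
      where
      cases : Dec (r ∣ x) → 𝟙 (free? (r ∷ rs) x) + 𝟙 (r ∣? x) * 𝟙 (free? rs x) ≡ 𝟙 (free? rs x)
      cases (yes r∣x) = trans (cong₂ (λ a b → a + b * 𝟙 (free? rs x))
        (𝟙-no (free? (r ∷ rs) x) (λ { (r∤x ∷ _) → r∤x r∣x })) (𝟙-yes (r ∣? x) r∣x))
        (*-identityˡ _)
      cases (no r∤x) = trans (cong₂ (λ a b → a + b * 𝟙 (free? rs x))
        (𝟙-cong (free? (r ∷ rs) x) (free? rs x) (λ { (_ ∷ free) → free }) (r∤x ∷_)) (𝟙-no (r ∣? x) r∤x))
        (+-identityʳ _)
    scale : ∀ {s} → Prime s → r ≢ s → ∀ y → ¬ s ∣ y → ¬ s ∣ y * r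
    scale s-prime r≢s y s∤y s∣yr = [ s∤y , (λ s∣r → r≢s (sym (prime∣prime⇒≡ s-prime r-prime s∣r))) ]′
      (euclidsLemma y r s-prime s∣yr)
    scales : ∀ {ss} → All Prime ss → All (r ≢_) ss → ∀ y → Free ss y → Free ss (y * r)
    scales []       []       y []       = []
    scales (s ∷ ss) (e ∷ es) y (f ∷ fs) = scale s e y f ∷ scales ss es y fs
    multiples : ∑[ x < M * (r * R) ] (𝟙 (r ∣? x) * 𝟙 (free? rs x)) ≡ M * D
    multiples = begin
      ∑[ x < M * (r * R) ] (𝟙 (r ∣? x) * 𝟙 (free? rs x))
        ≡⟨ cong (λ N → ∑[ x < N ] (𝟙 (r ∣? x) * 𝟙 (free? rs x))) (ring′ M r R) ⟩
      ∑[ x < M * R * r ] (𝟙 (r ∣? x) * 𝟙 (free? rs x))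
        ≡⟨ ∑-multiples (M * R) r (λ x → 𝟙 (free? rs x)) ⟩
      ∑[ y < M * R ] 𝟙 (free? rs (y * r))
        ≡⟨ ∑-cong (M * R) (λ y _ → 𝟙-cong (free? rs (y * r)) (free? rs y)
             (All.map (λ ∤yr s∣y → ∤yr (∣m⇒∣m*n r s∣y))) (scales rs-prime r∉ y)) ⟩
      ∑[ y < M * R ] 𝟙 (free? rs y)
        ≡⟨ sieve rs rs-prime distinct M ⟩
      M * D ∎

  product-∣ : ∀ rs {n} → All Prime rs → AllPairs _≢_ rs → All (_∣ n) rs → product rs ∣ n
  product-∣ []       {n} []             []            []        = 1∣ n
  product-∣ (r ∷ rs) {n} (r-prime ∷ rs-prime) (r∉ ∷ distinct) (r∣n ∷ rs∣n)
    with product-∣ rs rs-prime distinct rs∣n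
  ... | divides c n≡cR = [ (λ { (divides c′ c≡c′r) → divides c′ (trans n≡cR
                              (trans (cong (_* product rs) c≡c′r) (*-assoc c′ r (product rs)))) })
                         , (λ r∣R → contradiction refl (All.lookup r∉ (factorisationHasAllPrimeFactors r-prime r∣R rs-prime))) ]′
    (euclidsLemma c (product rs) r-prime (subst (r ∣_) n≡cR r∣n))

  prime-divisor : ∀ d → .{{NonZero d}} → d ≢ 1 → ∃[ r ] (Prime r × r ∣ d)
  prime-divisor d d≢1 with factorise d
  ... | record { factors = [] ; isFactorisation = d≡1 } = contradiction d≡1 d≢1
  ... | record { factors = r ∷ rs ; isFactorisation = d≡ ; factorsPrime = r-prime ∷ _ } =
    r , r-prime , subst (r ∣_) (sym d≡) (m∣m*n (product rs))

  length-filter-applyUpTo : ∀ {P : ℕ → Set} (P? : ∀ x → Dec (P x)) (f : ℕ → ℕ) n →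
    length (filter P? (applyUpTo f n)) ≡ ∑[ k < n ] 𝟙 (P? (f k))
  length-filter-applyUpTo P? f zero    = refl
  length-filter-applyUpTo P? f (suc n) = trans (head (P? (f 0)) refl) (sym (∑-head n (λ k → 𝟙 (P? (f k)))))
    where
    head : ∀ d → P? (f 0) ≡ d → length (filter P? (applyUpTo f (suc n)))
      ≡ 𝟙 (P? (f 0)) + ∑[ k < n ] 𝟙 (P? (f (suc k)))
    head d eq with P? (f 0)
    ... | yes _ = cong suc (length-filter-applyUpTo P? (λ k → f (suc k)) n)
    ... | no  _ = length-filter-applyUpTo P? (λ k → f (suc k)) n

  φ≡∑ : ∀ n → φ n ≡ ∑[ k < n ] 𝟙 (coprime? (suc k) n)
  φ≡∑ n = trans (cong (λ ks → length (filter (λ k → coprime? k n) ks)) (map-upTo suc n))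
                (length-filter-applyUpTo (λ k → coprime? k n) suc n)

  -- Moves the range 1, ..., n in the definition of `φ` to the range 0, ..., n - 1 of the sieve.
  ∑-rotate : ∀ n {f : ℕ → ℕ} → f 0 ≡ f n → ∑[ k < n ] f (suc k) ≡ ∑ n f
  ∑-rotate n {f} f0≡fn = +-cancelˡ-≡ (f 0) _ _ (trans (sym (∑-head n f))
    (trans (+-comm (∑ n f) (f n)) (cong (_+ ∑ n f) (sym f0≡fn))))

  OddPrimeDivisor : ℕ → ℕ → Set
  OddPrimeDivisor n r = Prime r × r ≢ 2 × r ∣ n

  -- The descending order gives both the distinctness that the sieve asks for and the growth of the
  -- members in `length<head`.
  oddPrimeDivisors : ∀ n b → ∃[ qs ] (All (OddPrimeDivisor n) qs × AllPairs _>_ qs × All (_≤ b) qs ×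
    (∀ {r} → r ≤ b → OddPrimeDivisor n r → r ∈ qs))
  oddPrimeDivisors n zero = [] , [] , [] , [] , λ { z≤n (0-prime , _) → contradiction 0-prime ¬prime[0] }
  oddPrimeDivisors n (suc b) with oddPrimeDivisors n b | prime? (suc b) ×-dec ¬? (suc b ≟ 2) ×-dec suc b ∣? n
  ... | qs , divs , desc , bounded , complete | yes d =
    suc b ∷ qs , d ∷ divs , All.map s≤s bounded ∷ desc , ≤-refl ∷ All.map m≤n⇒m≤1+n bounded ,
    λ r≤b′ r-div → [ (λ { (s≤s r≤b) → there (complete r≤b r-div) }) , (λ { refl → here refl }) ]′ (m≤n⇒m<n∨m≡n r≤b′)
  ... | qs , divs , desc , bounded , complete | no ¬d =
    qs , divs , desc , All.map m≤n⇒m≤1+n bounded ,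
    λ r≤b′ r-div → [ (λ { (s≤s r≤b) → complete r≤b r-div }) , (λ { refl → contradiction r-div ¬d }) ]′ (m≤n⇒m<n∨m≡n r≤b′)

  >⇒≢-pairs : ∀ {rs} → AllPairs _>_ rs → AllPairs _≢_ rs
  >⇒≢-pairs []             = []
  >⇒≢-pairs (r> ∷ pairs) = All.map >⇒≢ r> ∷ >⇒≢-pairs pairs

  length<head : ∀ r rs → AllPairs _>_ (r ∷ rs) → All (2 ≤_) (r ∷ rs) → 2 + length rs ≤ r
  length<head r []       _                      (2≤r ∷ _) = 2≤r
  length<head r (s ∷ rs) ((r>s ∷ _) ∷ desc) (_ ∷ 2≤)  =
    ≤-trans (s≤s (length<head s rs desc 2≤)) r>s

  minimum : ∀ r rs → AllPairs _>_ (r ∷ rs) → ∃[ q ] (q ∈ (r ∷ rs) × All (q ≤_) (r ∷ rs))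
  minimum r []       _ = r , here refl , ≤-refl ∷ []
  minimum r (s ∷ rs) ((r>s ∷ _) ∷ desc) with minimum s rs desc
  ... | q , q∈ , q≤s ∷ q≤ = q , there q∈ , ≤-trans q≤s (<⇒≤ r>s) ∷ q≤s ∷ q≤

  module _ (n : ℕ) (n≥2 : 2 ≤ n) (2∣n : 2 ∣ n) where

    private
      instance
        n≢0 : NonZero n
        n≢0 = >-nonZero (≤-trans (s≤s z≤n) n≥2)

    oddPrimes : List ℕ
    oddPrimes = proj₁ (oddPrimeDivisors n n)

    oddPrimes-divisors : All (OddPrimeDivisor n) oddPrimes
    oddPrimes-divisors = proj₁ (proj₂ (oddPrimeDivisors n n))

    oddPrimes-descending : AllPairs _>_ oddPrimes
    oddPrimes-descending = proj₁ (proj₂ (proj₂ (oddPrimeDivisors n n)))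

    oddPrimes-complete : ∀ {r} → r ≤ n → OddPrimeDivisor n r → r ∈ oddPrimes
    oddPrimes-complete = proj₂ (proj₂ (proj₂ (proj₂ (oddPrimeDivisors n n))))

    primes : List ℕ
    primes = 2 ∷ oddPrimes

    primes-prime : All Prime primes
    primes-prime = prime[2] ∷ All.map proj₁ oddPrimes-divisors

    primes-distinct : AllPairs _≢_ primes
    primes-distinct = All.map (λ { (_ , r≢2 , _) 2≡r → r≢2 (sym 2≡r) }) oddPrimes-divisors
                    ∷ >⇒≢-pairs oddPrimes-descending

    primes-divide : All (_∣ n) primes
    primes-divide = 2∣n ∷ All.map (λ { (_ , _ , r∣n) → r∣n }) oddPrimes-divisors

    cofactor : ℕ
    cofactor = quotient (product-∣ primes primes-prime primes-distinct primes-divide)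

    n≡cofactor*product : n ≡ cofactor * product primes
    n≡cofactor*product = _∣_.equality (product-∣ primes primes-prime primes-distinct primes-divide)

    free⇒coprime : ∀ {x} → Free primes x → Coprime x n
    free⇒coprime {x} (odd ∷ free) {d} (d∣x , d∣n) with d ≟ 1
    ... | yes d≡1 = d≡1
    ... | no  d≢1 = contradiction (prime-divisor d {{d≢0}} d≢1) common-prime
      where
      d≢0 : NonZero d
      d≢0 = >-nonZero (n≢0⇒n>0 (λ { refl → ≢-nonZero⁻¹ n (0∣⇒≡0 d∣n) }))
      common-prime : ¬ (∃[ r ] (Prime r × r ∣ d))
      common-prime (r , r-prime , r∣d) with r ≟ 2
      ... | yes refl = contradiction (∣-trans r∣d d∣x) odd
      ... | no  r≢2  = contradiction (∣-trans r∣d d∣x)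
        (All.lookup free (oddPrimes-complete (∣⇒≤ (∣-trans r∣d d∣n)) (r-prime , r≢2 , ∣-trans r∣d d∣n)))

    coprime⇒free : ∀ {x} → Coprime x n → Free primes x
    coprime⇒free {x} coprime = go primes-prime primes-divide
      where
      go : ∀ {rs} → All Prime rs → All (_∣ n) rs → Free rs x
      go []                   []             = []
      go (r-prime ∷ rs-prime) (r∣n ∷ rs∣n) =
        (λ r∣x → ¬prime[1] (subst Prime (coprime (r∣x , r∣n)) r-prime)) ∷ go rs-prime rs∣n

    φ≡∑free : φ n ≡ ∑[ x < n ] 𝟙 (free? primes x)
    φ≡∑free = begin
      φ n                                     ≡⟨ φ≡∑ n ⟩
      ∑[ k < n ] 𝟙 (coprime? (suc k) n)       ≡⟨ ∑-cong n (λ k _ →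
                                                   𝟙-cong (coprime? (suc k) n) (free? primes (suc k)) coprime⇒free free⇒coprime) ⟩
      ∑[ k < n ] 𝟙 (free? primes (suc k))     ≡⟨ ∑-rotate n (trans
                                                   (𝟙-no (free? primes 0) (λ { (∤0 ∷ _) → ∤0 (divides 0 refl) }))
                                                   (sym (𝟙-no (free? primes n) (λ { (∤n ∷ _) → ∤n 2∣n })))) ⟩
      ∑[ x < n ] 𝟙 (free? primes x)           ∎
      where open ≡-Reasoning

    φ≡cofactor*product : φ n ≡ cofactor * product (map pred oddPrimes)
    φ≡cofactor*product = begin
      φ n                                                           ≡⟨ φ≡∑free ⟩
      ∑[ x < n ] 𝟙 (free? primes x)                                 ≡⟨ cong (λ N → ∑[ x < N ] 𝟙 (free? primes x)) n≡cofactor*product ⟩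
      ∑[ x < cofactor * product primes ] 𝟙 (free? primes x)         ≡⟨ sieve primes primes-prime primes-distinct cofactor ⟩
      cofactor * (1 * product (map pred oddPrimes))                 ≡⟨ cong (cofactor *_) (*-identityˡ _) ⟩
      cofactor * product (map pred oddPrimes)                       ∎
      where open ≡-Reasoning

  -- The union bound ∏ (1 - 1/r) ≥ 1 - ∑ 1/r ≥ 1 - l/q, cleared of denominators. It forces the least
  -- prime factor to be small when φ(n)/n is small.
  product-pred-bound : ∀ q rs → All (q ≤_) rs → All NonZero rs →
    q * product rs ≤ q * product (map pred rs) + length rs * product rs
  product-pred-bound q []           []           []          = m≤m+n (q * 1) 0
  product-pred-bound q (suc s ∷ rs) (q≤r ∷ q≤) (_ ∷ rs≢0) = begin
    q * (P + s * P)                          ≡⟨ ring₁ q s P ⟩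
    s * (q * P) + q * P                      ≤⟨ +-mono-≤ (*-monoʳ-≤ s (product-pred-bound q rs q≤ rs≢0)) (*-monoˡ-≤ P q≤r) ⟩
    s * (q * D + l * P) + suc s * P          ≤⟨ m≤m+n _ (l * P) ⟩
    s * (q * D + l * P) + suc s * P + l * P  ≡⟨ ring₂ q s l P D ⟩
    q * (s * D) + suc l * (suc s * P)        ∎
    where
    open ≤-Reasoning
    P D l : ℕ
    P = product rs
    D = product (map pred rs)
    l = length rs
    ring₁ : ∀ q s P → q * (P + s * P) ≡ s * (q * P) + q * P
    ring₁ = solve-∀
    ring₂ : ∀ q s l P D → s * (q * D + l * P) + suc s * P + l * P ≡ q * (s * D) + suc l * (suc s * P)
    ring₂ = solve-∀

  -- The i-th smallest member r of rs satisfies r - 1 ≥ i, hence (r - 1)⁴ / r³ ≥ i⁴ / (i + 1)³.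
  factorial-bound : ∀ rs → AllPairs _>_ rs → All (2 ≤_) rs →
    let P = product rs ; D = product (map pred rs) ; l = length rs in
    l ! * (P * P * P) ≤ suc l * suc l * suc l * (D * D * (D * D))
  factorial-bound []           _    _  = ≤-refl
  factorial-bound (suc s ∷ rs) pairs@(_ ∷ desc) 2≤@(_ ∷ 2≤rs) = begin
    l * k ! * (r * P * (r * P) * (r * P))              ≡⟨ ring₁ l (k !) r P ⟩
    l * (r * r * r) * (k ! * (P * P * P))              ≤⟨ *-monoʳ-≤ (l * (r * r * r)) (factorial-bound rs desc 2≤rs) ⟩
    l * (r * r * r) * (l * l * l * (D * D * (D * D)))  ≡⟨ ring₂ l r (D * D * (D * D)) ⟩
    l * (l * r * (l * r) * (l * r)) * (D * D * (D * D))
      ≤⟨ *-monoˡ-≤ (D * D * (D * D)) (*-mono-≤ l≤s (*-mono-≤ (*-mono-≤ lr≤ lr≤) lr≤)) ⟩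
    s * (suc l * s * (suc l * s) * (suc l * s)) * (D * D * (D * D))
      ≡⟨ ring₃ (suc l) s D ⟩
    suc l * suc l * suc l * (s * D * (s * D) * (s * D * (s * D))) ∎
    where
    open ≤-Reasoning
    r P D k l : ℕ
    r = suc s
    P = product rs
    D = product (map pred rs)
    k = length rs
    l = suc k
    l≤s : l ≤ s
    l≤s = s≤s⁻¹ (length<head (suc s) rs pairs 2≤)
    lr≤ : l * r ≤ suc l * s
    lr≤ = ≤-trans (≤-reflexive (*-suc l s)) (+-monoˡ-≤ (l * s) l≤s)
    ring₁ : ∀ l f r P → l * f * (r * P * (r * P) * (r * P)) ≡ l * (r * r * r) * (f * (P * P * P))
    ring₁ = solve-∀
    ring₂ : ∀ l r E → l * (r * r * r) * (l * l * l * E) ≡ l * (l * r * (l * r) * (l * r)) * E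
    ring₂ = solve-∀
    ring₃ : ∀ m s D → s * (m * s * (m * s) * (m * s)) * (D * D * (D * D))
      ≡ m * m * m * (s * D * (s * D) * (s * D * (s * D)))
    ring₃ = solve-∀

-- The numerical contradiction: factorials against powers of 16.

module Growth where

  open import Defs using (φ; QNRNP; _≡_[mod_])
  open import Data.Nat.Base
  open import Data.Nat.Properties
  open import Data.Nat.Tactic.RingSolver using (solve-∀)
  open import Data.Unit.Base using (tt)
  open import Relation.Binary.PropositionalEquality
  open import Relation.Nullary using (¬_; yes; no)
  open import Relation.Nullary.Decidable using (toWitness)

  -- Opaque, because otherwise products with these numerals unfold to iterated sums.
  opaque
    a b : ℕ
    a = 34848
    b = 2 ^ 82

    a-def : a ≡ 288 * (11 * 11)
    a-def = refl

    b-def : b ≡ 2 ^ 82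
    b-def = refl

    -- Here the size of `b` matters: the tightest case is l = 21, where the right side is about
    -- twice the left.
    small-cases : ∀ {l} → l < 25 → 2 * (a * a) * (16 ^ l * suc l ^ 7) < b * l !
    small-cases = toWitness {a? = allUpTo? (λ l → 2 * (a * a) * (16 ^ l * suc l ^ 7) <? b * l !) 25} tt

  -- For n ≥ x the ratio (n + 1)/n is at most y/x, so one numerical comparison at x bounds m ((n +
  -- 1)/n)^k by n for all larger n.
  power-ratio : ∀ {m x y} k n → .{{NonZero x}} → x * suc n ≤ y * n → m * y ^ k ≤ x ^ k * x → x ≤ n →
    m * suc n ^ k ≤ n * n ^ k
  power-ratio {m} {x} {y} k n x[1+n]≤yn myᵏ≤xᵏx x≤n = *-cancelˡ-≤ (x ^ k) {{m^n≢0 x k}} (begin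
    x ^ k * (m * suc n ^ k)     ≡⟨ x∙yz≈y∙xz (x ^ k) m (suc n ^ k) ⟩
    m * (x ^ k * suc n ^ k)     ≡⟨ cong (m *_) (^-distribʳ-* k x (suc n)) ⟨
    m * (x * suc n) ^ k         ≤⟨ *-monoʳ-≤ m (^-monoˡ-≤ k x[1+n]≤yn) ⟩
    m * (y * n) ^ k             ≡⟨ cong (m *_) (^-distribʳ-* k y n) ⟩
    m * (y ^ k * n ^ k)         ≡⟨ *-assoc m (y ^ k) (n ^ k) ⟨
    m * y ^ k * n ^ k           ≤⟨ *-monoˡ-≤ (n ^ k) myᵏ≤xᵏx ⟩
    x ^ k * x * n ^ k           ≤⟨ *-monoˡ-≤ (n ^ k) (*-monoʳ-≤ (x ^ k) x≤n) ⟩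
    x ^ k * n * n ^ k           ≡⟨ *-assoc (x ^ k) n (n ^ k) ⟩
    x ^ k * (n * n ^ k)         ∎)
    where
    open ≤-Reasoning
    x∙yz≈y∙xz : ∀ x y z → x * (y * z) ≡ y * (x * z)
    x∙yz≈y∙xz x y z = trans (sym (*-assoc x y z)) (trans (cong (_* z) (*-comm x y)) (*-assoc y x z))
    ^-distribʳ-* : ∀ k x y → (x * y) ^ k ≡ x ^ k * y ^ k
    ^-distribʳ-* zero    x y = refl
    ^-distribʳ-* (suc k) x y = trans (cong (x * y *_) (^-distribʳ-* k x y)) (ring x y (x ^ k) (y ^ k))
      where
      ring : ∀ x y u v → x * y * (u * v) ≡ x * u * (y * v)
      ring = solve-∀

  -- From l to l + 1 the left side is multiplied by 16 ((l + 2)/(l + 1))^7 and the right side by l +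
  -- 1. Once l + 1 ≥ 25, the second factor is at least the first.
  growth : ∀ l → 2 * (a * a) * (16 ^ l * suc l ^ 7) < b * l !
  growth zero = small-cases (s≤s z≤n)
  growth (suc l) with suc l <? 25
  ... | yes l<25 = small-cases l<25
  ... | no  l≮25 = begin-strict
    c * (16 * 16 ^ l * suc (suc l) ^ 7)       ≡⟨ ring₁ c (16 ^ l) 16 (suc (suc l) ^ 7) ⟩
    c * 16 ^ l * (16 * suc (suc l) ^ 7)       ≤⟨ *-monoʳ-≤ (c * 16 ^ l) (power-ratio {16} {25} {26} 7 (suc l) 25[2+l]≤26[1+l]
                                                   (toWitness {a? = 16 * 26 ^ 7 ≤? 25 ^ 7 * 25} tt) (≮⇒≥ l≮25)) ⟩
    c * 16 ^ l * (suc l * suc l ^ 7)          ≡⟨ ring₂ c (16 ^ l) (suc l) (suc l ^ 7) ⟩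
    suc l * (c * (16 ^ l * suc l ^ 7))        <⟨ *-monoʳ-< (suc l) (growth l) ⟩
    suc l * (b * l !)                         ≡⟨ ring₃ (suc l) b (l !) ⟩
    b * (suc l * l !)                         ∎
    where
    open ≤-Reasoning
    c = 2 * (a * a)
    25[2+l]≤26[1+l] : 25 * suc (suc l) ≤ 26 * suc l
    25[2+l]≤26[1+l] = ≤-trans (≤-reflexive (*-suc 25 (suc l))) (+-monoˡ-≤ (25 * suc l) (≮⇒≥ l≮25))
    ring₁ : ∀ c x y z → c * (y * x * z) ≡ c * x * (y * z)
    ring₁ = solve-∀
    ring₂ : ∀ c x y z → c * x * (y * z) ≡ y * (c * (x * z))
    ring₂ = solve-∀
    ring₃ : ∀ x b y → x * (b * y) ≡ b * (x * y)
    ring₃ = solve-∀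

  -- The assumed bound is squared so that D⁴ appears, which `factorial` bounds from below by l! P³ /
  -- (l + 1)³. The surplus power of P, together with M, forms n = 2 M P ≥ b, and `growth` is
  -- violated.
  contradictory : ∀ M P D l → .{{NonZero M}} → .{{NonZero P}} →
    b ≤ M * (2 * P) →
    l ! * (P * P * P) ≤ suc l * suc l * suc l * (D * D * (D * D)) →
    ¬ M * (D * D) ≤ a * (4 ^ l * (l * l)) * P
  contradictory M P D l b≤n factorial bound = <⇒≱ (growth l) (*-cancelʳ-≤ _ _ (P * P) {{m*n≢0 P P}} (begin
    b * l ! * (P * P)                        ≤⟨ *-monoˡ-≤ (P * P) (*-monoˡ-≤ (l !) b≤n) ⟩
    M * (2 * P) * l ! * (P * P)              ≡⟨ ring₁ M P (l !) ⟩
    2 * M * (l ! * (P * P * P))              ≤⟨ *-monoʳ-≤ (2 * M) factorial ⟩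
    -- A spare factor M is inserted to complete the square of M D².
    2 * M * (s * s * s * (D * D * (D * D)))  ≤⟨ m≤n*m (2 * M * (s * s * s * (D * D * (D * D)))) M ⟩
    M * (2 * M * (s * s * s * (D * D * (D * D))))
                                             ≡⟨ ring₂ M s D ⟩
    2 * (s * s * s) * (M * (D * D) * (M * (D * D)))
                                             ≤⟨ *-monoʳ-≤ (2 * (s * s * s)) (*-mono-≤ bound bound) ⟩
    2 * (s * s * s) * (a * (4 ^ l * (l * l)) * P * (a * (4 ^ l * (l * l)) * P))
                                             ≡⟨ ring₃ s a (4 ^ l) l P ⟩
    2 * (a * a) * (4 ^ l * 4 ^ l * (s * s * s * (l * (l * (l * l))))) * (P * P)
      ≤⟨ *-monoˡ-≤ (P * P) (*-monoʳ-≤ (2 * (a * a)) (*-monoʳ-≤ (4 ^ l * 4 ^ l) (*-monoʳ-≤ (s * s * s)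
           (*-mono-≤ l≤s (*-mono-≤ l≤s (*-mono-≤ l≤s l≤s)))))) ⟩
    2 * (a * a) * (4 ^ l * 4 ^ l * (s * s * s * (s * (s * (s * s))))) * (P * P)
      ≡⟨ cong₂ (λ x y → 2 * (a * a) * (x * y) * (P * P)) 4ˡ4ˡ≡16ˡ (ring₄ s) ⟩
    2 * (a * a) * (16 ^ l * s ^ 7) * (P * P) ∎))
    where
    open ≤-Reasoning
    s : ℕ
    s = suc l
    l≤s : l ≤ s
    l≤s = n≤1+n l
    4ˡ4ˡ≡16ˡ : 4 ^ l * 4 ^ l ≡ 16 ^ l
    4ˡ4ˡ≡16ˡ = trans (sym (^-distribˡ-+-* 4 l l)) (trans (cong (4 ^_) (double l)) (sym (^-*-assoc 4 2 l)))
      where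
      double : ∀ l → l + l ≡ 2 * l
      double = solve-∀
    ring₁ : ∀ M P f → M * (2 * P) * f * (P * P) ≡ 2 * M * (f * (P * P * P))
    ring₁ = solve-∀
    ring₂ : ∀ M s D → M * (2 * M * (s * s * s * (D * D * (D * D)))) ≡ 2 * (s * s * s) * (M * (D * D) * (M * (D * D)))
    ring₂ = solve-∀
    ring₃ : ∀ s a f l P → 2 * (s * s * s) * (a * (f * (l * l)) * P * (a * (f * (l * l)) * P))
      ≡ 2 * (a * a) * (f * f * (s * s * s * (l * (l * (l * l))))) * (P * P)
    ring₃ = solve-∀
    ring₄ : ∀ s → s * s * s * (s * (s * (s * s))) ≡ s * (s * (s * (s * (s * (s * (s * 1))))))
    ring₄ = solve-∀

  -- The threshold 4 works because (5/4)³ < 2.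
  cube-suc : ∀ n → 4 ≤ n → suc n * suc n * suc n ≤ 2 * (n * n * n)
  cube-suc n 4≤n with n ∸ 4 | m+[n∸m]≡n 4≤n
  ... | k | refl = ≤-trans (m≤m+n _ _) (≤-reflexive (sym (ring k)))
    where
    ring : ∀ k → 2 * ((4 + k) * (4 + k) * (4 + k))
      ≡ (5 + k) * (5 + k) * (5 + k) + (3 + 21 * k + 9 * (k * k) + k * k * k)
    ring = solve-∀

  -- Here f = φ n, t = 4 ^ l, w = |X| |Y|, g is the number of pairs with coprime sum and K is
  -- half of f.
  cofactor-bound : ∀ {n M P D H q l K f w g} t → .{{NonZero M}} → .{{NonZero n}} → 4 ≤ n →
    n ≡ M * (2 * P) → f ≡ M * D → f ≤ 3 * K → K * K ≤ g → g ≤ 4 * t * w →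
    w * (H * H) ≤ 2 * (suc n * suc n * suc n) → H * (2 * q) ≡ n → 2 * q ≤ 11 * l →
    M * (D * D) ≤ a * (t * (l * l)) * P
  cofactor-bound {n} {M} {P} {D} {H} {q} {l} {K} {f} {w} {g} t 4≤n n≡ f≡ f≤3K K²≤g g≤ w≤ H2q≡n 2q≤11l =
    ≤-trans (*-cancelˡ-≤ M M²D²≤) (begin
      288 * t * (2 * q * (2 * q)) * P         ≤⟨ *-monoˡ-≤ P (*-monoʳ-≤ (288 * t) (*-mono-≤ 2q≤11l 2q≤11l)) ⟩
      288 * t * (11 * l * (11 * l)) * P       ≡⟨ trans (ring₄ 288 11 t l P) (cong (λ a → a * (t * (l * l)) * P) (sym a-def)) ⟩
      a * (t * (l * l)) * P               ∎)
    where
    open ≤-Reasoning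
    ring₁ : ∀ n K → 3 * K * (3 * K) * (n * n) ≡ 9 * (n * n) * (K * K)
    ring₁ = solve-∀
    ring₂ : ∀ H q t w → 9 * (H * (2 * q) * (H * (2 * q))) * (4 * t * w) ≡ 36 * (t * (2 * q * (2 * q))) * (w * (H * H))
    ring₂ = solve-∀
    ring₃ : ∀ s n → 36 * s * (2 * (2 * (n * n * n))) ≡ 144 * s * n * (n * n)
    ring₃ = solve-∀
    ring₄ : ∀ a e t l P → a * t * (e * l * (e * l)) * P ≡ a * (e * e) * (t * (l * l)) * P
    ring₄ = solve-∀
    ring₅ : ∀ M D → M * (M * (D * D)) ≡ M * D * (M * D)
    ring₅ = solve-∀
    ring₆ : ∀ t s M P → 144 * (t * s) * (M * (2 * P)) ≡ M * (288 * t * s * P)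
    ring₆ = solve-∀
    f²≤ : f * f ≤ 144 * (t * (2 * q * (2 * q))) * n
    f²≤ = *-cancelʳ-≤ _ _ (n * n) {{m*n≢0 n n}} (begin
      f * f * (n * n)                                 ≤⟨ *-monoˡ-≤ (n * n) (*-mono-≤ f≤3K f≤3K) ⟩
      3 * K * (3 * K) * (n * n)                       ≡⟨ ring₁ n K ⟩
      9 * (n * n) * (K * K)                           ≤⟨ *-monoʳ-≤ (9 * (n * n)) (≤-trans K²≤g g≤) ⟩
      9 * (n * n) * (4 * t * w)                       ≡⟨ cong (λ n → 9 * (n * n) * (4 * t * w)) H2q≡n ⟨
      9 * (H * (2 * q) * (H * (2 * q))) * (4 * t * w) ≡⟨ ring₂ H q t w ⟩
      36 * (t * (2 * q * (2 * q))) * (w * (H * H))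
        ≤⟨ *-monoʳ-≤ (36 * (t * (2 * q * (2 * q)))) (≤-trans w≤ (*-monoʳ-≤ 2 (cube-suc n 4≤n))) ⟩
      36 * (t * (2 * q * (2 * q))) * (2 * (2 * (n * n * n)))
                                                      ≡⟨ ring₃ (t * (2 * q * (2 * q))) n ⟩
      144 * (t * (2 * q * (2 * q))) * n * (n * n)     ∎)
    M²D²≤ : M * (M * (D * D)) ≤ M * (288 * t * (2 * q * (2 * q)) * P)
    M²D²≤ = begin
      M * (M * (D * D))                               ≡⟨ ring₅ M D ⟩
      M * D * (M * D)                                 ≡⟨ cong₂ _*_ f≡ f≡ ⟨
      f * f                                           ≤⟨ f²≤ ⟩
      144 * (t * (2 * q * (2 * q))) * n               ≡⟨ cong (144 * (t * (2 * q * (2 * q))) *_) n≡ ⟩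
      144 * (t * (2 * q * (2 * q))) * (M * (2 * P))   ≡⟨ ring₆ t (2 * q * (2 * q)) M P ⟩
      M * (288 * t * (2 * q * (2 * q)) * P)           ∎

-- From a root of z^H ≡ -1 to a pair of QNRNPs.

module Residues where

  open import Defs using (φ; PrimitiveRoot; QuadraticNonResidue; QNRNP; _≡_[mod_])
  open import Data.Integer.Base as ℤ using (ℤ; +_; 0ℤ; 1ℤ; -1ℤ) renaming (_^_ to _^ᶻ_; _*_ to _*ᶻ_; _+_ to _+ᶻ_; _-_ to _-ᶻ_; -_ to -ᶻ_)
  import Data.Integer.Coprimality as ℤ
  import Data.Integer.DivMod as ℤ
  import Data.Integer.Properties as ℤ
  open import Data.Nat.Base
  open import Data.Nat.Coprimality as Coprimality using (Coprime; coprime-Bézout)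
  open import Data.Nat.Divisibility
  open import Data.Nat.GCD using (module Bézout)
  open import Data.Nat.Primality
  open import Data.Nat.Properties
  open import Data.Nat.Tactic.RingSolver using (solve-∀)
  open import Data.Product.Base using (∃-syntax; _×_; _,_; proj₁; proj₂)
  open import Data.Sum.Base using (_⊎_; inj₁; inj₂; [_,_]′)
  open import Relation.Binary.PropositionalEquality
  import Relation.Binary.Reasoning.Setoid as ≈-Reasoning
  open import Relation.Nullary using (¬_; Dec; yes; no; contradiction)
  open Sums
  open Modular
  open Sieve using (prime∣prime⇒≡)

  2∣n⊎2∣1+n : ∀ n → 2 ∣ n ⊎ 2 ∣ suc n
  2∣n⊎2∣1+n zero    = inj₁ (divides 0 refl)
  2∣n⊎2∣1+n (suc n) = [ (λ { (divides k refl) → inj₂ (divides (suc k) refl) }) , inj₁ ]′ (2∣n⊎2∣1+n n)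

  [-1]^odd : ∀ k → ¬ 2 ∣ k → -1ℤ ^ᶻ k ≡ -1ℤ
  [-1]^odd zero          2∤k = contradiction (divides 0 refl) 2∤k
  [-1]^odd (suc zero)    2∤k = refl
  [-1]^odd (suc (suc k)) 2∤k = trans (sym (ℤ.*-assoc -1ℤ -1ℤ (-1ℤ ^ᶻ k)))
    (trans (ℤ.*-identityˡ (-1ℤ ^ᶻ k)) ([-1]^odd k (λ 2∣k → 2∤k (∣m∣n⇒∣m+n ∣-refl 2∣k))))

  coprime⇒inverse : ∀ z n → 2 ≤ n → Coprime z n → ∃[ k ] ∃[ j ] k * z ≡ 1 + j * n
  coprime⇒inverse z n@(suc n-1) 2≤n coprime with coprime-Bézout coprime
  ... | Bézout.+- x y 1+yn≡xz = x , y , sym 1+yn≡xz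
  -- Here -x is the inverse of z; multiplication by n - 1 ≡ -1 turns it into the natural number x (n
  -- - 1).
  ... | Bézout.-+ x (suc y) 1+xz≡yn = x * n-1 , y * n-1 + (n-1 ∸ 1) , +-cancelʳ-≡ n-1 _ _ (begin
      x * n-1 * z + n-1                              ≡⟨ ring₁ x n-1 z ⟩
      (1 + x * z) * n-1                              ≡⟨ cong (_* n-1) 1+xz≡yn ⟩
      suc y * n * n-1                                ≡⟨ ring₂ y n n-1 ⟩
      y * n-1 * n + n * n-1                          ≡⟨ cong (λ m → y * n-1 * n + n * m) (m+[n∸m]≡n {1} (s≤s⁻¹ 2≤n)) ⟨
      y * n-1 * n + n * suc (n-1 ∸ 1)                ≡⟨ ring₃ (y * n-1) (n-1 ∸ 1) n-1 ⟩
      1 + (y * n-1 + (n-1 ∸ 1)) * n + n-1            ∎)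
    where
    open ≡-Reasoning
    ring₁ : ∀ x m z → x * m * z + m ≡ (1 + x * z) * m
    ring₁ = solve-∀
    ring₂ : ∀ y n m → suc y * n * m ≡ y * m * n + n * m
    ring₂ = solve-∀
    ring₃ : ∀ a c m → a * suc m + suc m * suc c ≡ 1 + (a + c) * suc m + m
    ring₃ = solve-∀

  module Root {p q H : ℕ} (p-prime : Prime p) (2<p : 2 < p) (q-prime : Prime q) (q≢2 : q ≢ 2)
    (H2q≡n : H * (2 * q) ≡ p ∸ 1) where

    open ModPrime p-prime

    n : ℕ
    n = p ∸ 1

    private
      suc-n : suc n ≡ p
      suc-n = m+[n∸m]≡n {1} (<⇒≤ 1<p)

    n>0 : 0 < n
    n>0 = m<n⇒0<n∸m 1<p

    private instance
      n≢0 : NonZero n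
      n≢0 = >-nonZero n>0
      H≢0 : NonZero H
      H≢0 = m*n≢0⇒m≢0 H {{subst NonZero (sym H2q≡n) n≢0}}

    q-odd : ¬ 2 ∣ q
    q-odd 2∣q = q≢2 (sym (prime∣prime⇒≡ prime[2] q-prime 2∣q))

    1≉-1 : ¬ 1ℤ ≈ -1ℤ
    1≉-1 1≈-1 = <⇒≱ 2<p (∣⇒≤ (unmod 1≈-1))

    fermat-ℤ : ∀ y → ¬ y ≈ 0ℤ → y ^ᶻ n ≈ 1ℤ
    fermat-ℤ y y≉0 = ≈-trans (^-cong n y≈r) (fermat r (λ r≈0 → y≉0 (≈-trans y≈r r≈0)))
      where
      open ≈-Reasoning ≈-setoid
      instance
        p≢0 : NonZero p
        p≢0 = prime⇒nonZero p-prime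
      r : ℕ
      r = y ℤ.%ℕ p
      multiple : (y ℤ./ℕ p) *ᶻ + p ≈ 0ℤ
      multiple = ∣⇒≈0 (subst (p ∣_) (sym (ℤ.abs-* (y ℤ./ℕ p) (+ p))) (n∣m*n ℤ.∣ y ℤ./ℕ p ∣))
      y≈r : y ≈ + r
      y≈r = begin
        y                          ≡⟨ ℤ.a≡a%ℕn+[a/ℕn]*n y p ⟩
        + r +ᶻ (y ℤ./ℕ p) *ᶻ + p   ≈⟨ +-cong (≈-refl {+ r}) multiple ⟩
        + r +ᶻ 0ℤ                  ≡⟨ ℤ.+-identityʳ (+ r) ⟩
        + r                        ∎

    ≉0⇒coprime : ∀ a → ¬ a ≈ 0ℤ → ℤ.Coprime a (+ p)
    ≉0⇒coprime a a≉0 (d∣a , d∣p) = [ (λ d≡1 → d≡1) , (λ { refl → contradiction (∣⇒≈0 d∣a) a≉0 }) ]′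
      (prime⇒irreducible p-prime d∣p)

    power-2H : ∀ {a} → a ^ᶻ H ≈ -1ℤ → a ^ᶻ (H * 2) ≈ 1ℤ
    power-2H {a} aᴴ≈-1 = ≈-trans (≈-reflexive (sym (ℤ.^-*-assoc a H 2))) (^-cong 2 aᴴ≈-1)

    root≉0 : ∀ {a} → a ^ᶻ H ≈ -1ℤ → ¬ a ≈ 0ℤ
    root≉0 {a} aᴴ≈-1 a≈0 = 1≉0 (begin
      1ℤ            ≈⟨ power-2H aᴴ≈-1 ⟨
      a ^ᶻ (H * 2)  ≈⟨ ^-cong (H * 2) a≈0 ⟩
      0ℤ ^ᶻ (H * 2) ≡⟨ cong (0ℤ ^ᶻ_) (suc-pred (H * 2) {{m*n≢0 H 2}}) ⟨
      0ℤ ^ᶻ suc (pred (H * 2)) ≡⟨⟩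
      0ℤ            ∎)
      where open ≈-Reasoning ≈-setoid

    root⇒QNRNP : ∀ {a} → a ^ᶻ H ≈ -1ℤ → QNRNP p a
    root⇒QNRNP {a} aᴴ≈-1 = (≉0⇒coprime a a≉0 , nonresidue) , nonprimitive
      where
      a≉0 : ¬ a ≈ 0ℤ
      a≉0 = root≉0 aᴴ≈-1
      nonresidue : ¬ (∃[ y ] y ^ᶻ 2 ≡ a [mod p ])
      nonresidue (y , y²≡a) = 1≉-1 (begin
        1ℤ                      ≈⟨ fermat-ℤ y y≉0 ⟨
        y ^ᶻ n                  ≡⟨ cong (y ^ᶻ_) (trans (sym H2q≡n) (ring H q)) ⟩
        y ^ᶻ (2 * (H * q))      ≡⟨ ℤ.^-*-assoc y 2 (H * q) ⟨
        (y ^ᶻ 2) ^ᶻ (H * q)     ≈⟨ ^-cong (H * q) y²≈a ⟩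
        a ^ᶻ (H * q)            ≡⟨ ℤ.^-*-assoc a H q ⟨
        (a ^ᶻ H) ^ᶻ q           ≈⟨ ^-cong q aᴴ≈-1 ⟩
        -1ℤ ^ᶻ q                ≡⟨ [-1]^odd q q-odd ⟩
        -1ℤ                     ∎)
        where
        open ≈-Reasoning ≈-setoid
        y²≈a : y ^ᶻ 2 ≈ a
        y²≈a = mod y²≡a
        y≉0 : ¬ y ≈ 0ℤ
        y≉0 y≈0 = a≉0 (≈-trans (≈-sym y²≈a) (^-cong 2 y≈0))
        ring : ∀ H q → H * (2 * q) ≡ 2 * (H * q)
        ring = solve-∀
      -- Every power of a is a root of z ^ (2 H) - 1, which has only 2 H < p - 1 roots.
      nonprimitive : ¬ PrimitiveRoot p a
      nonprimitive (_ , generates) = <⇒≱ 2H<n (+-cancelʳ-≤ 1 n (H * 2) (begin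
        n + 1                                                        ≡⟨ trans (+-comm n 1) suc-n ⟩
        p                                                            ≡⟨ trans (∑-const p 1) (*-identityʳ p) ⟨
        ∑[ h < p ] 1                                                 ≤⟨ ∑-mono p (λ h _ → everything h (+ h ≈? 0ℤ)) ⟩
        ∑[ h < p ] (𝟙 ((+ h) ^ᶻ (H * 2) ≈? 1ℤ) + 𝟙 (+ h ≈? 0ℤ))      ≡⟨ ∑-distrib-+ p (λ h → 𝟙 ((+ h) ^ᶻ (H * 2) ≈? 1ℤ)) (λ h → 𝟙 (+ h ≈? 0ℤ)) ⟩
        ∑[ h < p ] 𝟙 ((+ h) ^ᶻ (H * 2) ≈? 1ℤ) + ∑[ h < p ] 𝟙 (+ h ≈? 0ℤ)
          ≤⟨ +-mono-≤ (roots-of-unity (H * 2) {{m*n≢0 H 2}})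
               (∑𝟙≤1 p (λ h → + h ≈? 0ℤ) (λ i j i<p j<p i≈0 j≈0 → ≈⇒≡ i<p j<p (≈-trans i≈0 (≈-sym j≈0)))) ⟩
        H * 2 + 1                                                    ∎))
        where
        open ≤-Reasoning
        2H<n : H * 2 < n
        2H<n = subst (H * 2 <_) (trans (*-assoc H 2 q) H2q≡n)
          (m<m*n (H * 2) q {{m*n≢0 H 2}} (nonTrivial⇒n>1 q {{prime⇒nonTrivial q-prime}}))
        power : ∀ h k → a ^ᶻ k ≈ + h → (+ h) ^ᶻ (H * 2) ≈ 1ℤ
        power h k aᵏ≈h = R.begin
          (+ h) ^ᶻ (H * 2)        R.≈⟨ ^-cong (H * 2) aᵏ≈h ⟨
          (a ^ᶻ k) ^ᶻ (H * 2)     R.≡⟨ ℤ.^-*-assoc a k (H * 2) ⟩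
          a ^ᶻ (k * (H * 2))      R.≡⟨ cong (a ^ᶻ_) (*-comm k (H * 2)) ⟩
          a ^ᶻ (H * 2 * k)        R.≡⟨ ℤ.^-*-assoc a (H * 2) k ⟨
          (a ^ᶻ (H * 2)) ^ᶻ k     R.≈⟨ ^-cong k (power-2H aᴴ≈-1) ⟩
          1ℤ ^ᶻ k                 R.≡⟨ ℤ.^-zeroˡ k ⟩
          1ℤ                      R.∎
          where module R = ≈-Reasoning ≈-setoid
        everything : ∀ h → Dec (+ h ≈ 0ℤ) → 1 ≤ 𝟙 ((+ h) ^ᶻ (H * 2) ≈? 1ℤ) + 𝟙 (+ h ≈? 0ℤ)
        everything h (yes h≈0) = ≤-trans (≤-reflexive (sym (𝟙-yes (+ h ≈? 0ℤ) h≈0))) (m≤n+m _ _)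
        everything h (no h≉0)  = ≤-trans (≤-reflexive (sym (𝟙-yes ((+ h) ^ᶻ (H * 2) ≈? 1ℤ)
            (power h (proj₁ generator) (mod (proj₂ generator)))))) (m≤m+n _ _)
          where
          generator = generates (+ h) (≉0⇒coprime (+ h) h≉0)

    2∣n : 2 ∣ n
    2∣n = subst (2 ∣_) H2q≡n (∣n⇒∣m*n H (m∣m*n q))

    fixed-point : ∀ z → z < n → Coprime z n → (+ z) ^ᶻ H ≈ -1ℤ →
      ∃[ g ] ∃[ x ] (QNRNP p g × 1 ≤ x × x ≤ n × QNRNP p (+ x) × (g ^ᶻ x) ≡ (+ x) [mod p ])
    fixed-point z z<n coprime zᴴ≈-1 = solution (coprime⇒inverse z n (∣⇒≤ 2∣n) coprime)
      where
      open ≈-Reasoning ≈-setoid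
      z≢0 : z ≢ 0
      z≢0 refl = root≉0 zᴴ≈-1 ≈-refl
      solution : ∃[ k ] ∃[ j ] k * z ≡ 1 + j * n →
        ∃[ g ] ∃[ x ] (QNRNP p g × 1 ≤ x × x ≤ n × QNRNP p (+ x) × (g ^ᶻ x) ≡ (+ x) [mod p ])
      solution (k , j , kz≡1+jn) =
        (+ z) ^ᶻ k , z , root⇒QNRNP gᴴ≈-1 , n≢0⇒n>0 z≢0 , <⇒≤ z<n , root⇒QNRNP zᴴ≈-1 , unmod gᶻ≈z
        where
        -- k z = 1 + j n is odd because n is even. Oddness of k is what keeps g^H = (z^H)^k = (-1)^k
        -- equal to -1.
        k-odd : ¬ 2 ∣ k
        k-odd 2∣k = contradiction (∣1⇒≡1 (∣m+n∣n⇒∣m′ (subst (2 ∣_) kz≡1+jn (∣m⇒∣m*n z 2∣k)) (∣n⇒∣m*n j 2∣n))) (λ ())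
          where
          ∣m+n∣n⇒∣m′ : ∀ {d a b} → d ∣ a + b → d ∣ b → d ∣ a
          ∣m+n∣n⇒∣m′ {d} {a} {b} d∣a+b = ∣m+n∣m⇒∣n (subst (d ∣_) (+-comm a b) d∣a+b)
        gᴴ≈-1 : ((+ z) ^ᶻ k) ^ᶻ H ≈ -1ℤ
        gᴴ≈-1 = begin
          ((+ z) ^ᶻ k) ^ᶻ H   ≡⟨ ℤ.^-*-assoc (+ z) k H ⟩
          (+ z) ^ᶻ (k * H)    ≡⟨ cong ((+ z) ^ᶻ_) (*-comm k H) ⟩
          (+ z) ^ᶻ (H * k)    ≡⟨ ℤ.^-*-assoc (+ z) H k ⟨
          ((+ z) ^ᶻ H) ^ᶻ k   ≈⟨ ^-cong k zᴴ≈-1 ⟩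
          -1ℤ ^ᶻ k            ≡⟨ [-1]^odd k k-odd ⟩
          -1ℤ                 ∎
        gᶻ≈z : ((+ z) ^ᶻ k) ^ᶻ z ≈ + z
        gᶻ≈z = begin
          ((+ z) ^ᶻ k) ^ᶻ z         ≡⟨ ℤ.^-*-assoc (+ z) k z ⟩
          (+ z) ^ᶻ (k * z)          ≡⟨ cong ((+ z) ^ᶻ_) (trans kz≡1+jn (cong suc (*-comm j n))) ⟩
          + z *ᶻ (+ z) ^ᶻ (n * j)   ≡⟨ cong (+ z *ᶻ_) (ℤ.^-*-assoc (+ z) n j) ⟨
          + z *ᶻ ((+ z) ^ᶻ n) ^ᶻ j  ≈⟨ *-cong (≈-refl {+ z}) (^-cong j (fermat-ℤ (+ z) (root≉0 zᴴ≈-1))) ⟩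
          + z *ᶻ 1ℤ ^ᶻ j            ≡⟨ cong (+ z *ᶻ_) (ℤ.^-zeroˡ j) ⟩
          + z *ᶻ 1ℤ                 ≡⟨ ℤ.*-identityʳ (+ z) ⟩
          + z                       ∎

-- Existence of the root, by comparing the two counts.

module Existence where

  open import Defs using (φ; QNRNP; _≡_[mod_])
  open import Data.Bool.Base using (Bool; true; T)
  open import Data.Integer.Base using (+_; 1ℤ; -1ℤ) renaming (_^_ to _^ᶻ_)
  import Data.Integer.Properties as ℤ
  open import Data.List.Base using (List; []; _∷_; length; map)
  open import Data.List.Membership.Propositional using (_∈_)
  open import Data.List.Relation.Unary.All as All using (All; []; _∷_)
  open import Data.List.Relation.Unary.AllPairs using (AllPairs)
  open import Data.Nat.Base
  open import Data.Nat.Coprimality using (Coprime; coprime?)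
  open import Data.Nat.Divisibility
  open import Data.Nat.DivMod using (_/_; _%_; m≡m%n+[m/n]*n; m%n<n)
  open import Data.Nat.ListAction using (product)
  open import Data.Nat.ListAction.Properties using (∈⇒∣product)
  open import Data.Nat.Primality
  open import Data.Nat.Properties
  open import Data.Nat.Tactic.RingSolver using (solve-∀)
  open import Data.Product.Base using (∃-syntax; _×_; _,_; proj₁; proj₂)
  open import Data.Sum.Base using (_⊎_; inj₁; inj₂; [_,_]′)
  open import Data.Unit.Base using (tt)
  open import Relation.Binary.PropositionalEquality
  open import Relation.Nullary using (¬_; Dec; yes; no; contradiction)
  open import Relation.Nullary.Decidable using (_×-dec_; toWitness)
  open Sums
  open Modular using (module ModPrime)
  open SecondMoment using (module Sumset)
  open Separation
  open Sieve
  open Growth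
  open Residues

  bit-T : ∀ {c} → T c → bit c ≡ 1
  bit-T {true} _ = refl

  ≡true⇒T : ∀ {c} → c ≡ true → T c
  ≡true⇒T refl = tt

  -- Without odd primes both products are empty and the hypothesis reads 11 ≤ 9; in other words
  -- φ(n)/n would be exactly 1/2.
  smallest : ∀ qs → AllPairs _>_ qs → 11 * product (map pred qs) ≤ 9 * product qs →
    ∃[ q ] (q ∈ qs × All (q ≤_) qs)
  smallest []       _    11≤9 = contradiction 11≤9 (<⇒≱ (toWitness {a? = 9 * 1 <? 11 * 1} tt))
  smallest (r ∷ rs) desc _    = minimum r rs desc

  4≤2^82 : 4 ≤ 2 ^ 82
  4≤2^82 = ^-monoʳ-≤ 2 {2} {82} (s≤s (s≤s z≤n))

  module _ {p : ℕ} (p-prime : Prime p) (2^82<p : 2 ^ 82 < p) (φ-small : 22 * φ (p ∸ 1) ≤ 9 * (p ∸ 1)) where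

    open ModPrime p-prime

    private
      n : ℕ
      n = p ∸ 1

      suc-n : suc n ≡ p
      suc-n = m+[n∸m]≡n {1} (<⇒≤ 1<p)

      2^82≤n : 2 ^ 82 ≤ n
      2^82≤n = s≤s⁻¹ (subst (2 ^ 82 <_) (sym suc-n) 2^82<p)

      4≤n : 4 ≤ n
      4≤n = ≤-trans 4≤2^82 2^82≤n

      2≤n : 2 ≤ n
      2≤n = ≤-trans (s≤s (s≤s z≤n)) 4≤n

      2<p : 2 < p
      2<p = subst (2 <_) suc-n (s≤s 2≤n)

      2∣n : 2 ∣ n
      2∣n = [ (λ 2∣n → 2∣n)
            , (λ 2∣1+n → contradiction (prime∣prime⇒≡ prime[2] p-prime (subst (2 ∣_) suc-n 2∣1+n)) (<⇒≢ 2<p))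
            ]′ (2∣n⊎2∣1+n n)

      qs rs : List ℕ
      qs = oddPrimes n 2≤n 2∣n
      rs = primes n 2≤n 2∣n

      M P D l f : ℕ
      M = cofactor n 2≤n 2∣n
      P = product qs
      D = product (map pred qs)
      l = length qs
      f = φ n

      n≡M2P : n ≡ M * (2 * P)
      n≡M2P = n≡cofactor*product n 2≤n 2∣n

      f≡MD : f ≡ M * D
      f≡MD = φ≡cofactor*product n 2≤n 2∣n

      instance
        n≢0 : NonZero n
        n≢0 = >-nonZero (≤-trans (s≤s z≤n) 4≤n)

        M≢0 : NonZero M
        M≢0 = m*n≢0⇒m≢0 M {{subst NonZero n≡M2P n≢0}}

        P≢0 : NonZero P
        P≢0 = m*n≢0⇒n≢0 2 {{m*n≢0⇒n≢0 M {{subst NonZero n≡M2P n≢0}}}}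

      divisors : All (OddPrimeDivisor n) qs
      divisors = oddPrimes-divisors n 2≤n 2∣n

      descending : AllPairs _>_ qs
      descending = oddPrimes-descending n 2≤n 2∣n

      11D≤9P : 11 * D ≤ 9 * P
      11D≤9P = *-cancelˡ-≤ (M * 2) {{m*n≢0 M 2}} (begin
        M * 2 * (11 * D)   ≡⟨ ring₁ M D ⟩
        22 * (M * D)       ≡⟨ cong (22 *_) f≡MD ⟨
        22 * f             ≤⟨ φ-small ⟩
        9 * n              ≡⟨ cong (9 *_) n≡M2P ⟩
        9 * (M * (2 * P))  ≡⟨ ring₂ M P ⟩
        M * 2 * (9 * P)    ∎)
        where
        open ≤-Reasoning
        ring₁ : ∀ M D → M * 2 * (11 * D) ≡ 22 * (M * D)
        ring₁ = solve-∀
        ring₂ : ∀ M P → 9 * (M * (2 * P)) ≡ M * 2 * (9 * P)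
        ring₂ = solve-∀

      q : ℕ
      q = proj₁ (smallest qs descending 11D≤9P)

      q∈qs : q ∈ qs
      q∈qs = proj₁ (proj₂ (smallest qs descending 11D≤9P))

      q-divisor : OddPrimeDivisor n q
      q-divisor = All.lookup divisors q∈qs

      q-prime : Prime q
      q-prime = proj₁ q-divisor

      -- `product-pred-bound` and `11D≤9P` give 1 - l/q ≤ D/P ≤ 9/11, that is l/q ≥ 2/11.
      2q≤11l : 2 * q ≤ 11 * l
      2q≤11l = *-cancelʳ-≤ (2 * q) (11 * l) P (+-cancelˡ-≤ (9 * q * P) _ _ (begin
        9 * q * P + 2 * q * P            ≡⟨ ring₁ q P ⟩
        11 * (q * P)                     ≤⟨ *-monoʳ-≤ 11 (product-pred-bound q qs (proj₂ (proj₂ (smallest qs descending 11D≤9P)))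
                                              (All.map (λ { (r-prime , _) → prime⇒nonZero r-prime }) divisors)) ⟩
        11 * (q * D + l * P)             ≡⟨ ring₂ q D l P ⟩
        q * (11 * D) + 11 * l * P        ≤⟨ +-monoˡ-≤ (11 * l * P) (*-monoʳ-≤ q 11D≤9P) ⟩
        q * (9 * P) + 11 * l * P         ≡⟨ ring₃ q l P ⟩
        9 * q * P + 11 * l * P           ∎))
        where
        open ≤-Reasoning
        ring₁ : ∀ q P → 9 * q * P + 2 * q * P ≡ 11 * (q * P)
        ring₁ = solve-∀
        ring₂ : ∀ q D l P → 11 * (q * D + l * P) ≡ q * (11 * D) + 11 * l * P
        ring₂ = solve-∀
        ring₃ : ∀ q l P → q * (9 * P) + 11 * l * P ≡ 9 * q * P + 11 * l * P
        ring₃ = solve-∀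

      H : ℕ
      H = M * quotient (∈⇒∣product q∈qs)

      H2q≡n : H * (2 * q) ≡ n
      H2q≡n = begin
        M * c * (2 * q)    ≡⟨ ring M c q ⟩
        M * (2 * (c * q))  ≡⟨ cong (λ z → M * (2 * z)) (_∣_.equality (∈⇒∣product q∈qs)) ⟨
        M * (2 * P)        ≡⟨ n≡M2P ⟨
        n                  ∎
        where
        open ≡-Reasoning
        c : ℕ
        c = quotient (∈⇒∣product q∈qs)
        ring : ∀ M c q → M * c * (2 * q) ≡ M * (2 * (c * q))
        ring = solve-∀

      instance
        q≢0 : NonZero q
        q≢0 = prime⇒nonZero q-prime

        2q≢0 : NonZero (2 * q)
        2q≢0 = m*n≢0 2 q

        H≢0 : NonZero H
        H≢0 = m*n≢0⇒m≢0 H {{subst NonZero (sym H2q≡n) n≢0}}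

      -- `Sumset` takes its forbidden value as a natural number below p, so -1 is represented by n.
      -- It is admissible because -1 is a 2q-th root of unity.
      n≈-1 : + n ≈ -1ℤ
      n≈-1 = mod (subst (p ∣_) (trans (sym suc-n) (+-comm 1 n)) ∣-refl)

      n^2q≈1 : (+ n) ^ᶻ (2 * q) ≈ 1ℤ
      n^2q≈1 = ≈-trans (^-cong (2 * q) n≈-1)
        (≈-reflexive (trans (sym (ℤ.^-*-assoc -1ℤ 2 q)) (ℤ.^-zeroˡ q)))

      κ : ℕ → ℕ
      κ s = 𝟙 (free? rs s)

      -- The starting sets are the intervals [0, K) and [0, n - K). Their lengths add up to n, which
      -- keeps all sums below n, and half of φ(n) is the length for which every row still holds K
      -- coprime sums.
      K : ℕ
      K = f / 2

      K+K≤f : K + K ≤ f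
      K+K≤f = ≤-trans (m≤n+m (K + K) (f % 2))
        (≤-reflexive (trans (cong (λ z → f % 2 + z) (ring K)) (sym (m≡m%n+[m/n]*n f 2))))
        where
        ring : ∀ K → K + K ≡ K * 2
        ring = solve-∀

      f≡∑κ : f ≡ ∑ n κ
      f≡∑κ = φ≡∑free n 2≤n 2∣n

      ∑κ≤ : ∀ N (h : ℕ → ℕ) → ∑[ x < N ] κ (h x) ≤ N
      ∑κ≤ N h = ≤-trans (∑-mono N (λ x _ → 𝟙≤1 (free? rs (h x)))) (≤-reflexive (trans (∑-const N 1) (*-identityʳ N)))

      K≤n : K ≤ n
      K≤n = ≤-trans (m≤m+n K K) (≤-trans K+K≤f (≤-trans (≤-reflexive f≡∑κ) (∑κ≤ n (λ x → x))))

      n≤p : n ≤ p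
      n≤p = m∸n≤m p 1

      -- The window [x, x + n - K) misses x numbers of [0, n) below it and K - x above it. At most K
      -- of the f ≥ 2 K coprime numbers are lost.
      row : ∀ x → x < K → K ≤ ∑[ y < n ∸ K ] κ (x + y)
      row x x<K = +-cancelˡ-≤ K K _ (begin
        K + K                          ≤⟨ K+K≤f ⟩
        f                              ≡⟨ f≡∑κ ⟩
        ∑ n κ                          ≡⟨ cong (λ N → ∑ N κ) n≡ ⟨
        ∑ (x + (n ∸ K + (K ∸ x))) κ    ≡⟨ trans (∑-split x (n ∸ K + (K ∸ x)) κ)
                                            (cong (λ z → ∑ x κ + z) (∑-split (n ∸ K) (K ∸ x) (λ y → κ (x + y)))) ⟩
        ∑ x κ + (R + ∑[ j < K ∸ x ] κ (x + (n ∸ K + j)))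
                                       ≤⟨ +-mono-≤ (∑κ≤ x (λ x → x)) (+-monoʳ-≤ R (∑κ≤ (K ∸ x) (λ j → x + (n ∸ K + j)))) ⟩
        x + (R + (K ∸ x))              ≡⟨ ring x R (K ∸ x) ⟩
        x + (K ∸ x) + R                ≡⟨ cong (λ z → z + R) (m+[n∸m]≡n (<⇒≤ x<K)) ⟩
        K + R                          ∎)
        where
        open ≤-Reasoning
        R : ℕ
        R = ∑[ y < n ∸ K ] κ (x + y)
        ring : ∀ x R d → x + (R + d) ≡ x + d + R
        ring = solve-∀
        n≡ : x + (n ∸ K + (K ∸ x)) ≡ n
        n≡ = trans (ring x (n ∸ K) (K ∸ x)) (trans (cong (λ z → z + (n ∸ K)) (m+[n∸m]≡n (<⇒≤ x<K))) (m+[n∸m]≡n K≤n))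

      X Y : ℕ → Bool
      X x = x <ᵇ K
      Y y = y <ᵇ n ∸ K

      K²≤pairs : K * K ≤ pairs p κ X Y
      K²≤pairs = begin
        K * K                                      ≡⟨ ∑-const K K ⟨
        ∑[ x < K ] K                               ≤⟨ ∑-mono K row ⟩
        ∑[ x < K ] ∑[ y < n ∸ K ] κ (x + y)        ≡⟨ ∑-cong K (λ x x<K → ∑-cong (n ∸ K) (λ y y<n∸K → trans
                                                        (sym (*-identityˡ (κ (x + y))))
                                                        (cong₂ (λ a b → a * b * κ (x + y))
                                                          (sym (bit-T (<⇒<ᵇ x<K))) (sym (bit-T (<⇒<ᵇ y<n∸K)))))) ⟩
        ∑[ x < K ] ∑[ y < n ∸ K ] w x y            ≤⟨ ∑-mono K (λ x _ → ∑-monoˡ-≤ (w x) (≤-trans (m∸n≤m n K) n≤p)) ⟩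
        ∑[ x < K ] ∑[ y < p ] w x y                ≤⟨ ∑-monoˡ-≤ (λ x → ∑[ y < p ] w x y) (≤-trans K≤n n≤p) ⟩
        pairs p κ X Y                              ∎
        where
        open ≤-Reasoning
        w : ℕ → ℕ → ℕ
        w x y = bit (X x) * bit (Y y) * κ (x + y)

      killed : All (Killed p κ) rs
      killed = All.tabulate (λ {r} r∈ → prime⇒nonZero (All.lookup (primes-prime n 2≤n 2∣n) r∈) ,
        λ s r∣s → 𝟙-no (free? rs s) (λ free → All.lookup free r∈ r∣s))

      IsRoot : ℕ → Set
      IsRoot z = Coprime z n × (+ z) ^ᶻ H ≈ -1ℤ

      -- After thinning, every sum of X′ and Y′ is coprime to n, and it is below n since the thinned
      -- sets stay inside the intervals. So the absence of roots is exactly the avoidance condition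
      -- of `Sumset`.
      few-pairs : (∀ z → z < n → ¬ IsRoot z) → ∃[ w ] (w * (H * H) ≤ 2 * (suc n * suc n * suc n) ×
        pairs p κ X Y ≤ 4 * 4 ^ l * w)
      few-pairs none = bounded (separate p κ rs killed X Y)
        where
        bounded : ∃[ X′ ] ∃[ Y′ ] (_⊑_ p κ X′ X × _⊑_ p κ Y′ Y × All (Separated p κ X′ Y′) rs ×
            pairs p κ X Y ≤ 4 ^ length rs * pairs p κ X′ Y′) →
          ∃[ w ] (w * (H * H) ≤ 2 * (suc n * suc n * suc n) × pairs p κ X Y ≤ 4 * 4 ^ l * w)
        bounded (X′ , Y′ , X′⊑X , Y′⊑Y , separated , bound) =
          _ , subst (λ s → (∑[ x < p ] bit (X′ x)) * (∑[ y < p ] bit (Y′ y)) * (H * H) ≤ 2 * (s * s * s)) (sym suc-n)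
                (Sumset.sumset-bound p-prime H (2 * q) H2q≡n n (subst (n <_) suc-n (n<1+n n)) n^2q≈1 X′ Y′ avoids) ,
          ≤-trans bound (*-monoʳ-≤ (4 * 4 ^ l) (pairs≤ p κ (λ s → 𝟙≤1 (free? rs s)) X′ Y′))
          where
          avoids : ∀ x y → X′ x ≡ true → Y′ y ≡ true → ¬ (+ (x + y)) ^ᶻ H ≈ + n
          avoids x y x∈ y∈ root = none (x + y)
            (<-≤-trans (+-mono-<-≤ (<ᵇ⇒< x K (≡true⇒T (X′⊑X x x∈)))
                                   (<⇒≤ (<ᵇ⇒< y (n ∸ K) (≡true⇒T (Y′⊑Y y y∈)))))
                       (≤-reflexive (m+[n∸m]≡n K≤n)))
            (free⇒coprime n 2≤n 2∣n (All.map (λ sep → sep x y x∈ y∈) separated) , ≈-trans root n≈-1)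

      l>0 : 0 < l
      l>0 = nonempty q∈qs
        where
        nonempty : ∀ {qs} → q ∈ qs → 0 < length qs
        nonempty {_ ∷ _} _ = s≤s z≤n

      -- Halving loses at most 1, so f ≤ 2 K + 1, which is at most 3 K as soon as K ≥ 1.
      f≤3K⊎f≤1 : f ≤ 3 * K ⊎ f ≤ 1
      f≤3K⊎f≤1 = cases K (subst (f ≤_) (cong suc (ring K)) (≤-trans (≤-reflexive (m≡m%n+[m/n]*n f 2))
        (+-monoˡ-≤ (K * 2) (s≤s⁻¹ (m%n<n f 2)))))
        where
        ring : ∀ k → k * 2 ≡ k + k
        ring = solve-∀
        ring′ : ∀ k → suc (suc k + suc k) + k ≡ 3 * suc k
        ring′ = solve-∀
        cases : ∀ k → f ≤ suc (k + k) → f ≤ 3 * k ⊎ f ≤ 1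
        cases zero    f≤1 = inj₂ f≤1
        cases (suc k) f≤  = inj₁ (≤-trans f≤ (≤-trans (m≤m+n _ k) (≤-reflexive (ring′ k))))

      bound : (∀ z → z < n → ¬ IsRoot z) → M * (D * D) ≤ a * (4 ^ l * (l * l)) * P
      bound none = [ large , small ]′ f≤3K⊎f≤1
        where
        large : f ≤ 3 * K → M * (D * D) ≤ a * (4 ^ l * (l * l)) * P
        large f≤3K = let w , w≤ , pairs≤w = few-pairs none in
          cofactor-bound {H = H} {q} {l} {K} {w = w} (4 ^ l) 4≤n n≡M2P f≡MD f≤3K K²≤pairs pairs≤w w≤ H2q≡n 2q≤11l
        -- Here K = 0 and the count of pairs says nothing. But M D = φ(n) ≤ 1 makes the left side at
        -- most 1, and l > 0 makes the right side positive.
        small : f ≤ 1 → M * (D * D) ≤ a * (4 ^ l * (l * l)) * P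
        small f≤1 = begin
          M * (D * D)                    ≡⟨ *-assoc M D D ⟨
          M * D * D                      ≤⟨ *-mono-≤ MD≤1 (≤-trans (m≤n*m D M) MD≤1) ⟩
          1                              ≤⟨ >-nonZero⁻¹ _ {{m*n≢0 _ P {{m*n≢0 a (4 ^ l * (l * l)) {{a≢0}} {{m*n≢0 (4 ^ l) (l * l) {{m^n≢0 4 l}} {{m*n≢0 l l}}}}}}}} ⟩
          a * (4 ^ l * (l * l)) * P      ∎
          where
          open ≤-Reasoning
          instance
            l≢0 : NonZero l
            l≢0 = >-nonZero l>0
          a≢0 : NonZero a
          a≢0 = subst NonZero (sym a-def) _
          MD≤1 : M * D ≤ 1
          MD≤1 = subst (_≤ 1) f≡MD f≤1

      -- The counting argument only refutes that there is no root; a decidable search below n turns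
      -- this into a witness.
      root? : ∀ z → Dec (IsRoot z)
      root? z = coprime? z n ×-dec ((+ z) ^ᶻ H ≈? -1ℤ)

    solvable : ∃[ g ] ∃[ x ] (QNRNP p g × 1 ≤ x × x ≤ p ∸ 1 × QNRNP p (+ x) × (g ^ᶻ x) ≡ (+ x) [mod p ])
    solvable = decide-root (anyUpTo? root? n)
      where
      decide-root : Dec (∃[ z ] (z < n × IsRoot z)) →
        ∃[ g ] ∃[ x ] (QNRNP p g × 1 ≤ x × x ≤ p ∸ 1 × QNRNP p (+ x) × (g ^ᶻ x) ≡ (+ x) [mod p ])
      decide-root (yes (z , z<n , coprime , zᴴ≈-1)) =
        Root.fixed-point {H = H} p-prime 2<p q-prime (proj₁ (proj₂ q-divisor)) H2q≡n z z<n coprime zᴴ≈-1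
      decide-root (no none) = contradiction (bound (λ z z<n root → none (z , z<n , root)))
        (contradictory M P D l (subst₂ _≤_ (sym b-def) n≡M2P 2^82≤n)
          (factorial-bound qs descending
            (All.map (λ { (r-prime , _) → nonTrivial⇒n>1 _ {{prime⇒nonTrivial r-prime}} }) divisors)))

-- Extracting integer inequalities from the hypotheses on real numbers.

module Reals where

  open import Defs
  open import Algebra.Bundles using (CommutativeRing)
  open import Data.Integer.Base using (+_)
  open import Data.Nat.Base as ℕ using (ℕ; zero; suc; _∸_)
  import Data.Nat.Properties as ℕ
  open import Data.Nat.Primality using (Prime)
  open import Data.Product.Base using (∃-syntax; _×_; _,_)
  open import Data.Rational.Base
  open import Data.Rational.Properties
  open import Data.Rational.Solver using (module +-*-Solver)
  import Data.Rational.Unnormalised.Base as ℚᵘ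
  import Data.Rational.Unnormalised.Properties as ℚᵘ
  open import Data.Unit.Base using (tt)
  open import Relation.Binary.PropositionalEquality
  open import Relation.Nullary.Decidable using (toWitness)
  open import Algebra.Properties.CommutativeSemiring.Exp
    (CommutativeRing.commutativeSemiring +-*-commutativeRing) using (_^_; ^-distrib-*)
  open ℚ-Lemmas
  open +-*-Solver using (solve; _:=_; _:*_)

  -- Links two embeddings of ℕ into ℚ: `fromℕ` is built on fractions, while the arithmetic lemmas
  -- concern the recursive `ι`.
  ι≡/1 : ∀ n → + n / 1 ≡ ι n
  ι≡/1 n = toℚᵘ-injective (ℚᵘ.≃-trans (toℚᵘ-fromℚᵘ (ℚᵘ.mkℚᵘ (+ n) 0)) (ℚᵘ.≃-sym (toℚᵘ-ι n)))

  ι-mono-< : ∀ {m n} → m ℕ.< n → ι m < ι n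
  ι-mono-< {m} {n} m<n = subst (λ k → ι m < ι k) (trans (ℕ.+-suc m (n ∸ suc m)) (ℕ.m+[n∸m]≡n m<n))
    (lt-by (ι-pos (n ∸ suc m)) (ι-+ m (suc (n ∸ suc m))))

  ι-mono-≤ : ∀ {m n} → m ℕ.≤ n → ι m ≤ ι n
  ι-mono-≤ {m} {n} m≤n = subst (λ k → ι m ≤ ι k) (ℕ.m+[n∸m]≡n m≤n)
    (le-by (ι-nonneg (n ∸ m)) (ι-+ m (n ∸ m)))

  ι-cancel-< : ∀ {m n} → ι m < ι n → m ℕ.< n
  ι-cancel-< {m} {n} ιm<ιn = ℕ.≰⇒> (λ n≤m → <-irrefl refl (<-≤-trans ιm<ιn (ι-mono-≤ n≤m)))

  ι-^ : ∀ m k → ι (m ℕ.^ k) ≡ ι m ^ k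
  ι-^ m zero    = refl
  ι-^ m (suc k) = trans (ι-* m (m ℕ.^ k)) (cong (ι m *_) (ι-^ m k))

  fraction-^ : ∀ {y} m n k → y * ι n ≡ ι m → y ^ k * ι (n ℕ.^ k) ≡ ι (m ℕ.^ k)
  fraction-^ {y} m n k yn≡m = begin
    y ^ k * ι (n ℕ.^ k)  ≡⟨ cong (y ^ k *_) (ι-^ n k) ⟩
    y ^ k * ι n ^ k      ≡⟨ ^-distrib-* y (ι n) k ⟨
    (y * ι n) ^ k        ≡⟨ cong (_^ k) yn≡m ⟩
    ι m ^ k              ≡⟨ ι-^ m k ⟨
    ι (m ℕ.^ k)          ∎
    where open ≡-Reasoning

  ι-^-pos : ∀ n k → 0ℚ < ι (suc n ℕ.^ k)
  ι-^-pos n k = subst (0ℚ <_) (sym (ι-^ (suc n) k)) (^-pos k (ι-pos n))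

  -- Clearing denominators turns a comparison with a high rational power into a decidable comparison
  -- of natural numbers. `1<-power` does the same for the upper cut of the exponential.
  <-power : ∀ {y} w m n k → y * ι (suc n) ≡ ι m → w ℕ.* suc n ℕ.^ k ℕ.< m ℕ.^ k → ι w < y ^ k
  <-power {y} w m n k yn≡m w*< = *-cancelʳ-<′ (ι-^-pos n k)
    (subst₂ _<_ (ι-* w (suc n ℕ.^ k)) (sym (fraction-^ m (suc n) k yn≡m)) (ι-mono-< w*<))

  1<-power : ∀ {r y} u v m n k → r * ι (suc v) ≡ ι u → y * ι (suc n) ≡ ι m →
    suc v ℕ.* suc n ℕ.^ k ℕ.< u ℕ.* m ℕ.^ k → 1ℚ < r * y ^ k
  1<-power {r} {y} u v m n k rv≡u yn≡m v*<u* = *-cancelʳ-<′ (*-pos (ι-pos v) (ι-^-pos n k))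
    (subst₂ _<_
      (trans (ι-* (suc v) (suc n ℕ.^ k)) (sym (*-identityˡ _)))
      (trans (ι-* u (m ℕ.^ k)) (trans (sym (cong₂ _*_ rv≡u (fraction-^ m (suc n) k yn≡m)))
        (ring r (ι (suc v)) (y ^ k) (ι (suc n ℕ.^ k)))))
      (ι-mono-< v*<u*))
    where
    ring : ∀ r v y n → r * v * (y * n) ≡ r * y * (v * n)
    ring = solve 4 (λ r v y n → r :* v :* (y :* n) := r :* y :* (v :* n)) refl

  -- Chains u < e^c < e^q < r. Used twice, it strips the two logarithms off p.
  exp-lower : ∀ {c q u r} → c < q → L (expℚ c) u → U (expℚ q) r → u < r
  exp-lower {c} {q} {u} {r} c<q Lu Ur = through (expℚ-mono c<q)
    where
    through : expℚ c <ℝ expℚ q → u < r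
    through (v , Uv , Lv) = <-trans (L<U (expℚ c) Lu Uv) (L<U (expℚ q) Lv Ur)

  -- The upper bound (1 - 1/10)^(-18) for e^(9/5), with n = 18 because (9/5)/18 = 1/10, is about
  -- 6.66; the separating rational 34/5 = 6.8 lies between it and 6.83.
  9/5<log6·83 : L (log (fromℚ (+ 683 / 100)) 0<6·83) (+ 9 / 5)
  9/5<log6·83 = + 34 / 5 ,
    (17 , subst (0ℚ <_) (sym base) (positive⁻¹ (+ 9 / 10)) ,
      subst (λ z → 1ℚ < + 34 / 5 * z ^ 18) (sym base)
        (1<-power {+ 34 / 5} {+ 9 / 10} 34 4 9 9 18 refl refl (toWitness {a? = 5 ℕ.* 10 ℕ.^ 18 ℕ.<? 34 ℕ.* 9 ℕ.^ 18} tt))) ,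
    toWitness {a? = + 34 / 5 <? + 683 / 100} tt
    where
    base : 1ℚ - + 9 / 5 * inv 17 ≡ + 9 / 10
    base = cong (λ z → 1ℚ - + 9 / 5 * z) (inv-def 17)

  -- n = 44 makes the base 1 + (22/5)/44 = 11/10, and (11/10)^44 is slightly above 66.
  66<exp : L (expℚ (+ 22 / 5)) (ι 66)
  66<exp = 43 , subst (0ℚ <_) (sym base) (positive⁻¹ (+ 11 / 10)) ,
    subst (λ z → ι 66 < z ^ 44) (sym base)
      (<-power {+ 11 / 10} 66 11 9 44 refl (toWitness {a? = 66 ℕ.* 10 ℕ.^ 44 ℕ.<? 11 ℕ.^ 44} tt))
    where
    base : 1ℚ + + 22 / 5 * inv 43 ≡ + 11 / 10
    base = cong (λ z → 1ℚ + + 22 / 5 * z) (inv-def 43)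

  -- n = 330 makes the base 1 + 66/330 = 6/5. The bound `w` stays a variable so that the recursive
  -- `ι` never meets the numeral 2^82.
  <exp66 : ∀ w → w ℕ.* 5 ℕ.^ 330 ℕ.< 6 ℕ.^ 330 → L (expℚ (ι 66)) (ι w)
  <exp66 w w*< = 329 , subst (0ℚ <_) (sym base) (positive⁻¹ (+ 6 / 5)) ,
    subst (λ z → ι w < z ^ 330) (sym base) (<-power {+ 6 / 5} w 6 4 330 refl w*<)
    where
    base : 1ℚ + ι 66 * inv 329 ≡ + 6 / 5
    base = cong (λ z → 1ℚ + ι 66 * z) (inv-def 329)

  module _ (ε : ℝ) (1/11≤ε : fromℚ (+ 1 / 11) ≤ℝ ε) where

    -- 9/22 = 1/2 - 1/11. The upper approximation `t` of ε is at least 1/11, as otherwise it would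
    -- lie in both cuts of ε.
    below-½-ε : ∀ {q} → L (fromℚ ½ -ℝ ε) q → q < + 9 / 22
    below-½-ε {q} (t , Ut , q+t<½) = shiftʳ q (+ 1 / 11) ½ (≤-<-trans (+-monoʳ-≤ q 1/11≤t) q+t<½)
      where
      1/11≤t : + 1 / 11 ≤ t
      1/11≤t = ≮⇒≥ (λ t<1/11 → disjoint ε (1/11≤ε t t<1/11) Ut)

    -- If 9 n < 22 f, then 9/22 itself belongs to the lower cut of the quotient, hence to that of
    -- 1/2 - ε, and `below-½-ε` yields 9/22 < 9/22.
    ratio-bound : ∀ f n (0<n : 0ℝ <ℝ fromℕ n) → fromℕ f /ℝ fromℕ n [ 0<n ] ≤ℝ fromℚ ½ -ℝ ε →
      22 ℕ.* f ℕ.≤ 9 ℕ.* n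
    ratio-bound f n 0<n quotient≤ = ℕ.≮⇒≥ (λ 9n<22f →
      <-irrefl refl (below-½-ε (quotient≤ (+ 9 / 22) (exceeds 9n<22f))))
      where
      scaled : 9 ℕ.* n ℕ.< 22 ℕ.* f → + n / 1 * (+ 9 / 22) < + f / 1
      scaled 9n<22f = *-cancelʳ-<′ (ι-pos 21) (subst₂ _<_
        (trans (ι-* 9 n) (trans (cong₂ (λ a b → a * b) {ι 9} {(+ 9 / 22) * ι 22} refl (sym (ι≡/1 n)))
          (ring (+ 9 / 22) (ι 22) (+ n / 1))))
        (trans (ι-* 22 f) (trans (*-comm (ι 22) (ι f)) (cong (_* ι 22) (sym (ι≡/1 f)))))
        (ι-mono-< 9n<22f))
        where
        ring : ∀ c d x → c * d * x ≡ x * c * d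
        ring = solve 3 (λ c d x → c :* d :* x := x :* c :* d) refl
      exceeds : 9 ℕ.* n ℕ.< 22 ℕ.* f → L (fromℕ f /ℝ fromℕ n [ 0<n ]) (+ 9 / 22)
      exceeds 9n<22f = go 0<n (<-dense (scaled 9n<22f))
        where
        go : (0<n : 0ℝ <ℝ fromℕ n) → ∃[ a ] (+ n / 1 * (+ 9 / 22) < a × a < + f / 1) →
          L (fromℕ f /ℝ fromℕ n [ 0<n ]) (+ 9 / 22)
        -- Membership in the cut of a quotient asks for an interval around the denominator, so n is
        -- enlarged to some t with t · 9/22 still below `a`; the lower end s comes from the
        -- positivity proof.
        go (s , 0<s , s<n) (a , n9/22<a , a<f) =
          let t , n<t , t9/22<a = Division-Lemmas.scale-openʳ {+ n / 1} {+ 9 / 22} (positive⁻¹ (+ 9 / 22)) n9/22<a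
          in a , s , t , a<f , s<n , n<t , 0<s ,
             <-trans (subst (_< t * (+ 9 / 22)) (*-comm s (+ 9 / 22))
               (*-monoˡ-<′ (positive⁻¹ (+ 9 / 22)) (<-trans s<n n<t))) t9/22<a ,
             subst (_< a) (*-comm t (+ 9 / 22)) t9/22<a

    -- Since e^(9/5) < 6.83 and 1/2 - ε ≤ 9/22, log log p > 22/5; hence log p > e^(22/5) > 66
    -- and p > e^66 > (6/5)^330.
    prime-bound : ∀ w → w ℕ.* 5 ℕ.^ 330 ℕ.< 6 ℕ.^ 330 → (ε<½ : ε <ℝ fromℚ ½) → (p : ℕ) (p-prime : Prime p) →
      log (fromℚ (+ 683 / 100)) 0<6·83 /ℝ (fromℚ ½ -ℝ ε) [ <⇒0<- {ε} {fromℚ ½} ε<½ ]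
        <ℝ log (log (fromℕ p) (0<p p-prime)) (0<log-p p-prime) →
      w ℕ.< p
    prime-bound w w*< ε<½ p p-prime
      (q , (a , s , t , Ua , Ls , Ut , 0<s , a<qs , a<qt) , (r , Ur , (v , Uv , v<p))) =
      ι-cancel-< (<-trans (exp-lower 66<r (<exp66 w w*<) Uv) (subst (v <_) (ι≡/1 p) v<p))
      where
      9/5<qs : + 9 / 5 < q * s
      9/5<qs = <-trans (L<U (log (fromℚ (+ 683 / 100)) 0<6·83) 9/5<log6·83 Ua) a<qs
      0<q : 0ℚ < q
      0<q = *-cancelʳ-<′ 0<s (subst (_< q * s) (sym (*-zeroˡ s)) (<-trans (positive⁻¹ (+ 9 / 5)) 9/5<qs))
      22/5<q : + 22 / 5 < q
      22/5<q = *-cancelʳ-<′ {+ 9 / 22} (positive⁻¹ (+ 9 / 22))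
        (<-trans 9/5<qs (*-monoʳ-<′ 0<q (below-½-ε Ls)))
      66<r : ι 66 < r
      66<r = exp-lower 22/5<q 66<exp Ur

-- The theorem.

open import Defs
open import Data.Integer.Base using (ℤ; +_; _^_)
open import Data.Nat.Base using (ℕ; _∸_; _≤_)
open import Data.Nat.Primality using (Prime)
open import Data.Product.Base using (∃-syntax; _×_)
open import Data.Rational.Base using (½; _/_)
import Data.Nat.Base as ℕ
import Data.Nat.Properties as ℕ
open import Data.Unit.Base using (tt)
open import Relation.Nullary.Decidable using (toWitness)

corollary1p1 :
    (ε : ℝ) → fromℚ (+ 1 / 11) ≤ℝ ε → (ε<½ : ε <ℝ fromℚ ½) →
    (p : ℕ) (p-prime : Prime p) →
    log (fromℚ (+ 683 / 100)) 0<6·83 /ℝ (fromℚ ½ -ℝ ε) [ <⇒0<- {ε} {fromℚ ½} ε<½ ]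
      <ℝ log (log (fromℕ p) (0<p p-prime)) (0<log-p p-prime) →
    fromℕ (φ (p ∸ 1)) /ℝ fromℕ (p ∸ 1) [ 0<p-1 p-prime ] ≤ℝ fromℚ ½ -ℝ ε →
    ∃[ g ] ∃[ x ] (QNRNP p g × 1 ≤ x × x ≤ p ∸ 1 × QNRNP p (+ x) ×
                   (g ^ x) ≡ (+ x) [mod p ])
corollary1p1 ε 1/11≤ε ε<½ p p-prime log-bound φ-bound = Existence.solvable p-prime
  (Reals.prime-bound ε 1/11≤ε (2 ℕ.^ 82)
    -- (6/5)^330 is about 2^86.8, which leaves room above 2^82.
    (toWitness {a? = 2 ℕ.^ 82 ℕ.* 5 ℕ.^ 330 ℕ.<? 6 ℕ.^ 330} tt) ε<½ p p-prime log-bound)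
  (Reals.ratio-bound ε 1/11≤ε (φ (p ∸ 1)) (p ∸ 1) (0<p-1 p-prime) φ-bound)
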